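{- For fixed integers $s\ge 1$ and $k\ge 2$, we have, uniformly for integers $n\ge 1$ and $u_1,\dots,u_{k-1}\ge 1$ with $\gcd(u_i,u_j)=1$ for $1\le i\ne j\le k-1$, $$Q_{s,k}^{(u)}(n) = A_{s,k}\Big(\prod_{i=1}^{k-1} f_{s,k,i}(u_i)\Big) n^s + O\big(\theta(u_1)\, n^{s-1} \log^{\delta(s,k)} n\big),$$ where $$A_{s,k}=\prod_{p}\left[\left(1-\frac1p\right)^{s-k+1}\sum_{m=0}^{k-1}\binom{s}{m}\left(1-\frac1p\right)^{k-1-m}\frac{1}{p^m}\right]$$ (product over all primes $p$), $$f_{s,k,i}(u_i)=\prod_{p\mid u_i}\left(1-\frac{\sum_{m=i}^{k-1}\binom{s}{m}(p-1)^{k-1-m}}{\sum_{m=0}^{k-1}\binom{s}{m}(p-1)^{k-1-m}}\right)$$ (product over the primes $p$ dividing $u_i$), $$\delta(s,k)=\max\left\{\binom{s-1}{i} : i=1,2,\dots,k-1\right\},$$ and $\theta(u_1)$ is the number of squarefree divisors of $u_1$.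
   Context: Positive integers $a_1,\dots,a_s$ are called $k$-wise relatively prime if any $k$ of them are relatively prime, i.e. the greatest common divisor of any $k$ of them (any $k$ distinct indices) is $1$ (a vacuous condition if $k>s$). They are called $i$-wise relatively prime to a positive integer $a$ if the gcd of any $i$ of them (any $i$ distinct indices) is relatively prime to $a$ (vacuous if $i>s$). For a $(k-1)$-tuple of positive integers $u=(u_1,\dots,u_{k-1})$, $Q_{s,k}^{(u)}(n)$ denotes the number of $s$-tuples $(a_1,\dots,a_s)$ of positive integers with $1\le a_1,\dots,a_s\le n$ such that $a_1,\dots,a_s$ are $k$-wise relatively prime and are $i$-wise relatively prime to $u_i$ for each $i=1,2,\dots,k-1$. Here $\log^{\delta} n$ means $(\log n)^{\delta}$, and $\binom{a}{b}=0$ if $b>a\ge 0$. "Uniformly" means that the constant implied by the $O$-symbol depends only on $s$ and $k$, not on $n$ or the $u_i$.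
   Formalization: The case n = 1 is excluded when δ(s,k) > 0 (i.e. s ≥ 2): there log n = 0 makes the error term vanish and the claim is false, e.g. s = k = 2, u_1 = 1 would give 1 = 6/π². -}

module Defs where

open import Algebra.Definitions.RawSemiring using () renaming (_^_ to pow)
open import Data.Fin using (Fin; zero; toℕ)
import Data.Fin.Properties as Fin
open import Data.Fin.Subset using (Subset; inside; outside; ∣_∣)
open import Data.Fin.Subset.Properties using (anySubset?)
open import Data.Integer using (ℤ; +_; -[1+_]; 1ℤ)
import Data.Integer as ℤ
import Data.Integer.Properties as ℤ
open import Data.List using (List; []; _∷_; map; upTo; filter; length; foldr; cartesianProductWith; tabulate)
open import Data.Nat using (ℕ; zero; suc; s≤s; z≤n; NonZero; NonTrivial; _∸_)
import Data.Nat as ℕ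
open import Data.Nat.Combinatorics using (_C_; nCk≡nC[n∸k]; nCn≡1)
open import Data.Nat.Coprimality using (Coprime; coprime?)
open import Data.Nat.Divisibility using (_∣_; _∣?_; divides; ∣⇒≤)
open import Data.Nat.GCD using (gcd)
open import Data.Nat.Primality using (prime?; prime⇒nonTrivial)
import Data.Nat.Properties as ℕ
open import Data.Product using (_×_; _,_; ∃)
open import Data.Rational
  using (ℚ; mkℚ; 0ℚ; 1ℚ; ½; _/_; _+_; _-_; -_; _*_; 1/_; _≤_; _<_; *≤*; *<*)
import Data.Rational as ℚ
import Data.Rational.Properties as ℚ
open import Data.Rational.Solver using (module +-*-Solver)
open import Data.Rational.Unnormalised using (mkℚᵘ)
import Data.Rational.Unnormalised as ℚᵘ
import Data.Rational.Unnormalised.Properties as ℚᵘ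
open import Data.Sum using (inj₁; inj₂)
open import Data.Unit using (⊤; tt)
open import Data.Vec using (Vec; []; _∷_)
open import Relation.Binary.PropositionalEquality
open import Relation.Nullary using (Dec; yes; no; contradiction)
open import Relation.Nullary.Decidable using (map′; decidable-stable; _×-dec_; _→-dec_; ¬?)
open import Relation.Unary using (Decidable)

------------------------------------------------------------------------
-- Elementary number theory

-- i , i + 1 , … , j  (empty when j < i)
_⋯_ : ℕ → ℕ → List ℕ
i ⋯ j = map (i ℕ.+_) (upTo (suc j ∸ i))

sumℕ maxℕ : List ℕ → ℕ
sumℕ = foldr ℕ._+_ 0
maxℕ = foldr ℕ._⊔_ 0

Squarefree : ℕ → Set
Squarefree m = ∀ d → d ℕ.* d ∣ m → d ≡ 1

squarefree? : Decidable Squarefree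
squarefree? zero = no λ sf → contradiction (sf 2 (divides 0 refl)) λ ()
squarefree? m@(suc _) = map′ to from (ℕ.allUpTo? P? (suc m))
  where
  P? : ∀ d → Dec (d ℕ.* d ∣ m → d ≡ 1)
  P? d = (d ℕ.* d ∣? m) →-dec (d ℕ.≟ 1)

  d≤d*d : ∀ d → d ℕ.≤ d ℕ.* d
  d≤d*d zero    = z≤n
  d≤d*d (suc d) = ℕ.m≤m*n (suc d) (suc d)

  to : (∀ {d} → d ℕ.< suc m → d ℕ.* d ∣ m → d ≡ 1) → Squarefree m
  to h d d²∣m = h (s≤s (ℕ.≤-trans (d≤d*d d) (∣⇒≤ d²∣m))) d²∣m

  from : Squarefree m → ∀ {d} → d ℕ.< suc m → d ℕ.* d ∣ m → d ≡ 1
  from sf {d} _ = sf d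

-- number of squarefree divisors (of m ≥ 1)
θ : ℕ → ℕ
θ m = length (filter (λ d → (d ∣? m) ×-dec squarefree? d) (1 ⋯ m))

------------------------------------------------------------------------
-- The counting function

private variable s : ℕ

-- gcd of the entries a_j with j ∈ I  (0 when I is empty)
gcdOver : Vec ℕ s → Subset s → ℕ
gcdOver []       []            = 0
gcdOver (a ∷ as) (inside  ∷ I) = gcd a (gcdOver as I)
gcdOver (a ∷ as) (outside ∷ I) = gcdOver as I

WiseCoprime : ℕ → Vec ℕ s → Set
WiseCoprime {s} k a = (I : Subset s) → ∣ I ∣ ≡ k → gcdOver a I ≡ 1

WiseCoprimeTo : ℕ → Vec ℕ s → ℕ → Set
WiseCoprimeTo {s} i a u = (I : Subset s) → ∣ I ∣ ≡ i → Coprime (gcdOver a I) u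

-- The tuple u = (u_1 , … , u_{k-1}) is indexed by Fin (k ∸ 1), so that
-- u i is the entry usually written u_{suc (toℕ i)}.
Admissible : (s k : ℕ) → (Fin (k ∸ 1) → ℕ) → Vec ℕ s → Set
Admissible s k u a = WiseCoprime k a × (∀ i → WiseCoprimeTo (suc (toℕ i)) a (u i))

allSubset? : ∀ {P : Subset s → Set} → Decidable P → Dec (∀ I → P I)
allSubset? P? with anySubset? (λ I → ¬? (P? I))
... | yes (I , ¬P) = no λ h → ¬P (h I)
... | no  ¬∃¬P     = yes λ I → decidable-stable (P? I) λ ¬P → ¬∃¬P (I , ¬P)

admissible? : ∀ s k u → Decidable (Admissible s k u)
admissible? s k u a =
  allSubset? (λ I → (∣ I ∣ ℕ.≟ k) →-dec (gcdOver a I ℕ.≟ 1))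
  ×-dec Fin.all? λ i →
    allSubset? (λ I → (∣ I ∣ ℕ.≟ suc (toℕ i)) →-dec coprime? (gcdOver a I) (u i))

tuples : (s : ℕ) → List ℕ → List (Vec ℕ s)
tuples zero    xs = [] ∷ []
tuples (suc s) xs = cartesianProductWith _∷_ xs (tuples s xs)

Q : (s k : ℕ) → (Fin (k ∸ 1) → ℕ) → ℕ → ℕ
Q s k u n = length (filter (admissible? s k u) (tuples s (1 ⋯ n)))

δ : ℕ → ℕ → ℕ
δ s k = maxℕ (map (λ i → (s ∸ 1) C i) (1 ⋯ (k ∸ 1)))

first : ∀ {k} → 2 ℕ.≤ k → Fin (k ∸ 1)
first (s≤s (s≤s z≤n)) = zero

------------------------------------------------------------------------
-- Rational arithmetic

infixr 8 _^_ _^ℤ_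

_^_ : ℚ → ℕ → ℚ
_^_ = pow ℚ.+-*-rawSemiring

_^ℤ_ : (q : ℚ) .{{_ : ℚ.NonZero q}} → ℤ → ℚ
q ^ℤ (+ n)    = q ^ n
q ^ℤ -[1+ n ] = (1/ q) ^ suc n

fromℕ : ℕ → ℚ
fromℕ n = + n / 1

sumℚ productℚ : List ℚ → ℚ
sumℚ     = foldr _+_ 0ℚ
productℚ = foldr _*_ 1ℚ

module Identities where
  open +-*-Solver

  +-cancel : ∀ r q → r + q - q ≡ r
  +-cancel = solve 2 (λ r q → r :+ q :- q := r) refl

  minus-cancel : ∀ p q → p - q + q ≡ p
  minus-cancel = solve 2 (λ p q → p :- q :+ q := p) refl

  neg-minus : ∀ p q → - (p - q) ≡ q - p
  neg-minus = solve 2 (λ p q → :- (p :- q) := q :- p) refl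

  minus-interchange : ∀ a b c d → (a - b) - (c - d) ≡ (a - c) - (b - d)
  minus-interchange = solve 4 (λ a b c d → (a :- b) :- (c :- d) := (a :- c) :- (b :- d)) refl

  product-diff : ∀ a b c d → a * (c - d) + (a - b) * d ≡ a * c - b * d
  product-diff = solve 4 (λ a b c d → a :* (c :- d) :+ (a :- b) :* d := a :* c :- b :* d) refl

  factor-out : ∀ e i a b → a * (e * i) + (e * i) * b ≡ e * (i * (a + b))
  factor-out = solve 4 (λ e i a b → a :* (e :* i) :+ (e :* i) :* b := e :* (i :* (a :+ b))) refl

  *-swap : ∀ a b c → b * (a * c) ≡ a * b * c
  *-swap = solve 3 (λ a b c → b :* (a :* c) := a :* b :* c) refl

  *-one-minus : ∀ a b → a * (1ℚ - b) ≡ a - a * b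
  *-one-minus = solve 2 (λ a b → a :* (con 1ℚ :- b) := a :- a :* b) refl

  reassoc : ∀ s y r a x → s + y * r + a * (x * y) * r ≡ s + y * r + (a * x) * y * r
  reassoc = solve 5 (λ s y r a x → s :+ y :* r :+ a :* (x :* y) :* r := s :+ y :* r :+ (a :* x) :* y :* r) refl

  absorb : ∀ s y r a → s + y * r + (a - 1ℚ) * y * r ≡ s + a * y * r
  absorb = solve 4 (λ s y r a → s :+ y :* r :+ (a :- con 1ℚ) :* y :* r := s :+ a :* y :* r) refl

open Identities

toℚᵘ-/ : ∀ a b → ℚ.toℚᵘ (+ a / suc b) ℚᵘ.≃ mkℚᵘ (+ a) b
toℚᵘ-/ a b = ℚ.toℚᵘ-fromℚᵘ (mkℚᵘ (+ a) b)

/-≤ : ∀ a b c d → a ℕ.* suc d ℕ.≤ c ℕ.* suc b → + a / suc b ≤ + c / suc d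
/-≤ a b c d h = ℚ.toℚᵘ-cancel-≤
  (ℚᵘ.≤-respˡ-≃ (ℚᵘ.≃-sym (toℚᵘ-/ a b)) (ℚᵘ.≤-respʳ-≃ (ℚᵘ.≃-sym (toℚᵘ-/ c d))
    (ℚᵘ.*≤* (subst₂ ℤ._≤_ (ℤ.pos-* a (suc d)) (ℤ.pos-* c (suc b)) (ℤ.+≤+ h)))))

/-< : ∀ a b c d → a ℕ.* suc d ℕ.< c ℕ.* suc b → + a / suc b < + c / suc d
/-< a b c d h = ℚ.toℚᵘ-cancel-<
  (ℚᵘ.<-respˡ-≃ (ℚᵘ.≃-sym (toℚᵘ-/ a b)) (ℚᵘ.<-respʳ-≃ (ℚᵘ.≃-sym (toℚᵘ-/ c d))
    (ℚᵘ.*<* (subst₂ ℤ._<_ (ℤ.pos-* a (suc d)) (ℤ.pos-* c (suc b)) (ℤ.+<+ h)))))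

/-* : ∀ a c d → fromℕ a * (+ c / suc d) ≡ + (a ℕ.* c) / suc d
/-* a c d = ℚ.toℚᵘ-injective
  (ℚᵘ.≃-trans (ℚ.toℚᵘ-homo-* (fromℕ a) (+ c / suc d))
  (ℚᵘ.≃-trans (ℚᵘ.*-cong (toℚᵘ-/ a 0) (toℚᵘ-/ c d))
  (ℚᵘ.≃-trans (ℚᵘ.*≡* (cong₂ ℤ._*_ (sym (ℤ.pos-* a c)) (cong +_ (sym (ℕ.+-identityʳ (suc d))))))
              (ℚᵘ.≃-sym (toℚᵘ-/ (a ℕ.* c) d)))))

n*1/n : ∀ n → fromℕ (suc n) * (+ 1 / suc n) ≡ 1ℚ
n*1/n n = trans (/-* (suc n) 1 n) (ℚ.fromℚᵘ-cong {mkℚᵘ (+ (suc n ℕ.* 1)) n} {mkℚᵘ (+ 1) 0}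
  (ℚᵘ.*≡* (cong +_ (trans (ℕ.*-identityʳ (suc n ℕ.* 1)) (trans (ℕ.*-identityʳ (suc n)) (sym (ℕ.+-identityʳ (suc n))))))))

0≤q-p : ∀ p q → p ≤ q → 0ℚ ≤ q - p
0≤q-p p q p≤q = subst (_≤ q - p) (ℚ.+-inverseʳ p) (ℚ.+-monoˡ-≤ (- p) p≤q)

1-1/_ : (p : ℕ) .{{_ : NonZero p}} → ℚ
1-1/ p = 1ℚ - + 1 / p

1-1/p-nonZero : ∀ p .{{_ : NonTrivial p}} → ℚ.NonZero ((1-1/ p) {{ℕ.nonTrivial⇒nonZero p}})
1-1/p-nonZero (suc (suc p)) = ℚ.>-nonZero
  (subst (_< 1-1/ suc (suc p)) (ℚ.+-inverseʳ r)
    (ℚ.+-monoˡ-< (- r) (/-< 1 (suc p) 1 0 (s≤s (s≤s z≤n)))))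
  where r = + 1 / suc (suc p)

------------------------------------------------------------------------
-- Products over primes

-- ∏ g(p) over the primes p ≤ N satisfying P
primeProduct : {P : ℕ → Set} → Decidable P →
               ((p : ℕ) .{{_ : NonTrivial p}} → ℚ) → ℕ → ℚ
primeProduct P? g zero    = 1ℚ
primeProduct P? g (suc N) with prime? (suc N) ×-dec P? (suc N)
... | yes (p , _) = g (suc N) {{prime⇒nonTrivial p}} * primeProduct P? g N
... | no  _       = primeProduct P? g N

-- ∑_{m=i}^{k-1} binom(s,m) (p-1)^{k-1-m}
W : (s k i p : ℕ) → ℕ
W s k i p = sumℕ (map (λ m → (s C m) ℕ.* (p ∸ 1) ℕ.^ (k ∸ 1 ∸ m)) (i ⋯ (k ∸ 1)))

W-nonZero : ∀ s k p .{{_ : NonTrivial p}} → NonZero (W s k 0 p)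
W-nonZero s k (suc (suc p)) = ℕ.>-nonZero
  (ℕ.≤-trans (ℕ.*-mono-≤ {1} {s C 0} {1} (ℕ.≤-reflexive (sym sC0≡1)) (ℕ.m^n>0 (suc p) (k ∸ 1)))
             (ℕ.m≤m+n ((s C 0) ℕ.* suc p ℕ.^ (k ∸ 1)) _))
  where
  sC0≡1 : s C 0 ≡ 1
  sC0≡1 = trans (nCk≡nC[n∸k] {0} {s} z≤n) (nCn≡1 s)

f : (s k i u : ℕ) → ℚ
f s k i u = primeProduct (_∣? u) (λ p → 1ℚ - (+ W s k i p / W s k 0 p) {{W-nonZero s k p}}) u

∏f : (s k : ℕ) → (Fin (k ∸ 1) → ℕ) → ℚ
∏f s k u = productℚ (tabulate λ i → f s k (suc (toℕ i)) (u i))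

-- the factor at p of the product defining A_{s,k}
A-factor : (s k p : ℕ) .{{_ : NonTrivial p}} → ℚ
A-factor s k p =
  (1-1/ p) ^ℤ (+ s ℤ.- + k ℤ.+ 1ℤ) *
  sumℚ (map (λ m → fromℕ (s C m) * (1-1/ p) ^ (k ∸ 1 ∸ m) * (+ 1 / p) ^ m) (0 ⋯ (k ∸ 1)))
  where instance
    _ = ℕ.nonTrivial⇒nonZero p
    _ = 1-1/p-nonZero p

------------------------------------------------------------------------
-- Real numbers, as Cauchy sequences of rationals

IsCauchy : (ℕ → ℚ) → Set
IsCauchy x = ∀ ε → 0ℚ < ε → ∃ λ N → ∀ m n → N ℕ.≤ m → N ℕ.≤ n → ℚ.∣ x m - x n ∣ ≤ ε

record ℝ : Set where
  constructor mkℝ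
  field
    approx : ℕ → ℚ
    cauchy : IsCauchy approx

open ℝ

infix  4 _≤ʳ_
infixl 6 _-ʳ_
infixl 7 _*ʳ_
infixr 8 _^ʳ_

_≤ʳ_ : ℝ → ℝ → Set
x ≤ʳ y = ∀ ε → 0ℚ < ε → ∃ λ N → ∀ n → N ℕ.≤ n → approx x n ≤ approx y n + ε

≤⊔ˡ : ∀ {M N m} → M ℕ.⊔ N ℕ.≤ m → M ℕ.≤ m
≤⊔ˡ {M} {N} = ℕ.≤-trans (ℕ.m≤m⊔n M N)

≤⊔ʳ : ∀ {M N m} → M ℕ.⊔ N ℕ.≤ m → N ℕ.≤ m
≤⊔ʳ {M} {N} = ℕ.≤-trans (ℕ.m≤n⊔m M N)

0<p*q : ∀ {p q} → 0ℚ < p → 0ℚ < q → 0ℚ < p * q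
0<p*q {p} {q} 0<p 0<q = ℚ.positive⁻¹ (p * q)
  {{ℚ.pos*pos⇒pos p {{ℚ.positive 0<p}} q {{ℚ.positive 0<q}}}}

∣p∣≤q : ∀ {p q} → p ≤ q → - p ≤ q → ℚ.∣ p ∣ ≤ q
∣p∣≤q {p} p≤q -p≤q with ℚ.∣p∣≡p∨∣p∣≡-p p
... | inj₁ eq = subst (_≤ _) (sym eq) p≤q
... | inj₂ eq = subst (_≤ _) (sym eq) -p≤q

p-q≤r : ∀ p q {r} → p ≤ r + q → p - q ≤ r
p-q≤r p q {r} h = subst (p - q ≤_)
  (+-cancel r q) (ℚ.+-monoˡ-≤ (- q) h)

∣p-q∣-sym : ∀ p q → ℚ.∣ p - q ∣ ≡ ℚ.∣ q - p ∣
∣p-q∣-sym p q = trans (sym (ℚ.∣-p∣≡∣p∣ (p - q)))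
  (cong ℚ.∣_∣ (neg-minus p q))

∣p∣-∣q∣≤∣p-q∣ : ∀ p q → ℚ.∣ p ∣ - ℚ.∣ q ∣ ≤ ℚ.∣ p - q ∣
∣p∣-∣q∣≤∣p-q∣ p q = p-q≤r ℚ.∣ p ∣ ℚ.∣ q ∣ (subst (λ r → ℚ.∣ r ∣ ≤ ℚ.∣ p - q ∣ + ℚ.∣ q ∣)
  (minus-cancel p q) (ℚ.∣p+q∣≤∣p∣+∣q∣ (p - q) q))

∣∣*-mono : ∀ p q {P R} → 0ℚ < P → ℚ.∣ p ∣ ≤ P → ℚ.∣ q ∣ ≤ R → ℚ.∣ p * q ∣ ≤ P * R
∣∣*-mono p q {P} {R} 0<P p≤P q≤R = subst (_≤ P * R) (sym (ℚ.∣p*q∣≡∣p∣*∣q∣ p q))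
  (ℚ.≤-trans (ℚ.*-monoʳ-≤-nonNeg ℚ.∣ q ∣ {{ℚ.∣-∣-nonNeg q}} p≤P)
             (ℚ.*-monoˡ-≤-nonNeg P {{ℚ.pos⇒nonNeg P {{ℚ.positive 0<P}}}} q≤R))

∣product-diff∣ : ∀ a b c d {P R η} → 0ℚ < P → 0ℚ < η →
                 ℚ.∣ a ∣ ≤ P → ℚ.∣ c - d ∣ ≤ η → ℚ.∣ a - b ∣ ≤ η → ℚ.∣ d ∣ ≤ R →
                 ℚ.∣ a * c - b * d ∣ ≤ P * η + η * R
∣product-diff∣ a b c d {P} {R} {η} 0<P 0<η a≤ cd≤ ab≤ d≤ =
  subst (λ r → ℚ.∣ r ∣ ≤ P * η + η * R) (product-diff a b c d)
    (ℚ.≤-trans (ℚ.∣p+q∣≤∣p∣+∣q∣ (a * (c - d)) ((a - b) * d))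
      (ℚ.+-mono-≤ (∣∣*-mono a (c - d) 0<P a≤ cd≤) (∣∣*-mono (a - b) d 0<η ab≤ d≤)))

split : ∀ ε a b → 0ℚ < ε → 0ℚ < a → 0ℚ < b → ∃ λ η → 0ℚ < η × a * η + η * b ≡ ε
split ε a b 0<ε 0<a 0<b =
    ε * 1/ B
  , 0<p*q 0<ε (ℚ.positive⁻¹ (1/ B) {{ℚ.1/pos⇒pos B}})
  , trans (factor-out ε (1/ B) a b) (trans (cong (ε *_) (ℚ.*-inverseˡ B)) (ℚ.*-identityʳ ε))
  where
  B = a + b
  instance
    _ = ℚ.positive (ℚ.+-mono-< 0<a 0<b)
    _ = ℚ.pos⇒nonZero B

bounded : ∀ x → ∃ λ B → 0ℚ < B × ∃ λ N → ∀ n → N ℕ.≤ n → ℚ.∣ approx x n ∣ ≤ B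
bounded x with cauchy x 1ℚ (*<* (ℤ.+<+ (s≤s z≤n)))
... | N , c = 1ℚ + ℚ.∣ y ∣
            , ℚ.<-≤-trans (*<* (ℤ.+<+ (s≤s z≤n)))
                (subst (_≤ 1ℚ + ℚ.∣ y ∣) (ℚ.+-identityʳ 1ℚ) (ℚ.+-monoʳ-≤ 1ℚ (ℚ.0≤∣p∣ y)))
            , N , λ n N≤n → subst (λ r → ℚ.∣ r ∣ ≤ 1ℚ + ℚ.∣ y ∣)
                (minus-cancel (approx x n) y)
                (ℚ.≤-trans (ℚ.∣p+q∣≤∣p∣+∣q∣ (approx x n - y) y)
                  (ℚ.+-monoˡ-≤ ℚ.∣ y ∣ (c n N N≤n ℕ.≤-refl)))
  where
  y = approx x N

fromℚ : ℚ → ℝ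
fromℚ q = mkℝ (λ _ → q) λ ε 0<ε → 0 , λ _ _ _ _ →
  subst (_≤ ε) (sym (cong ℚ.∣_∣ (ℚ.+-inverseʳ q))) (ℚ.<⇒≤ 0<ε)

_-ʳ_ : ℝ → ℝ → ℝ
x -ʳ y = mkℝ (λ n → approx x n - approx y n) proof
  where
  proof : IsCauchy (λ n → approx x n - approx y n)
  proof ε 0<ε with cauchy x (ε * ½) (0<p*q 0<ε (ℚ.positive⁻¹ ½))
                 | cauchy y (ε * ½) (0<p*q 0<ε (ℚ.positive⁻¹ ½))
  ... | M , cx | N , cy = M ℕ.⊔ N , λ m n hm hn →
    let xm = approx x m; xn = approx x n; ym = approx y m; yn = approx y n in
    subst₂ _≤_
      (cong ℚ.∣_∣ (minus-interchange xm xn ym yn))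
      (trans (sym (ℚ.*-distribˡ-+ ε ½ ½)) (ℚ.*-identityʳ ε))
      (ℚ.≤-trans (ℚ.∣p-q∣≤∣p∣+∣q∣ (xm - xn) (ym - yn))
        (ℚ.+-mono-≤ (cx m n (≤⊔ˡ hm) (≤⊔ˡ hn)) (cy m n (≤⊔ʳ hm) (≤⊔ʳ hn))))

_*ʳ_ : ℝ → ℝ → ℝ
x *ʳ y = mkℝ (λ n → approx x n * approx y n) λ ε 0<ε →
  let (Bx , 0<Bx , M , bx) = bounded x
      (By , 0<By , N , by) = bounded y
      (η , 0<η , eq)       = split ε Bx By 0<ε 0<Bx 0<By
      (M′ , cx)            = cauchy x η 0<η
      (N′ , cy)            = cauchy y η 0<η
  in (M ℕ.⊔ M′) ℕ.⊔ (N ℕ.⊔ N′) , λ m n hm hn →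
    ℚ.≤-trans
      (∣product-diff∣ (approx x m) (approx x n) (approx y m) (approx y n) 0<Bx 0<η
        (bx m (≤⊔ˡ (≤⊔ˡ hm)))
        (cy m n (≤⊔ʳ {N} (≤⊔ʳ {M ℕ.⊔ M′} hm)) (≤⊔ʳ {N} (≤⊔ʳ {M ℕ.⊔ M′} hn)))
        (cx m n (≤⊔ʳ {M} (≤⊔ˡ hm)) (≤⊔ʳ {M} (≤⊔ˡ hn)))
        (by n (≤⊔ˡ (≤⊔ʳ {M ℕ.⊔ M′} hn))))
      (ℚ.≤-reflexive eq)

_^ʳ_ : ℝ → ℕ → ℝ
x ^ʳ zero  = fromℚ 1ℚ
x ^ʳ suc n = x *ʳ x ^ʳ n

∣_∣ʳ : ℝ → ℝ
∣ x ∣ʳ = mkℝ (λ n → ℚ.∣ approx x n ∣) λ ε 0<ε → let (N , c) = cauchy x ε 0<ε in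
  N , λ m n hm hn →
    let p = approx x m; q = approx x n in
    ℚ.≤-trans
      (∣p∣≤q (∣p∣-∣q∣≤∣p-q∣ p q)
             (subst₂ _≤_ (sym (neg-minus ℚ.∣ p ∣ ℚ.∣ q ∣))
                         (∣p-q∣-sym q p)
                         (∣p∣-∣q∣≤∣p-q∣ q p)))
      (c m n hm hn)

_⟶_ : (ℕ → ℚ) → ℝ → Set
x ⟶ L = ∀ ε → 0ℚ < ε → ∃ λ N → ∀ n → N ℕ.≤ n → ∣ fromℚ (x n) -ʳ L ∣ʳ ≤ʳ fromℚ ε

-- A = ∏_p g(p)
_IsProductOverPrimesOf_ : ℝ → ((p : ℕ) .{{_ : NonTrivial p}} → ℚ) → Set
A IsProductOverPrimesOf g = primeProduct {λ _ → ⊤} (λ _ → yes tt) g ⟶ A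

------------------------------------------------------------------------
-- The natural logarithm of a positive integer

-- ∑_{j=1}^{J} (1 - 1/n)^j / j, a partial sum of the Mercator series
-- - log (1 - x) = ∑_{j≥1} x^j / j  at  x = 1 - 1/n ∈ [0 , 1)
logSum : (n : ℕ) .{{_ : NonZero n}} → ℕ → ℚ
logSum n zero    = 0ℚ
logSum n (suc J) = logSum n J + (1-1/ n) ^ suc J * (+ 1 / suc J)

module LogCauchy (n-1 : ℕ) where

  n = suc n-1
  x = 1-1/ n
  S = logSum n

  0≤x : 0ℚ ≤ x
  0≤x = 0≤q-p (+ 1 / n) 1ℚ (/-≤ 1 n-1 1 0 (s≤s z≤n))

  x≤1 : x ≤ 1ℚ
  x≤1 = p-q≤r 1ℚ (+ 1 / n) (subst (_≤ 1ℚ + + 1 / n) (ℚ.+-identityʳ 1ℚ) (ℚ.+-monoʳ-≤ 1ℚ (/-≤ 0 0 1 n-1 z≤n)))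

  0≤xʲ : ∀ j → 0ℚ ≤ x ^ j
  0≤xʲ zero    = *≤* (ℤ.+≤+ z≤n)
  0≤xʲ (suc j) = subst (_≤ x * x ^ j) (ℚ.*-zeroʳ x)
    (ℚ.*-monoˡ-≤-nonNeg x {{ℚ.nonNegative 0≤x}} (0≤xʲ j))

  xʲ≤1 : ∀ j → x ^ j ≤ 1ℚ
  xʲ≤1 zero    = ℚ.≤-refl
  xʲ≤1 (suc j) = ℚ.≤-trans
    (subst (x * x ^ j ≤_) (ℚ.*-identityʳ x) (ℚ.*-monoˡ-≤-nonNeg x {{ℚ.nonNegative 0≤x}} (xʲ≤1 j)))
    x≤1

  R U : ℕ → ℚ
  R J = fromℕ n * x ^ suc J * (+ 1 / suc J)
  U J = S J + R J

  0≤term : ∀ j → 0ℚ ≤ x ^ suc j * (+ 1 / suc j)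
  0≤term j = subst (_≤ x ^ suc j * (+ 1 / suc j)) (ℚ.*-zeroʳ (x ^ suc j))
    (ℚ.*-monoˡ-≤-nonNeg (x ^ suc j) {{ℚ.nonNegative (0≤xʲ (suc j))}} (/-≤ 0 0 1 j z≤n))

  p≤p+q : ∀ p {q} → 0ℚ ≤ q → p ≤ p + q
  p≤p+q p {q} 0≤q = subst (_≤ p + q) (ℚ.+-identityʳ p) (ℚ.+-monoʳ-≤ p 0≤q)

  R≤ : ∀ J → R J ≤ + n / suc J
  R≤ J = subst₂ _≤_
    (*-swap (fromℕ n) (x ^ suc J) (+ 1 / suc J))
    (trans (ℚ.*-identityˡ _) (trans (/-* n 1 J) (cong (λ a → + a / suc J) (ℕ.*-identityʳ n))))
    (ℚ.*-monoʳ-≤-nonNeg (fromℕ n * (+ 1 / suc J))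
      {{ℚ.nonNegative (subst (0ℚ ≤_) (sym (/-* n 1 J)) (/-≤ 0 0 (n ℕ.* 1) J z≤n))}} (xʲ≤1 (suc J)))

  0≤R : ∀ J → 0ℚ ≤ R J
  0≤R J = subst₂ _≤_ (ℚ.*-zeroʳ (fromℕ n))
    (sym (ℚ.*-assoc (fromℕ n) (x ^ suc J) (+ 1 / suc J)))
    (ℚ.*-monoˡ-≤-nonNeg (fromℕ n) {{ℚ.nonNegative (/-≤ 0 0 n 0 z≤n)}} (0≤term J))

  nx : fromℕ n * x ≡ fromℕ n - 1ℚ
  nx = trans (*-one-minus (fromℕ n) (+ 1 / n))
             (cong (λ q → fromℕ n - q) (n*1/n n-1))

  U-step : ∀ J → U (suc J) ≤ U J
  U-step J = ℚ.≤-trans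
    (ℚ.+-monoʳ-≤ (S J + y * r)
      (ℚ.*-monoˡ-≤-nonNeg (fromℕ n * (x * y))
        {{ℚ.nonNegative (subst (_≤ fromℕ n * (x * y)) (ℚ.*-zeroʳ (fromℕ n))
          (ℚ.*-monoˡ-≤-nonNeg (fromℕ n) {{ℚ.nonNegative (/-≤ 0 0 n 0 z≤n)}} (0≤xʲ (suc (suc J)))))}}
        (/-≤ 1 (suc J) 1 J (s≤s (ℕ.+-monoˡ-≤ 0 (ℕ.n≤1+n J))))))
    (ℚ.≤-reflexive
      (trans (reassoc (S J) y r (fromℕ n) x)
      (trans (cong (λ q → S J + y * r + q * y * r) nx)
             (absorb (S J) y r (fromℕ n)))))
    where
    y = x ^ suc J
    r = + 1 / suc J

  S-mono : ∀ {N m} → N ℕ.≤′ m → S N ≤ S m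
  S-mono (ℕ.≤′-reflexive refl) = ℚ.≤-refl
  S-mono {m = suc m} (ℕ.≤′-step h) = ℚ.≤-trans (S-mono h) (p≤p+q (S m) (0≤term m))

  U-anti : ∀ {N m} → N ℕ.≤′ m → U m ≤ U N
  U-anti (ℕ.≤′-reflexive refl) = ℚ.≤-refl
  U-anti {m = suc m} (ℕ.≤′-step h) = ℚ.≤-trans (U-step m) (U-anti h)

  S-S≤R : ∀ {N m m′} → N ℕ.≤ m → N ℕ.≤ m′ → S m - S m′ ≤ R N
  S-S≤R {N} {m} {m′} h h′ = p-q≤r (S m) (S m′) (ℚ.≤-trans
    (ℚ.≤-trans (p≤p+q (S m) (0≤R m)) (U-anti (ℕ.≤⇒≤′ h)))
    (subst (_≤ R N + S m′) (ℚ.+-comm (R N) (S N)) (ℚ.+-monoʳ-≤ (R N) (S-mono (ℕ.≤⇒≤′ h′)))))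

  R-small : ∀ ε → 0ℚ < ε → ∃ λ N → R N ≤ ε
  R-small ε@(mkℚ (+ zero) _ _) (*<* (ℤ.+<+ ()))
  R-small (mkℚ -[1+ _ ] _ _) (*<* ())
  R-small ε@(mkℚ (+ suc a) b c) 0<ε = N , ℚ.≤-trans (R≤ N)
    (subst (+ n / suc N ≤_) (ℚ.fromℚᵘ-toℚᵘ ε) (/-≤ n N (suc a) b
      (ℕ.≤-trans (ℕ.n≤1+n N) (ℕ.m≤m+n (suc N) (a ℕ.* suc N)))))
    where N = n ℕ.* suc b

  S-cauchy : IsCauchy S
  S-cauchy ε 0<ε with R-small ε 0<ε
  ... | N , h = N , λ m m′ hm hm′ → ∣p∣≤q
    (ℚ.≤-trans (S-S≤R hm hm′) h)
    (subst (_≤ ε) (sym (neg-minus (S m) (S m′)))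
      (ℚ.≤-trans (S-S≤R hm′ hm) h))

log : (n : ℕ) .{{_ : NonZero n}} → ℝ
log n@(suc n-1) = mkℝ (logSum n) (LogCauchy.S-cauchy n-1)

{-# OPTIONS --safe #-}

-- For a prime p let τ(p) = i if p ∣ u_i, and τ(p) = k if p divides no u_i.  A tuple is counted by Q
-- iff every prime p ≤ n divides fewer than τ(p) of its entries, and the main term is n^s ∏_p ρ_s(p)
-- with ρ_s(p) = P(Bin(s, 1/p) < τ(p)).  Primes p > n change this product by O(θ(u_1)/n).
--
-- The finite statement is proved for arbitrary τ by induction on s.  Fixing one entry a lowers τ by
-- one at the primes dividing a, so that both
--   * the main terms for s - 1, weighted over a ≤ n, and
--   * the errors, which grow by the factor 2^ω(a),
-- are one-dimensional sieve sums.  Expanding these over squarefree d with ⌊n/d⌋ = n/d + O(min(1, n/d))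
-- costs a factor ∑_d min(1, n/d)/d ≤ 1 + H_n for each dimension.  Keeping the minimum, instead of
-- bounding it by 1, makes Mertens' theorem unnecessary.  The resulting power log^{s-1} n suffices
-- because δ(s,k) ≥ binom(s-1, 1).
module Submission where

open import Defs
open import Data.Fin using (Fin)
open import Data.Nat using (ℕ; NonZero; _∸_; _*_; _≤_) renaming (_^_ to _^ⁿ_)
open import Data.Nat.GCD using (gcd)
open import Data.Product using (Σ-syntax; _×_)
open import Data.Sum using (_⊎_)
open import Relation.Binary.PropositionalEquality using (_≡_; _≢_)

import Data.Fin as Fin
import Data.Fin.Properties as Fin
open import Data.Fin.Subset using (Subset; inside; outside; ∣_∣)
open import Data.Integer using (_⊖_; +≤+; +<+) renaming (+_ to pos)
import Data.Integer as ℤ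
import Data.Integer.Properties as ℤ
open import Data.List using (List; []; _∷_; _++_; [_]; map; filter; length; upTo; cartesianProductWith; tabulate)
import Data.List.Properties as List
open import Data.List.Membership.Propositional using (_∈_; find)
open import Data.List.Membership.Propositional.Properties
open import Data.List.Relation.Unary.All as All using (All; []; _∷_)
import Data.List.Relation.Unary.All.Properties as All
open import Data.List.Relation.Unary.AllPairs as AllPairs using (AllPairs; []; _∷_)
import Data.List.Relation.Unary.AllPairs.Properties as AllPairs
open import Data.List.Relation.Unary.Any using (here; there)
open import Data.List.Relation.Unary.Unique.Propositional using (Unique)
import Data.List.Relation.Unary.Unique.Propositional.Properties as Unique
open import Data.Nat using (zero; suc; z≤n; s≤s; _<_; _⊓_; NonTrivial)
import Data.Nat as ℕ
import Data.Nat.Properties as ℕ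
open import Data.Nat.Combinatorics using (_C_; nCn≡1; nC1≡n; nCk≡nC[n∸k]; k>n⇒nCk≡0; nCk+nC[k+1]≡[n+1]C[k+1])
open import Data.Nat.Coprimality as Coprime using (Coprime)
open import Data.Nat.Divisibility
open import Data.Nat.GCD using (gcd[m,n]∣m; gcd[m,n]∣n; gcd-greatest)
open import Data.Nat.Primality
open import Data.Nat.Primality.Factorisation using (factorise)
open import Data.Product using (∃; _,_; proj₁; proj₂)
open import Data.Rational using (ℚ; 0ℚ; 1ℚ; _+_; _-_; -_; _/_; 1/_; *≤*; *<*)
  renaming (_*_ to _·_; _≤_ to _≤ℚ_; _<_ to _<ℚ_)
import Data.Rational as ℚ
import Data.Rational.Properties as ℚ
open import Data.Rational.Solver using (module +-*-Solver)
import Data.Rational.Unnormalised as ℚᵘ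
import Data.Rational.Unnormalised.Properties as ℚᵘ
open import Data.Sum using (inj₁; inj₂)
open import Data.Unit using (⊤; tt)
open import Data.Vec using (Vec; []; _∷_)
open import Data.Vec.Relation.Unary.All using ([]; _∷_) renaming (All to VecAll)
open import Function using (_∘_)
open import Relation.Binary.PropositionalEquality using (refl; sym; trans; cong; cong₂; subst; subst₂; module ≡-Reasoning)
open import Relation.Nullary using (Dec; yes; no; ¬_; contradiction)
open import Relation.Nullary.Decidable using (_×-dec_)
open import Relation.Unary using (Decidable)
open +-*-Solver using (solve; con; _:+_; _:*_; _:-_; :-_; _:=_)

-- Origin of θ(u_1): once an entry is fixed, its divisibility by p changes the local factor of the
-- other s entries by P(X = τ(p) - 1), with X binomial with parameters s and 1/p. For τ(p) ≥ 2 this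
-- is at most P(X ≥ 1) ≤ s/p, the local density of a sieve of dimension s, and such a sieve costs
-- L^s, where L is the one-dimensional sieve sum. For τ(p) = 1 the change is close to 1, and
-- expanding over d with density 1 would be ruinous. At these primes the expansion is given up:
-- passing from d to pd only decreases min(1, n/d), so the whole effect is a factor 2. The error
-- therefore carries a product of factors `weight`, equal to 2 where τ ≤ 1. Initially these primes
-- divide u_1, so the product is at most θ(u_1). Lowering τ from 2 to 1 creates new ones, which is
-- the source of 2^ω(a).
--
-- Origin of the exponent s - 1: the count of empty tuples is exact, so the s steps of the induction
-- contribute s equal errors (nL)^(s-1), and none of order (nL)^s.

private variable
  X Y : Set
  p q r t : ℚ

-- Ordered-ring arithmetic

0≤· : 0ℚ ≤ℚ p → 0ℚ ≤ℚ q → 0ℚ ≤ℚ p · q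
0≤· {p} {q} 0≤p 0≤q = subst (_≤ℚ p · q) (ℚ.*-zeroʳ p) (ℚ.*-monoˡ-≤-nonNeg p {{ℚ.nonNegative 0≤p}} 0≤q)

0≤+ : 0ℚ ≤ℚ p → 0ℚ ≤ℚ q → 0ℚ ≤ℚ p + q
0≤+ = ℚ.+-mono-≤

·-monoʳ : 0ℚ ≤ℚ p → q ≤ℚ r → p · q ≤ℚ p · r
·-monoʳ {p} 0≤p = ℚ.*-monoˡ-≤-nonNeg p {{ℚ.nonNegative 0≤p}}

·-monoˡ : 0ℚ ≤ℚ r → p ≤ℚ q → p · r ≤ℚ q · r
·-monoˡ {r} 0≤r = ℚ.*-monoʳ-≤-nonNeg r {{ℚ.nonNegative 0≤r}}

·-mono : 0ℚ ≤ℚ q → 0ℚ ≤ℚ r → p ≤ℚ q → r ≤ℚ t → p · r ≤ℚ q · t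
·-mono 0≤q 0≤r p≤q r≤s = ℚ.≤-trans (·-monoˡ 0≤r p≤q) (·-monoʳ 0≤q r≤s)

0≤-⇒≤ : 0ℚ ≤ℚ q - p → p ≤ℚ q
0≤-⇒≤ {q} {p} h = subst₂ _≤ℚ_ (ℚ.+-identityˡ p) (Identities.minus-cancel q p) (ℚ.+-monoˡ-≤ p h)

≤-via : ∀ {d} → 0ℚ ≤ℚ d → q - p ≡ d → p ≤ℚ q
≤-via 0≤d refl = 0≤-⇒≤ 0≤d

p≤p+q : 0ℚ ≤ℚ q → p ≤ℚ p + q
p≤p+q {q} {p} 0≤q = subst (_≤ℚ p + q) (ℚ.+-identityʳ p) (ℚ.+-monoʳ-≤ p 0≤q)

p≤p·q : 0ℚ ≤ℚ p → 1ℚ ≤ℚ q → p ≤ℚ p · q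
p≤p·q {p} {q} 0≤p 1≤q = subst (_≤ℚ p · q) (ℚ.*-identityʳ p) (·-monoʳ 0≤p 1≤q)

0≤1 : 0ℚ ≤ℚ 1ℚ
0≤1 = *≤* (+≤+ z≤n)

0≤^ : ∀ m → 0ℚ ≤ℚ p → 0ℚ ≤ℚ p ^ m
0≤^ zero    _   = 0≤1
0≤^ (suc m) 0≤p = 0≤· 0≤p (0≤^ m 0≤p)

^-monoˡ : ∀ m → 0ℚ ≤ℚ p → p ≤ℚ q → p ^ m ≤ℚ q ^ m
^-monoˡ zero    _   _   = ℚ.≤-refl
^-monoˡ (suc m) 0≤p p≤q = ·-mono (ℚ.≤-trans 0≤p p≤q) (0≤^ m 0≤p) p≤q (^-monoˡ m 0≤p p≤q)

1≤^ : ∀ m → 1ℚ ≤ℚ p → 1ℚ ≤ℚ p ^ m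
1≤^ zero    _   = ℚ.≤-refl
1≤^ (suc m) 1≤p = ·-mono (ℚ.≤-trans 0≤1 1≤p) 0≤1 1≤p (1≤^ m 1≤p)

^-monoʳ : ∀ {m n} → 1ℚ ≤ℚ p → m ≤ n → p ^ m ≤ℚ p ^ n
^-monoʳ {n = n} 1≤p z≤n = 1≤^ n 1≤p
^-monoʳ 1≤p (s≤s {m} {n} m≤n) = ·-monoʳ (ℚ.≤-trans 0≤1 1≤p) (^-monoʳ {m = m} {n} 1≤p m≤n)

^-distrib-· : ∀ p q m → (p · q) ^ m ≡ p ^ m · q ^ m
^-distrib-· p q zero    = refl
^-distrib-· p q (suc m) = trans (cong (p · q ·_) (^-distrib-· p q m))
  (solve 4 (λ p q a b → p :* q :* (a :* b) := p :* a :* (q :* b)) refl p q (p ^ m) (q ^ m))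

0≤p⇒∣p·q∣≡p·∣q∣ : 0ℚ ≤ℚ p → ∀ q → ℚ.∣ p · q ∣ ≡ p · ℚ.∣ q ∣
0≤p⇒∣p·q∣≡p·∣q∣ {p} 0≤p q = trans (ℚ.∣p*q∣≡∣p∣*∣q∣ p q) (cong (_· ℚ.∣ q ∣) (ℚ.0≤p⇒∣p∣≡p 0≤p))

-- fromℕ, and the total reciprocal (with 1/0 = 0)

fromℕ-* : ∀ a b → fromℕ (a * b) ≡ fromℕ a · fromℕ b
fromℕ-* a b = sym (/-* a b 0)

fromℕ-+ : ∀ a b → fromℕ (a ℕ.+ b) ≡ fromℕ a + fromℕ b
fromℕ-+ a b = ℚ.toℚᵘ-injective (begin
  ℚ.toℚᵘ (fromℕ (a ℕ.+ b))                    ≈⟨ toℚᵘ-/ (a ℕ.+ b) 0 ⟩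
  ℚᵘ.mkℚᵘ (pos (a ℕ.+ b)) 0                      ≈⟨ ℚᵘ.*≡* (cong (ℤ._* pos 1)
     (sym (cong₂ ℤ._+_ (ℤ.*-identityʳ (pos a)) (ℤ.*-identityʳ (pos b))))) ⟩
  ℚᵘ.mkℚᵘ (pos a) 0 ℚᵘ.+ ℚᵘ.mkℚᵘ (pos b) 0         ≈⟨ ℚᵘ.+-cong (toℚᵘ-/ a 0) (toℚᵘ-/ b 0) ⟨
  ℚ.toℚᵘ (fromℕ a) ℚᵘ.+ ℚ.toℚᵘ (fromℕ b)      ≈⟨ ℚ.toℚᵘ-homo-+ (fromℕ a) (fromℕ b) ⟨
  ℚ.toℚᵘ (fromℕ a + fromℕ b)                  ∎)
  where open ℚᵘ.≃-Reasoning

fromℕ-mono : ∀ {a b} → a ≤ b → fromℕ a ≤ℚ fromℕ b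
fromℕ-mono {a} {b} a≤b = /-≤ a 0 b 0 (ℕ.*-monoˡ-≤ 1 a≤b)

0≤fromℕ : ∀ a → 0ℚ ≤ℚ fromℕ a
0≤fromℕ a = fromℕ-mono {0} {a} z≤n

fromℕ-suc : ∀ a → fromℕ (suc a) ≡ 1ℚ + fromℕ a
fromℕ-suc = fromℕ-+ 1

fromℕ-^ : ∀ a m → fromℕ (a ^ⁿ m) ≡ fromℕ a ^ m
fromℕ-^ a zero    = refl
fromℕ-^ a (suc m) = trans (fromℕ-* a (a ^ⁿ m)) (cong (fromℕ a ·_) (fromℕ-^ a m))

inv : ℕ → ℚ
inv zero    = 0ℚ
inv (suc m) = pos 1 / suc m

0≤inv : ∀ m → 0ℚ ≤ℚ inv m
0≤inv zero    = ℚ.≤-refl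
0≤inv (suc m) = /-≤ 0 0 1 m z≤n

fromℕ·inv : ∀ {m} → 1 ≤ m → fromℕ m · inv m ≡ 1ℚ
fromℕ·inv (s≤s {n = m} _) = n*1/n m

inv-antitone : ∀ {a b} → 1 ≤ a → a ≤ b → inv b ≤ℚ inv a
inv-antitone (s≤s {n = a} _) (s≤s {n = b} a≤b) = /-≤ 1 b 1 a (ℕ.*-monoʳ-≤ 1 (s≤s a≤b))

inv≤1 : ∀ m → inv m ≤ℚ 1ℚ
inv≤1 zero    = 0≤1
inv≤1 (suc m) = inv-antitone {1} {suc m} (s≤s z≤n) (s≤s z≤n)

inv-* : ∀ a b → inv (a * b) ≡ inv a · inv b
inv-* zero      b         = sym (ℚ.*-zeroˡ (inv b))
inv-* a@(suc _) zero      = trans (cong inv (ℕ.*-zeroʳ a)) (sym (ℚ.*-zeroʳ (inv a)))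
inv-* a@(suc _) b@(suc _) = begin
  c                                            ≡⟨ ℚ.*-identityʳ c ⟨
  c · 1ℚ                                       ≡⟨ cong (c ·_) (cong₂ _·_ (fromℕ·inv {a} (s≤s z≤n)) (fromℕ·inv {b} (s≤s z≤n))) ⟨
  c · (fromℕ a · inv a · (fromℕ b · inv b))    ≡⟨ solve 5 (λ c x x′ y y′ → c :* (x :* x′ :* (y :* y′)) := x :* y :* c :* (x′ :* y′)) refl
                                                    c (fromℕ a) (inv a) (fromℕ b) (inv b) ⟩
  fromℕ a · fromℕ b · c · (inv a · inv b)      ≡⟨ cong (λ x → x · c · (inv a · inv b)) (fromℕ-* a b) ⟨
  fromℕ (a * b) · c · (inv a · inv b)          ≡⟨ cong (_· (inv a · inv b)) (fromℕ·inv {a * b} (s≤s z≤n)) ⟩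
  1ℚ · (inv a · inv b)                         ≡⟨ ℚ.*-identityˡ _ ⟩
  inv a · inv b                                ∎
  where
  open ≡-Reasoning
  c = inv (a * b)

·inv-≤ : ∀ {a b c d} → 1 ≤ b → 1 ≤ d → a * d ≤ c * b → fromℕ a · inv b ≤ℚ fromℕ c · inv d
·inv-≤ {a} {suc b} {c} {suc d} _ _ h = subst₂ _≤ℚ_ (sym (/-*1 a b)) (sym (/-*1 c d)) (/-≤ a b c d h)
  where
  /-*1 : ∀ a b → fromℕ a · inv (suc b) ≡ pos a / suc b
  /-*1 a b = trans (/-* a 1 b) (cong (λ x → pos x / suc b) (ℕ.*-identityʳ a))

-- Finite sums and products

∑ ∏ : List X → (X → ℚ) → ℚ
∑ xs F = sumℚ (map F xs)
∏ xs F = productℚ (map F xs)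

∑-cong : ∀ (xs : List X) {F G : X → ℚ} → (∀ {x} → x ∈ xs → F x ≡ G x) → ∑ xs F ≡ ∑ xs G
∑-cong []       h = refl
∑-cong (x ∷ xs) h = cong₂ _+_ (h (here refl)) (∑-cong xs (h ∘ there))

∑-mono : ∀ (xs : List X) {F G : X → ℚ} → (∀ x → F x ≤ℚ G x) → ∑ xs F ≤ℚ ∑ xs G
∑-mono []       h = ℚ.≤-refl
∑-mono (x ∷ xs) h = ℚ.+-mono-≤ (h x) (∑-mono xs h)

0≤∑ : ∀ (xs : List X) {F : X → ℚ} → (∀ x → 0ℚ ≤ℚ F x) → 0ℚ ≤ℚ ∑ xs F
0≤∑ []       h = ℚ.≤-refl
0≤∑ (x ∷ xs) h = 0≤+ (h x) (0≤∑ xs h)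

∑-+ : ∀ (xs : List X) (F G : X → ℚ) → ∑ xs (λ x → F x + G x) ≡ ∑ xs F + ∑ xs G
∑-+ []       F G = refl
∑-+ (x ∷ xs) F G = trans (cong ((F x + G x) +_) (∑-+ xs F G))
  (solve 4 (λ a b c d → a :+ b :+ (c :+ d) := a :+ c :+ (b :+ d)) refl (F x) (G x) (∑ xs F) (∑ xs G))

∑-· : ∀ (xs : List X) c (F : X → ℚ) → ∑ xs (λ x → c · F x) ≡ c · ∑ xs F
∑-· []       c F = sym (ℚ.*-zeroʳ c)
∑-· (x ∷ xs) c F = trans (cong ((c · F x) +_) (∑-· xs c F)) (sym (ℚ.*-distribˡ-+ c (F x) (∑ xs F)))

∑-++ : ∀ (xs ys : List X) {F : X → ℚ} → ∑ (xs ++ ys) F ≡ ∑ xs F + ∑ ys F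
∑-++ []       ys = sym (ℚ.+-identityˡ _)
∑-++ (x ∷ xs) ys {F} = trans (cong ((F x) +_) (∑-++ xs ys)) (sym (ℚ.+-assoc (F x) (∑ xs F) (∑ ys F)))

∑-map : ∀ (h : X → Y) xs {F : Y → ℚ} → ∑ (map h xs) F ≡ ∑ xs (F ∘ h)
∑-map h []           = refl
∑-map h (x ∷ xs) {F} = cong (F (h x) +_) (∑-map h xs)

∣∑∣≤∑∣∣ : ∀ (xs : List X) (F : X → ℚ) → ℚ.∣ ∑ xs F ∣ ≤ℚ ∑ xs (ℚ.∣_∣ ∘ F)
∣∑∣≤∑∣∣ []       F = ℚ.≤-refl
∣∑∣≤∑∣∣ (x ∷ xs) F = ℚ.≤-trans (ℚ.∣p+q∣≤∣p∣+∣q∣ (F x) (∑ xs F)) (ℚ.+-monoʳ-≤ ℚ.∣ F x ∣ (∣∑∣≤∑∣∣ xs F))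

-- The head of xs is cut out of ys at one occurrence; uniqueness of xs keeps its tail inside what
-- remains.
∑-⊆ : ∀ {xs ys : List X} {F : X → ℚ} → (∀ x → 0ℚ ≤ℚ F x) → Unique xs →
      (∀ {x} → x ∈ xs → x ∈ ys) → ∑ xs F ≤ℚ ∑ ys F
∑-⊆ {xs = []} {ys} 0≤F _ _ = 0≤∑ ys 0≤F
∑-⊆ {xs = x ∷ xs} {ys} {F} 0≤F (x∉xs ∷ u) ⊆ with ∈-∃++ (⊆ (here refl))
... | as , bs , refl = ℚ.≤-trans (ℚ.+-monoʳ-≤ (F x) (∑-⊆ 0≤F u ⊆′)) (ℚ.≤-reflexive (begin
  F x + ∑ (as ++ bs) F      ≡⟨ cong ((F x) +_) (∑-++ as bs) ⟩
  F x + (∑ as F + ∑ bs F)   ≡⟨ solve 3 (λ a b c → a :+ (b :+ c) := b :+ (a :+ c)) refl (F x) (∑ as F) (∑ bs F) ⟩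
  ∑ as F + (F x + ∑ bs F)   ≡⟨ ∑-++ as (x ∷ bs) ⟨
  ∑ (as ++ x ∷ bs) F        ∎))
  where
  open ≡-Reasoning
  ⊆′ : ∀ {y} → y ∈ xs → y ∈ as ++ bs
  ⊆′ y∈ with ∈-++⁻ as (⊆ (there y∈))
  ... | inj₁ y∈as         = ∈-++⁺ˡ y∈as
  ... | inj₂ (here refl)  = contradiction refl (All.lookup x∉xs y∈)
  ... | inj₂ (there y∈bs) = ∈-++⁺ʳ as y∈bs

∏-cong : ∀ (xs : List X) {F G : X → ℚ} → (∀ {x} → x ∈ xs → F x ≡ G x) → ∏ xs F ≡ ∏ xs G
∏-cong []       h = refl
∏-cong (x ∷ xs) h = cong₂ _·_ (h (here refl)) (∏-cong xs (h ∘ there))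

∏-· : ∀ (xs : List X) (F G : X → ℚ) → ∏ xs (λ x → F x · G x) ≡ ∏ xs F · ∏ xs G
∏-· []       F G = refl
∏-· (x ∷ xs) F G = trans (cong (F x · G x ·_) (∏-· xs F G))
  (solve 4 (λ a b c d → a :* b :* (c :* d) := a :* c :* (b :* d)) refl (F x) (G x) (∏ xs F) (∏ xs G))

∏-1 : ∀ (xs : List X) → ∏ xs (λ _ → 1ℚ) ≡ 1ℚ
∏-1 []       = refl
∏-1 (_ ∷ xs) = trans (ℚ.*-identityˡ _) (∏-1 xs)

0≤∏ : ∀ (xs : List X) {F : X → ℚ} → (∀ x → 0ℚ ≤ℚ F x) → 0ℚ ≤ℚ ∏ xs F
0≤∏ []       h = 0≤1
0≤∏ (x ∷ xs) h = 0≤· (h x) (0≤∏ xs h)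

∏≤1 : ∀ (xs : List X) {F : X → ℚ} → (∀ x → 0ℚ ≤ℚ F x) → (∀ x → F x ≤ℚ 1ℚ) → ∏ xs F ≤ℚ 1ℚ
∏≤1 []       0≤F F≤1 = ℚ.≤-refl
∏≤1 (x ∷ xs) 0≤F F≤1 = ·-mono 0≤1 (0≤∏ xs 0≤F) (F≤1 x) (∏≤1 xs 0≤F F≤1)

1≤∏ : ∀ (xs : List X) {F : X → ℚ} → (∀ x → 1ℚ ≤ℚ F x) → 1ℚ ≤ℚ ∏ xs F
1≤∏ []       h = ℚ.≤-refl
1≤∏ (x ∷ xs) h = ·-mono (ℚ.≤-trans 0≤1 (h x)) 0≤1 (h x) (1≤∏ xs h)

∏-mono : ∀ (xs : List X) {F G : X → ℚ} → (∀ x → 0ℚ ≤ℚ F x) → (∀ x → F x ≤ℚ G x) → ∏ xs F ≤ℚ ∏ xs G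
∏-mono []       0≤F F≤G = ℚ.≤-refl
∏-mono (x ∷ xs) 0≤F F≤G = ·-mono (ℚ.≤-trans (0≤F x) (F≤G x)) (0≤∏ xs 0≤F) (F≤G x) (∏-mono xs 0≤F F≤G)

-- The operators ∏_{p ∈ ps} (1 + c(p) T_p), where (T_p g)(q) = g(pq)

E : (ℕ → ℚ) → List ℕ → (ℕ → ℚ) → ℕ → ℚ
E c []       g q = g q
E c (p ∷ ps) g q = E c ps g q + c p · E c ps g (p * q)

module _ {c : ℕ → ℚ} where

  E-cong : ∀ {d} ps {g} q → (∀ p → c p ≡ d p) → E c ps g q ≡ E d ps g q
  E-cong []       q c≡d = refl
  E-cong (p ∷ ps) q c≡d = cong₂ _+_ (E-cong ps q c≡d) (cong₂ _·_ (c≡d p) (E-cong ps (p * q) c≡d))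

  E-zero : ∀ ps {g} q → (∀ p → c p ≡ 0ℚ) → E c ps g q ≡ g q
  E-zero []       q c≡0 = refl
  E-zero (p ∷ ps) {g} q c≡0 = trans
    (cong₂ _+_ (E-zero ps q c≡0) (trans (cong (_· E c ps g (p * q)) (c≡0 p)) (ℚ.*-zeroˡ (E c ps g (p * q)))))
    (ℚ.+-identityʳ (g q))

  E-+ : ∀ ps {g h} q → E c ps (λ q → g q + h q) q ≡ E c ps g q + E c ps h q
  E-+ []       q = refl
  E-+ (p ∷ ps) {g} {h} q = trans (cong₂ (λ a b → a + c p · b) (E-+ ps q) (E-+ ps (p * q)))
    (solve 5 (λ a b k a′ b′ → a :+ b :+ k :* (a′ :+ b′) := a :+ k :* a′ :+ (b :+ k :* b′)) refl
      (E c ps g q) (E c ps h q) (c p) (E c ps g (p * q)) (E c ps h (p * q)))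

  E-· : ∀ ps k {g} q → E c ps (λ q → k · g q) q ≡ k · E c ps g q
  E-· []       k q = refl
  E-· (p ∷ ps) k {g} q = trans (cong₂ (λ a b → a + c p · b) (E-· ps k q) (E-· ps k (p * q)))
    (solve 4 (λ k a d b → k :* a :+ d :* (k :* b) := k :* (a :+ d :* b)) refl
      k (E c ps g q) (c p) (E c ps g (p * q)))

  -- T_r commutes with every T_p.
  E-shift : ∀ ps r {g} q → E c ps (λ q → g (r * q)) q ≡ E c ps g (r * q)
  E-shift []       r q = refl
  E-shift (p ∷ ps) r {g} q = cong₂ (λ a b → a + c p · b) (E-shift ps r q)
    (trans (E-shift ps r (p * q)) (cong (E c ps g) (begin
      r * (p * q)  ≡⟨ ℕ.*-assoc r p q ⟨
      r * p * q    ≡⟨ cong (_* q) (ℕ.*-comm r p) ⟩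
      p * r * q    ≡⟨ ℕ.*-assoc p r q ⟩
      p * (r * q)  ∎)))
    where open ≡-Reasoning

  module _ (0≤c : ∀ p → 0ℚ ≤ℚ c p) where

    0≤E : ∀ ps {g} q → (∀ q → 0ℚ ≤ℚ g q) → 0ℚ ≤ℚ E c ps g q
    0≤E []       q 0≤g = 0≤g q
    0≤E (p ∷ ps) q 0≤g = 0≤+ (0≤E ps q 0≤g) (0≤· (0≤c p) (0≤E ps (p * q) 0≤g))

    E-mono : ∀ ps {g h} q → (∀ q → g q ≤ℚ h q) → E c ps g q ≤ℚ E c ps h q
    E-mono []       q g≤h = g≤h q
    E-mono (p ∷ ps) q g≤h = ℚ.+-mono-≤ (E-mono ps q g≤h) (·-monoʳ (0≤c p) (E-mono ps (p * q) g≤h))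

    E-antitone : ∀ ps r {g} q → (∀ q → g (r * q) ≤ℚ g q) → E c ps g (r * q) ≤ℚ E c ps g q
    E-antitone ps r {g} q h = subst (_≤ℚ E c ps g q) (E-shift ps r q) (E-mono ps q h)

    g≤E : ∀ ps {g} q → (∀ q → 0ℚ ≤ℚ g q) → g q ≤ℚ E c ps g q
    g≤E []       q 0≤g = ℚ.≤-refl
    g≤E (p ∷ ps) q 0≤g = ℚ.≤-trans (g≤E ps q 0≤g) (p≤p+q (0≤· (0≤c p) (0≤E ps (p * q) 0≤g)))

-- Prime by prime, (1 + a_p T_p)(1 + b_p T_p) exceeds 1 + (a_p + b_p) T_p by a_p b_p T_p², which is
-- nonnegative on nonnegative g. `E-tail` discards this term; everything else is an identity.
E-∘ : ∀ {a b : ℕ → ℚ} → (∀ p → 0ℚ ≤ℚ a p) → (∀ p → 0ℚ ≤ℚ b p) → ∀ ps {g} q → (∀ q → 0ℚ ≤ℚ g q) →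
      E (λ p → a p + b p) ps g q ≤ℚ E a ps (E b ps g) q
E-∘ 0≤a 0≤b [] q 0≤g = ℚ.≤-refl
E-∘ {a} {b} 0≤a 0≤b (p ∷ ps) {g} q 0≤g = begin
  E a+b ps g q + (a p + b p) · E a+b ps g (p * q)
    ≤⟨ ℚ.+-mono-≤ (E-∘ 0≤a 0≤b ps q 0≤g) (·-monoʳ (0≤+ (0≤a p) (0≤b p)) (E-∘ 0≤a 0≤b ps (p * q) 0≤g)) ⟩
  G q + (a p + b p) · G (p * q)
    ≡⟨ solve 4 (λ u a b v → u :+ (a :+ b) :* v := u :+ b :* v :+ a :* v) refl (G q) (a p) (b p) (G (p * q)) ⟩
  G q + b p · G (p * q) + a p · G (p * q)
    ≤⟨ ℚ.+-mono-≤ (ℚ.≤-reflexive (G-step)) (·-monoʳ (0≤a p) (E-mono 0≤a ps (p * q) (λ q → E-tail q))) ⟩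
  E a ps (E b (p ∷ ps) g) q + a p · E a ps (E b (p ∷ ps) g) (p * q)
    ∎
  where
  open ℚ.≤-Reasoning
  a+b = λ p → a p + b p
  G = E a ps (E b ps g)

  E-tail : ∀ q → E b ps g q ≤ℚ E b (p ∷ ps) g q
  E-tail q = p≤p+q (0≤· (0≤b p) (0≤E 0≤b ps (p * q) 0≤g))

  G-step : G q + b p · G (p * q) ≡ E a ps (E b (p ∷ ps) g) q
  G-step = sym (trans (E-+ ps q) (cong (G q +_)
    (trans (E-· ps (b p) q) (cong (b p ·_) (E-shift ps p {E b ps g} q)))))

module _ {c : ℕ → ℚ} (0≤c : ∀ p → 0ℚ ≤ℚ c p) (ps : List ℕ) {g : ℕ → ℚ} (0≤g : ∀ q → 0ℚ ≤ℚ g q)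
         (g-* : ∀ e q → g (e * q) ≤ℚ g e · g q) where

  -- Expanded, `E c ps g q` is ∑_d c(d) g(dq), and g(q) splits off from each summand.
  E-submult : ∀ q → E c ps g q ≤ℚ E c ps g 1 · g q
  E-submult q = begin
    E c ps g q                  ≡⟨ cong (E c ps g) (ℕ.*-identityʳ q) ⟨
    E c ps g (q * 1)            ≡⟨ E-shift ps q 1 ⟨
    E c ps (λ e → g (q * e)) 1  ≤⟨ E-mono 0≤c ps 1 (g-* q) ⟩
    E c ps (λ e → g q · g e) 1  ≡⟨ E-· ps (g q) 1 ⟩
    g q · E c ps g 1            ≡⟨ ℚ.*-comm (g q) (E c ps g 1) ⟩
    E c ps g 1 · g q            ∎
    where open ℚ.≤-Reasoning

  -- A sieve of dimension s is bounded by s nested sieves of dimension one: `E-∘` peels off one copy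
  -- of c, and `E-submult` turns the inner sieve into the constant `E c ps g 1`.
  E-pow : ∀ s q → E (λ p → fromℕ s · c p) ps g q ≤ℚ E c ps g 1 ^ s · g q
  E-pow zero    q = ℚ.≤-reflexive (trans (E-zero ps q (λ p → ℚ.*-zeroˡ (c p))) (sym (ℚ.*-identityˡ (g q))))
  E-pow (suc s) q = begin
    E (λ p → fromℕ (suc s) · c p) ps g q     ≡⟨ E-cong ps q (λ p → trans (cong (_· c p) (fromℕ-suc s))
                                                   (solve 2 (λ s c → (con 1ℚ :+ s) :* c := s :* c :+ c) refl (fromℕ s) (c p))) ⟩
    E (λ p → fromℕ s · c p + c p) ps g q     ≤⟨ E-∘ 0≤sc 0≤c ps q 0≤g ⟩
    E (λ p → fromℕ s · c p) ps (E c ps g) q  ≤⟨ E-mono 0≤sc ps q E-submult ⟩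
    E (λ p → fromℕ s · c p) ps (λ q → L · g q) q  ≡⟨ E-· ps L q ⟩
    L · E (λ p → fromℕ s · c p) ps g q       ≤⟨ ·-monoʳ (0≤E 0≤c ps 1 0≤g) (E-pow s q) ⟩
    L · (L ^ s · g q)                        ≡⟨ ℚ.*-assoc L (L ^ s) (g q) ⟨
    L · L ^ s · g q                          ∎
    where
    open ℚ.≤-Reasoning
    L = E c ps g 1
    0≤sc : ∀ p → 0ℚ ≤ℚ fromℕ s · c p
    0≤sc p = 0≤· (0≤fromℕ s) (0≤c p)

-- Counting multiples

pick : {P : Set} → Dec P → X → X → X
pick (yes _) a b = a
pick (no  _) a b = b

pick-∘ : ∀ {P : Set} (h : X → Y) (d : Dec P) {a b} → h (pick d a b) ≡ pick d (h a) (h b)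
pick-∘ h (yes _) = refl
pick-∘ h (no  _) = refl

pick-yes : ∀ {P : Set} (d : Dec P) {a b : X} → P → pick d a b ≡ a
pick-yes (yes _) p = refl
pick-yes (no ¬p) p = contradiction p ¬p

pick-no : ∀ {P : Set} (d : Dec P) {a b : X} → ¬ P → pick d a b ≡ b
pick-no (yes p) ¬p = contradiction p ¬p
pick-no (no  _) ¬p = refl

ind : {P : Set} → Dec P → ℚ
ind d = pick d 1ℚ 0ℚ

⋯-suc : ∀ n → 1 ⋯ suc n ≡ (1 ⋯ n) ++ [ suc n ]
⋯-suc n = trans (cong (map suc) (sym (List.upTo-∷ʳ n))) (List.map-++ suc (upTo n) [ n ])

∑-⋯-suc : ∀ n F → ∑ (1 ⋯ suc n) F ≡ ∑ (1 ⋯ n) F + F (suc n)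
∑-⋯-suc n F = trans (cong (λ xs → ∑ xs F) (⋯-suc n))
  (trans (∑-++ (1 ⋯ n) [ suc n ]) (cong (∑ (1 ⋯ n) F +_) (ℚ.+-identityʳ (F (suc n)))))

∈-⋯⁻ : ∀ {a n} → a ∈ 1 ⋯ n → 1 ≤ a × a ≤ n
∈-⋯⁻ a∈ with ∈-map⁻ suc a∈
... | i , i∈ , refl = s≤s z≤n , ∈-upTo⁻ i∈

∈-⋯⁺ : ∀ {a n} → 1 ≤ a → a ≤ n → a ∈ 1 ⋯ n
∈-⋯⁺ (s≤s _) a≤n = ∈-map⁺ suc (∈-upTo⁺ a≤n)

-- The witness is ⌊n/q⌋, described by two inequalities instead of a division. It advances exactly
-- when n + 1 reaches q(c + 1).
count-multiples : ∀ q → 1 ≤ q → ∀ n →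
  ∃ λ c → ∑ (1 ⋯ n) (λ a → ind (q ∣? a)) ≡ fromℕ c × q * c ≤ n × n < q * suc c
count-multiples q 1≤q zero    = 0 , refl , ℕ.≤-reflexive (ℕ.*-zeroʳ q) , ℕ.≤-trans 1≤q (ℕ.≤-reflexive (sym (ℕ.*-identityʳ q)))
count-multiples q 1≤q (suc n) with count-multiples q 1≤q n | ∑-⋯-suc n (λ a → ind (q ∣? a))
... | c , eq , qc≤n , n<qc+q | step with q ∣? suc n
...   | no q∤ = c , trans step (trans (cong (_+ 0ℚ) eq) (ℚ.+-identityʳ (fromℕ c))) , ℕ.m≤n⇒m≤1+n qc≤n
              , ℕ.≤∧≢⇒< n<qc+q (λ { eq → q∤ (divides (suc c) (trans eq (ℕ.*-comm q (suc c)))) })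
...   | yes (divides k 1+n≡kq) = suc c , trans step (trans (cong (_+ 1ℚ) eq) (trans (ℚ.+-comm (fromℕ c) 1ℚ) (sym (fromℕ-suc c))))
              , ℕ.≤-reflexive (sym 1+n≡) , subst (_< q * suc (suc c)) (sym 1+n≡) (ℕ.*-monoʳ-< q {{ℕ.>-nonZero 1≤q}} (ℕ.n<1+n (suc c)))
  where
  1+n≡qk = trans 1+n≡kq (ℕ.*-comm k q)
  c<k : c < k
  c<k = ℕ.*-cancelˡ-< q c k (subst (q * c <_) 1+n≡qk (s≤s qc≤n))
  k≤1+c : k ≤ suc c
  k≤1+c = ℕ.*-cancelˡ-≤ q {{ℕ.>-nonZero 1≤q}} (subst (_≤ q * suc c) 1+n≡qk n<qc+q)
  1+n≡ : suc n ≡ q * suc c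
  1+n≡ = trans 1+n≡qk (cong (q *_) (ℕ.≤-antisym k≤1+c c<k))

-- min (1 , n / q) for q ≥ 1, which dominates ∣ ⌊n/q⌋ - n/q ∣ and, unlike 1, keeps its sum over all q
-- weighted by 1/q logarithmic
γ : ℕ → ℕ → ℚ
γ n q = fromℕ (n ⊓ q) · inv q

0≤γ : ∀ n q → 0ℚ ≤ℚ γ n q
0≤γ n q = 0≤· (0≤fromℕ (n ⊓ q)) (0≤inv q)

γ-large : ∀ n q → n ≤ q → γ n q ≡ fromℕ n · inv q
γ-large n q n≤q = cong (λ m → fromℕ m · inv q) (ℕ.m≤n⇒m⊓n≡m n≤q)

γ-small : ∀ n q → 1 ≤ q → q ≤ n → γ n q ≡ 1ℚ
γ-small n q 1≤q q≤n = trans (cong (λ m → fromℕ m · inv q) (ℕ.m≥n⇒m⊓n≡n q≤n)) (fromℕ·inv 1≤q)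

γ≤1 : ∀ n q → γ n q ≤ℚ 1ℚ
γ≤1 n zero      = ℚ.≤-trans (ℚ.≤-reflexive (ℚ.*-zeroʳ (fromℕ (n ⊓ 0)))) 0≤1
γ≤1 n q@(suc _) = ℚ.≤-trans (·-monoˡ (0≤inv q) (fromℕ-mono (ℕ.m⊓n≤n n q))) (ℚ.≤-reflexive (fromℕ·inv {q} (s≤s z≤n)))

-- After clearing eq this is n ⊓ eq ≤ (n ⊓ e)(n ⊓ q). When e and q both exceed n the right side is
-- n², and 1 ≤ n makes this large enough.
γ-submult : ∀ {n} → 1 ≤ n → ∀ e q → γ n (e * q) ≤ℚ γ n e · γ n q
γ-submult {n} 1≤n zero q = ℚ.≤-reflexive (trans (ℚ.*-zeroʳ (fromℕ (n ⊓ 0)))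
  (sym (trans (cong (_· γ n q) (ℚ.*-zeroʳ (fromℕ (n ⊓ 0)))) (ℚ.*-zeroˡ (γ n q)))))
γ-submult {n} 1≤n e@(suc _) q = begin
  fromℕ (n ⊓ (e * q)) · inv (e * q)                ≡⟨ cong (fromℕ (n ⊓ (e * q)) ·_) (inv-* e q) ⟩
  fromℕ (n ⊓ (e * q)) · (inv e · inv q)            ≤⟨ ·-monoˡ (0≤· (0≤inv e) (0≤inv q)) (fromℕ-mono ⊓-submult) ⟩
  fromℕ ((n ⊓ e) * (n ⊓ q)) · (inv e · inv q)      ≡⟨ cong (_· (inv e · inv q)) (fromℕ-* (n ⊓ e) (n ⊓ q)) ⟩
  fromℕ (n ⊓ e) · fromℕ (n ⊓ q) · (inv e · inv q)  ≡⟨ solve 4 (λ a b c d → a :* b :* (c :* d) := a :* c :* (b :* d)) refl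
                                                       (fromℕ (n ⊓ e)) (fromℕ (n ⊓ q)) (inv e) (inv q) ⟩
  γ n e · γ n q                                    ∎
  where
  open ℚ.≤-Reasoning
  ⊓-submult : n ⊓ (e * q) ≤ (n ⊓ e) * (n ⊓ q)
  ⊓-submult with ℕ.≤-total n e
  ... | inj₂ e≤n rewrite ℕ.m≥n⇒m⊓n≡n e≤n = ℕ.≤-trans
    (ℕ.⊓-glb (ℕ.≤-trans (ℕ.m⊓n≤m n (e * q)) (ℕ.m≤n*m n e)) (ℕ.m⊓n≤n n (e * q)))
    (ℕ.≤-reflexive (sym (ℕ.*-distribˡ-⊓ e n q)))
  ... | inj₁ n≤e rewrite ℕ.m≤n⇒m⊓n≡m n≤e = n⊓eq≤ q
    where
    n⊓eq≤ : ∀ q → n ⊓ (e * q) ≤ n * (n ⊓ q)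
    n⊓eq≤ zero    = ℕ.≤-trans (ℕ.m⊓n≤n n (e * 0)) (ℕ.≤-trans (ℕ.≤-reflexive (ℕ.*-zeroʳ e)) z≤n)
    n⊓eq≤ (suc q) = ℕ.≤-trans (ℕ.m⊓n≤m n (e * suc q)) (ℕ.m≤m*n n (n ⊓ suc q) {{ℕ.>-nonZero (ℕ.⊓-glb 1≤n (s≤s z≤n))}})

γ-antitone : ∀ {n} → 1 ≤ n → ∀ e q → γ n (e * q) ≤ℚ γ n q
γ-antitone {n} 1≤n e q = ℚ.≤-trans (γ-submult 1≤n e q)
  (ℚ.≤-trans (·-monoˡ (0≤γ n q) (γ≤1 n e)) (ℚ.≤-reflexive (ℚ.*-identityˡ (γ n q))))

module _ (n q : ℕ) (1≤q : 1 ≤ q) where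

  private
    N = ∑ (1 ⋯ n) (λ a → ind (q ∣? a))
    c = proj₁ (count-multiples q 1≤q n)
    N≡c : N ≡ fromℕ c
    N≡c = proj₁ (proj₂ (count-multiples q 1≤q n))
    qc≤n : q * c ≤ n
    qc≤n = proj₁ (proj₂ (proj₂ (count-multiples q 1≤q n)))
    n<qc+q : n < q * suc c
    n<qc+q = proj₂ (proj₂ (proj₂ (count-multiples q 1≤q n)))
    -- The remainder n - qc is bounded by n and by q. Using both bounds gives the minimum in γ.
    n≤ : n ≤ q * c ℕ.+ n ⊓ q
    n≤ with ℕ.≤-total n q
    ... | inj₁ n≤q = ℕ.≤-trans (ℕ.m≤n+m n (q * c)) (ℕ.≤-reflexive (cong (q * c ℕ.+_) (sym (ℕ.m≤n⇒m⊓n≡m n≤q))))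
    ... | inj₂ q≤n = ℕ.≤-trans (ℕ.<⇒≤ n<qc+q) (ℕ.≤-reflexive (trans (ℕ.*-suc q c) (trans (ℕ.+-comm q (q * c))
                       (cong (q * c ℕ.+_) (sym (ℕ.m≥n⇒m⊓n≡n q≤n))))))
    qcq≤ : q * c * q ≤ n * (n ⊓ q)
    qcq≤ with ℕ.≤-<-connex q n
    ... | inj₁ q≤n = ℕ.≤-trans (ℕ.*-monoˡ-≤ q qc≤n) (ℕ.≤-reflexive (cong (n *_) (sym (ℕ.m≥n⇒m⊓n≡n q≤n))))
    ... | inj₂ n<q = ℕ.≤-trans (ℕ.≤-reflexive (cong (_* q) qc≡0)) z≤n
      where
      c<1 : c < 1
      c<1 = ℕ.*-cancelˡ-< q c 1 (ℕ.≤-<-trans qc≤n (subst (n <_) (sym (ℕ.*-identityʳ q)) n<q))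
      qc≡0 : q * c ≡ 0
      qc≡0 = trans (cong (q *_) (ℕ.n<1⇒n≡0 c<1)) (ℕ.*-zeroʳ q)
    N≡ : N ≡ fromℕ (q * c) · inv q
    N≡ = trans N≡c (sym (trans (cong (_· inv q) (fromℕ-* q c))
      (trans (solve 3 (λ q c i → q :* c :* i := c :* (q :* i)) refl (fromℕ q) (fromℕ c) (inv q))
        (trans (cong (fromℕ c ·_) (fromℕ·inv 1≤q)) (ℚ.*-identityʳ (fromℕ c))))))

  multiples-error : ℚ.∣ N - fromℕ n · inv q ∣ ≤ℚ γ n q
  multiples-error = ∣p∣≤q
    (ℚ.≤-trans (p-q≤r N (fromℕ n · inv q) {0ℚ} (subst₂ _≤ℚ_ (sym N≡) (sym (ℚ.+-identityˡ (fromℕ n · inv q)))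
      (·-monoˡ (0≤inv q) (fromℕ-mono qc≤n)))) (0≤γ n q))
    (subst (_≤ℚ γ n q) (sym (Identities.neg-minus N (fromℕ n · inv q)))
      (p-q≤r (fromℕ n · inv q) N {γ n q} (begin
        fromℕ n · inv q                                    ≤⟨ ·-monoˡ (0≤inv q) (fromℕ-mono n≤) ⟩
        fromℕ (q * c ℕ.+ n ⊓ q) · inv q                    ≡⟨ cong (_· inv q) (fromℕ-+ (q * c) (n ⊓ q)) ⟩
        (fromℕ (q * c) + fromℕ (n ⊓ q)) · inv q            ≡⟨ solve 3 (λ a b i → (a :+ b) :* i := b :* i :+ a :* i) refl
                                                                (fromℕ (q * c)) (fromℕ (n ⊓ q)) (inv q) ⟩
        γ n q + fromℕ (q * c) · inv q                      ≡⟨ cong (γ n q +_) N≡ ⟨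
        γ n q + N                                          ∎)))
    where open ℚ.≤-Reasoning

  -- The count vanishes for q > n, so the factor γ comes free beside the trivial bound n/q.
  multiples≤ : N ≤ℚ fromℕ n · inv q · γ n q
  multiples≤ = begin
    N                                             ≡⟨ N≡ ⟩
    fromℕ (q * c) · inv q                         ≡⟨ ℚ.*-identityʳ (fromℕ (q * c) · inv q) ⟨
    fromℕ (q * c) · inv q · 1ℚ                    ≡⟨ cong (fromℕ (q * c) · inv q ·_) (fromℕ·inv 1≤q) ⟨
    fromℕ (q * c) · inv q · (fromℕ q · inv q)     ≡⟨ rearrange (fromℕ (q * c)) (fromℕ q) ⟩
    fromℕ (q * c) · fromℕ q · (inv q · inv q)     ≡⟨ cong (_· (inv q · inv q)) (fromℕ-* (q * c) q) ⟨
    fromℕ (q * c * q) · (inv q · inv q)           ≤⟨ ·-monoˡ (0≤· (0≤inv q) (0≤inv q)) (fromℕ-mono qcq≤) ⟩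
    fromℕ (n * (n ⊓ q)) · (inv q · inv q)         ≡⟨ cong (_· (inv q · inv q)) (fromℕ-* n (n ⊓ q)) ⟩
    fromℕ n · fromℕ (n ⊓ q) · (inv q · inv q)     ≡⟨ rearrange (fromℕ n) (fromℕ (n ⊓ q)) ⟨
    fromℕ n · inv q · γ n q                       ∎
    where
    open ℚ.≤-Reasoning
    rearrange : ∀ a b → a · inv q · (b · inv q) ≡ a · b · (inv q · inv q)
    rearrange a b = solve 3 (λ a b i → a :* i :* (b :* i) := a :* b :* (i :* i)) refl a b (inv q)

-- A sieve with weights x(p) , y(p) according to p ∤ a , p ∣ a

coprime-* : ∀ {a b c} → Coprime a b → Coprime a c → Coprime a (b * c)
coprime-* ab ac (d∣a , d∣bc) = ac (d∣a , Coprime.coprime-divisor (λ { (e∣d , e∣b) → ab (∣-trans e∣d d∣a , e∣b) }) d∣bc)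

coprime-*∣ : ∀ {p q a} → Coprime p q → p ∣ a → q ∣ a → p * q ∣ a
coprime-*∣ {p} {q} pq p∣a (divides k refl) =
  subst (p * q ∣_) (ℕ.*-comm q k)
    (subst (_∣ q * k) (ℕ.*-comm q p) (*-monoʳ-∣ q (Coprime.coprime-divisor pq (subst (p ∣_) (ℕ.*-comm k q) p∣a))))

sieveSum : ℕ → (x y : ℕ → ℚ) → List ℕ → ℕ → ℚ
sieveSum n x y ps q = ∑ (1 ⋯ n) λ a → ind (q ∣? a) · ∏ ps λ p → pick (p ∣? a) (y p) (x p)

sieveSum-[] : ∀ n x y q → sieveSum n x y [] q ≡ ∑ (1 ⋯ n) (λ a → ind (q ∣? a))
sieveSum-[] n x y q = ∑-cong (1 ⋯ n) λ {a} _ → ℚ.*-identityʳ (ind (q ∣? a))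

-- The weight at p is x + (y - x)[p ∣ a], and [q ∣ a][p ∣ a] = [pq ∣ a] by coprimality: one step of
-- inclusion-exclusion.
sieveSum-∷ : ∀ n x y {p} ps {q} → Coprime p q →
  sieveSum n x y (p ∷ ps) q ≡ x p · sieveSum n x y ps q + (y p - x p) · sieveSum n x y ps (p * q)
sieveSum-∷ n x y {p} ps {q} p⊥q = begin
  ∑ (1 ⋯ n) (λ a → ind (q ∣? a) · (w a · v a))
    ≡⟨ ∑-cong (1 ⋯ n) (λ {a} _ → pointwise a) ⟩
  ∑ (1 ⋯ n) (λ a → x p · (ind (q ∣? a) · v a) + (y p - x p) · (ind (p * q ∣? a) · v a))
    ≡⟨ ∑-+ (1 ⋯ n) (λ a → x p · (ind (q ∣? a) · v a)) (λ a → (y p - x p) · (ind (p * q ∣? a) · v a)) ⟩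
  ∑ (1 ⋯ n) (λ a → x p · (ind (q ∣? a) · v a)) + ∑ (1 ⋯ n) (λ a → (y p - x p) · (ind (p * q ∣? a) · v a))
    ≡⟨ cong₂ _+_ (∑-· (1 ⋯ n) (x p) (λ a → ind (q ∣? a) · v a)) (∑-· (1 ⋯ n) (y p - x p) (λ a → ind (p * q ∣? a) · v a)) ⟩
  x p · sieveSum n x y ps q + (y p - x p) · sieveSum n x y ps (p * q) ∎
  where
  open ≡-Reasoning
  w v : ℕ → ℚ
  w a = pick (p ∣? a) (y p) (x p)
  v a = ∏ ps λ p → pick (p ∣? a) (y p) (x p)

  pointwise : ∀ a → ind (q ∣? a) · (w a · v a) ≡ x p · (ind (q ∣? a) · v a) + (y p - x p) · (ind (p * q ∣? a) · v a)
  pointwise a with q ∣? a | p ∣? a | p * q ∣? a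
  ... | yes _   | yes _   | yes _  = solve 3 (λ x y w → con 1ℚ :* (y :* w) := x :* (con 1ℚ :* w) :+ (y :- x) :* (con 1ℚ :* w)) refl (x p) (y p) (v a)
  ... | yes _   | no _    | no _   = solve 3 (λ x y w → con 1ℚ :* (x :* w) := x :* (con 1ℚ :* w) :+ (y :- x) :* (con 0ℚ :* w)) refl (x p) (y p) (v a)
  ... | no _    | yes _   | no _   = solve 3 (λ x y w → con 0ℚ :* (y :* w) := x :* (con 0ℚ :* w) :+ (y :- x) :* (con 0ℚ :* w)) refl (x p) (y p) (v a)
  ... | no _    | no _    | no _   = solve 3 (λ x y w → con 0ℚ :* (x :* w) := x :* (con 0ℚ :* w) :+ (y :- x) :* (con 0ℚ :* w)) refl (x p) (y p) (v a)
  ... | yes q∣a | yes p∣a | no pq∤a = contradiction (coprime-*∣ p⊥q p∣a q∣a) pq∤a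
  ... | _       | no p∤a  | yes pq∣a = contradiction (m*n∣⇒m∣ p q pq∣a) p∤a
  ... | no q∤a  | _       | yes pq∣a = contradiction (m*n∣⇒n∣ p q pq∣a) q∤a

PairwiseCoprime : List ℕ → Set
PairwiseCoprime = AllPairs Coprime

coprime-step : ∀ {p ps q} → All (Coprime p) ps → All (λ r → Coprime r q) ps → All (λ r → Coprime r (p * q)) ps
coprime-step []        []        = []
coprime-step (pr ∷ p⊥) (rq ∷ ⊥q) = coprime-* (Coprime.sym pr) rq ∷ coprime-step p⊥ ⊥q

-- By `sieveSum-∷` the main terms combine exactly: (n/q) x + (n/pq)(y - x) = (n/q)((1 - 1/p) x +
-- y/p). The errors combine with coefficients x ≤ 1 and x - y ≤ c, which is the recursion of `E c`.
sieveSum-error : ∀ n {x y c : ℕ → ℚ} → (∀ p → 0ℚ ≤ℚ x p) → (∀ p → x p ≤ℚ 1ℚ) →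
  (∀ p → 0ℚ ≤ℚ x p - y p) → (∀ p → x p - y p ≤ℚ c p) → ∀ {ps} → PairwiseCoprime ps → All (1 ≤_) ps →
  ∀ {q} → 1 ≤ q → All (λ p → Coprime p q) ps →
  ℚ.∣ sieveSum n x y ps q - fromℕ n · inv q · ∏ ps (λ p → (1ℚ - inv p) · x p + inv p · y p) ∣ ≤ℚ E c ps (γ n) q
sieveSum-error n {x} {y} _ _ _ _ [] [] {q} 1≤q [] =
  subst (λ z → ℚ.∣ z ∣ ≤ℚ γ n q) (cong₂ _-_ (sym (sieveSum-[] n x y q)) (sym (ℚ.*-identityʳ (fromℕ n · inv q))))
    (multiples-error n q 1≤q)
sieveSum-error n {x} {y} {c} 0≤x x≤1 y≤x x-y≤c {p ∷ ps} (p⊥ ∷ pc) (1≤p ∷ 1≤ps) {q} 1≤q (p⊥q ∷ ⊥q) = begin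
  ℚ.∣ sieveSum n x y (p ∷ ps) q - N · inv q · (((1ℚ - inv p) · x p + inv p · y p) · M) ∣
    ≡⟨ cong ℚ.∣_∣ decompose ⟩
  ℚ.∣ x p · e q + (y p - x p) · e (p * q) ∣
    ≤⟨ ℚ.∣p+q∣≤∣p∣+∣q∣ (x p · e q) ((y p - x p) · e (p * q)) ⟩
  ℚ.∣ x p · e q ∣ + ℚ.∣ (y p - x p) · e (p * q) ∣
    ≡⟨ cong₂ _+_ (0≤p⇒∣p·q∣≡p·∣q∣ (0≤x p) (e q)) (begin-equality
       ℚ.∣ (y p - x p) · e (p * q) ∣   ≡⟨ ℚ.∣-p∣≡∣p∣ ((y p - x p) · e (p * q)) ⟨
       ℚ.∣ - ((y p - x p) · e (p * q)) ∣ ≡⟨ cong ℚ.∣_∣ (solve 3 (λ x y e → :- ((y :- x) :* e) := (x :- y) :* e) refl (x p) (y p) (e (p * q))) ⟩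
       ℚ.∣ (x p - y p) · e (p * q) ∣   ≡⟨ 0≤p⇒∣p·q∣≡p·∣q∣ (y≤x p) (e (p * q)) ⟩
       (x p - y p) · ℚ.∣ e (p * q) ∣   ∎) ⟩
  x p · ℚ.∣ e q ∣ + (x p - y p) · ℚ.∣ e (p * q) ∣
    ≤⟨ ℚ.+-mono-≤
         (·-mono 0≤1 (ℚ.0≤∣p∣ (e q)) (x≤1 p) (sieveSum-error n 0≤x x≤1 y≤x x-y≤c pc 1≤ps 1≤q ⊥q))
         (·-mono (ℚ.≤-trans (y≤x p) (x-y≤c p)) (ℚ.0≤∣p∣ (e (p * q))) (x-y≤c p)
           (sieveSum-error n 0≤x x≤1 y≤x x-y≤c pc 1≤ps (ℕ.*-mono-≤ 1≤p 1≤q) (coprime-step p⊥ ⊥q))) ⟩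
  1ℚ · E c ps (γ n) q + c p · E c ps (γ n) (p * q)
    ≡⟨ cong (_+ c p · E c ps (γ n) (p * q)) (ℚ.*-identityˡ (E c ps (γ n) q)) ⟩
  E c (p ∷ ps) (γ n) q ∎
  where
  open ℚ.≤-Reasoning
  N = fromℕ n
  M = ∏ ps λ p → (1ℚ - inv p) · x p + inv p · y p
  e : ℕ → ℚ
  e q = sieveSum n x y ps q - N · inv q · M

  decompose : sieveSum n x y (p ∷ ps) q - N · inv q · (((1ℚ - inv p) · x p + inv p · y p) · M)
            ≡ x p · e q + (y p - x p) · e (p * q)
  decompose = trans
    (cong₂ _-_ (sieveSum-∷ n x y ps p⊥q) refl)
    (trans (solve 8 (λ x y S S′ N i j M →
        x :* S :+ (y :- x) :* S′ :- N :* i :* (((con 1ℚ :- j) :* x :+ j :* y) :* M)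
        := x :* (S :- N :* i :* M) :+ (y :- x) :* (S′ :- N :* (j :* i) :* M)) refl
      (x p) (y p) (sieveSum n x y ps q) (sieveSum n x y ps (p * q)) N (inv q) (inv p) M)
      (cong (λ i → x p · e q + (y p - x p) · (sieveSum n x y ps (p * q) - N · i · M)) (sym (inv-* p q))))

2ℚ : ℚ
2ℚ = 1ℚ + 1ℚ

-- ∑_{a ≤ n , q ∣ a} 2^ω(a), with ω counting the prime factors in ps
sieveSum-2^ω : ∀ n {ps} → PairwiseCoprime ps → All (1 ≤_) ps → ∀ {q} → 1 ≤ q → All (λ p → Coprime p q) ps →
  sieveSum n (λ _ → 1ℚ) (λ _ → 2ℚ) ps q ≤ℚ fromℕ n · inv q · E inv ps (γ n) q
sieveSum-2^ω n [] [] {q} 1≤q [] = subst (_≤ℚ fromℕ n · inv q · γ n q) (sym (sieveSum-[] n (λ _ → 1ℚ) (λ _ → 2ℚ) q))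
  (multiples≤ n q 1≤q)
sieveSum-2^ω n {p ∷ ps} (p⊥ ∷ pc) (1≤p ∷ 1≤ps) {q} 1≤q (p⊥q ∷ ⊥q) = begin
  S (p ∷ ps) q                                              ≡⟨ sieveSum-∷ n (λ _ → 1ℚ) (λ _ → 2ℚ) ps p⊥q ⟩
  1ℚ · S ps q + (2ℚ - 1ℚ) · S ps (p * q)                    ≡⟨ cong₂ _+_ (ℚ.*-identityˡ (S ps q)) (ℚ.*-identityˡ (S ps (p * q))) ⟩
  S ps q + S ps (p * q)                                     ≤⟨ ℚ.+-mono-≤ (sieveSum-2^ω n pc 1≤ps 1≤q ⊥q)
                                                                 (sieveSum-2^ω n pc 1≤ps (ℕ.*-mono-≤ 1≤p 1≤q) (coprime-step p⊥ ⊥q)) ⟩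
  N · inv q · e q + N · inv (p * q) · e (p * q)             ≡⟨ cong (λ i → N · inv q · e q + N · i · e (p * q)) (inv-* p q) ⟩
  N · inv q · e q + N · (inv p · inv q) · e (p * q)         ≡⟨ solve 5 (λ N i j a b → N :* i :* a :+ N :* (j :* i) :* b := N :* i :* (a :+ j :* b)) refl
                                                                 N (inv q) (inv p) (e q) (e (p * q)) ⟩
  N · inv q · E inv (p ∷ ps) (γ n) q                        ∎
  where
  open ℚ.≤-Reasoning
  N = fromℕ n
  S = sieveSum n (λ _ → 1ℚ) (λ _ → 2ℚ)
  e = E inv ps (γ n)

-- P(X < τ) for X binomially distributed with parameters s , y
ρ : ℚ → ℕ → ℕ → ℚ
ρ y zero    zero    = 0ℚ
ρ y zero    (suc τ) = 1ℚ
ρ y (suc s) τ       = (1ℚ - y) · ρ y s τ + y · ρ y s (τ ∸ 1)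

-- This makes the truncated τ ∸ 1 in the recursion harmless: P(X < 0) and P(X < -1) are both 0.
ρ-0 : ∀ y s → ρ y s 0 ≡ 0ℚ
ρ-0 y zero    = refl
ρ-0 y (suc s) = trans (cong₂ (λ a b → (1ℚ - y) · a + y · b) (ρ-0 y s) (ρ-0 y s))
  (solve 1 (λ y → (con 1ℚ :- y) :* con 0ℚ :+ y :* con 0ℚ := con 0ℚ) refl y)

module _ {y : ℚ} (0≤y : 0ℚ ≤ℚ y) (y≤1 : y ≤ℚ 1ℚ) where

  private
    0≤1-y : 0ℚ ≤ℚ 1ℚ - y
    0≤1-y = 0≤q-p y 1ℚ y≤1

  convex-≤ : ∀ {a b c d} → a ≤ℚ c → b ≤ℚ d → (1ℚ - y) · a + y · b ≤ℚ (1ℚ - y) · c + y · d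
  convex-≤ a≤c b≤d = ℚ.+-mono-≤ (·-monoʳ 0≤1-y a≤c) (·-monoʳ 0≤y b≤d)

  convex-const : ∀ a → (1ℚ - y) · a + y · a ≡ a
  convex-const = solve 2 (λ y a → (con 1ℚ :- y) :* a :+ y :* a := a) refl y

  0≤ρ : ∀ s τ → 0ℚ ≤ℚ ρ y s τ
  0≤ρ zero    zero    = ℚ.≤-refl
  0≤ρ zero    (suc τ) = 0≤1
  0≤ρ (suc s) τ       = 0≤+ (0≤· 0≤1-y (0≤ρ s τ)) (0≤· 0≤y (0≤ρ s (τ ∸ 1)))

  ρ≤1 : ∀ s τ → ρ y s τ ≤ℚ 1ℚ
  ρ≤1 zero    zero    = 0≤1
  ρ≤1 zero    (suc τ) = ℚ.≤-refl
  ρ≤1 (suc s) τ       = ℚ.≤-trans (convex-≤ (ρ≤1 s τ) (ρ≤1 s (τ ∸ 1))) (ℚ.≤-reflexive (convex-const 1ℚ))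

  ρ-mono : ∀ s {τ τ′} → τ ≤ τ′ → ρ y s τ ≤ℚ ρ y s τ′
  ρ-mono zero    {zero}  {τ′}     _         = 0≤ρ zero τ′
  ρ-mono zero    {suc τ} {suc τ′} _         = ℚ.≤-refl
  ρ-mono (suc s) {τ}     {τ′}     τ≤τ′      = convex-≤ (ρ-mono s τ≤τ′) (ρ-mono s (ℕ.∸-monoˡ-≤ 1 τ≤τ′))

  -- P(X ≥ 1) ≤ sy is the union bound over the s trials.
  1-ρ₁≤ : ∀ s → 1ℚ - ρ y s 1 ≤ℚ fromℕ s · y
  1-ρ₁≤ zero    = ℚ.≤-reflexive (sym (ℚ.*-zeroˡ y))
  1-ρ₁≤ (suc s) = begin
    1ℚ - ((1ℚ - y) · ρ y s 1 + y · ρ y s 0)  ≡⟨ cong (λ z → 1ℚ - ((1ℚ - y) · ρ y s 1 + y · z)) (ρ-0 y s) ⟩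
    1ℚ - ((1ℚ - y) · ρ y s 1 + y · 0ℚ)       ≤⟨ ≤-via (0≤· 0≤y (0≤q-p (ρ y s 1) 1ℚ (ρ≤1 s 1)))
                                                 (solve 2 (λ y r → con 1ℚ :- r :+ y :- (con 1ℚ :- ((con 1ℚ :- y) :* r :+ y :* con 0ℚ)) := y :* (con 1ℚ :- r)) refl y (ρ y s 1)) ⟩
    1ℚ - ρ y s 1 + y                         ≤⟨ ℚ.+-monoˡ-≤ y (1-ρ₁≤ s) ⟩
    fromℕ s · y + y                          ≡⟨ solve 2 (λ s y → s :* y :+ y := (con 1ℚ :+ s) :* y) refl (fromℕ s) y ⟩
    (1ℚ + fromℕ s) · y                       ≡⟨ cong (_· y) (fromℕ-suc s) ⟨
    fromℕ (suc s) · y                        ∎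
    where open ℚ.≤-Reasoning

  1-ρ≤ : ∀ s {τ} → 1 ≤ τ → 1ℚ - ρ y s τ ≤ℚ fromℕ s · y
  1-ρ≤ s 1≤τ = ℚ.≤-trans (ℚ.+-monoʳ-≤ 1ℚ (ℚ.neg-antimono-≤ (ρ-mono s 1≤τ))) (1-ρ₁≤ s)

  -- P(X ≥ 2) ≤ (sy)²: either the other s trials contain two successes, or the new trial succeeds
  -- and the others contain one. The quadratic decay is what makes the Euler product converge.
  1-ρ₂≤ : ∀ s → 1ℚ - ρ y s 2 ≤ℚ fromℕ s · y · (fromℕ s · y)
  1-ρ₂≤ zero    = ℚ.≤-reflexive (solve 1 (λ y → con 0ℚ := con 0ℚ :* y :* (con 0ℚ :* y)) refl y)
  1-ρ₂≤ (suc s) = begin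
    1ℚ - ((1ℚ - y) · ρ y s 2 + y · ρ y s 1)          ≡⟨ solve 3 (λ y a b → con 1ℚ :- ((con 1ℚ :- y) :* a :+ y :* b) :=
                                                          (con 1ℚ :- y) :* (con 1ℚ :- a) :+ y :* (con 1ℚ :- b)) refl y (ρ y s 2) (ρ y s 1) ⟩
    (1ℚ - y) · (1ℚ - ρ y s 2) + y · (1ℚ - ρ y s 1)   ≤⟨ convex-≤ (1-ρ₂≤ s) (1-ρ₁≤ s) ⟩
    (1ℚ - y) · (S · y · (S · y)) + y · (S · y)       ≤⟨ ≤-via (0≤+ (0≤· 0≤y (0≤· (0≤· 0≤S 0≤y) (0≤· 0≤S 0≤y)))
                                                              (0≤· (0≤· (0≤+ 0≤S 0≤1) 0≤y) 0≤y))
                                                          (solve 2 (λ S y → (con 1ℚ :+ S) :* y :* ((con 1ℚ :+ S) :* y) :- ((con 1ℚ :- y) :* (S :* y :* (S :* y)) :+ y :* (S :* y))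
                                                            := y :* (S :* y :* (S :* y)) :+ (S :+ con 1ℚ) :* y :* y) refl S y) ⟩
    (1ℚ + S) · y · ((1ℚ + S) · y)                    ≡⟨ cong (λ z → z · y · (z · y)) (fromℕ-suc s) ⟨
    fromℕ (suc s) · y · (fromℕ (suc s) · y)          ∎
    where
    open ℚ.≤-Reasoning
    S = fromℕ s
    0≤S = 0≤fromℕ s

  1-ρ≤² : ∀ s {τ} → 2 ≤ τ → 1ℚ - ρ y s τ ≤ℚ fromℕ s · y · (fromℕ s · y)
  1-ρ≤² s 2≤τ = ℚ.≤-trans (ℚ.+-monoʳ-≤ 1ℚ (ℚ.neg-antimono-≤ (ρ-mono s 2≤τ))) (1-ρ₂≤ s)

-- Primes with τ(p) ≤ 1 are those at which a single multiple costs a factor 2 in the error term.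

weight : ℕ → ℚ
weight 0 = 2ℚ
weight 1 = 2ℚ
weight (suc (suc _)) = 1ℚ

1≤2 : 1ℚ ≤ℚ 2ℚ
1≤2 = *≤* (+≤+ (s≤s z≤n))

1≤weight : ∀ τ → 1ℚ ≤ℚ weight τ
1≤weight 0 = 1≤2
1≤weight 1 = 1≤2
1≤weight (suc (suc _)) = ℚ.≤-refl

0≤weight : ∀ τ → 0ℚ ≤ℚ weight τ
0≤weight τ = ℚ.≤-trans 0≤1 (1≤weight τ)

-- The factor 2 is attained only in passing from τ = 2 to τ = 1.
weight-∸1 : ∀ τ → weight (τ ∸ 1) ≤ℚ weight τ · 2ℚ
weight-∸1 0 = *≤* (+≤+ (s≤s (s≤s z≤n)))
weight-∸1 1 = *≤* (+≤+ (s≤s (s≤s z≤n)))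
weight-∸1 2 = ℚ.≤-refl
weight-∸1 (suc (suc (suc _))) = 1≤2

gap : ℕ → ℕ → ℕ → ℚ
gap s 0 p = 1ℚ
gap s 1 p = 1ℚ
gap s (suc (suc _)) p = fromℕ s · inv p

ρ-gap : ∀ s τ p → ρ (inv p) s τ - ρ (inv p) s (τ ∸ 1) ≤ℚ gap s τ p
ρ-gap s τ p = go τ
  where
  ρ′ = ρ (inv p) s
  0≤ρ′ = 0≤ρ (0≤inv p) (inv≤1 p) s
  ≤1 : ∀ {a b} → 0ℚ ≤ℚ b → a ≤ℚ 1ℚ → a - b ≤ℚ 1ℚ
  ≤1 {a} {b} 0≤b a≤1 = p-q≤r a b (ℚ.≤-trans a≤1 (p≤p+q 0≤b))
  go : ∀ τ → ρ′ τ - ρ′ (τ ∸ 1) ≤ℚ gap s τ p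
  go 0 = ≤1 (0≤ρ′ 0) (ρ≤1 (0≤inv p) (inv≤1 p) s 0)
  go 1 = ≤1 (0≤ρ′ 0) (ρ≤1 (0≤inv p) (inv≤1 p) s 1)
  go (suc (suc τ)) = ℚ.≤-trans (ℚ.+-monoˡ-≤ (- ρ′ (suc τ)) (ρ≤1 (0≤inv p) (inv≤1 p) s (suc (suc τ))))
    (1-ρ≤ (0≤inv p) (inv≤1 p) s (s≤s z≤n))

-- Where the gap is 1, the operator 1 + T_p is bounded by 2, because T_p decreases g. The
-- nonnegative term c_p T_p is then put back, so that the operator has the same form at every prime
-- and `E-pow` applies.
E-gap : ∀ s τ ps {g} q → (∀ q → 0ℚ ≤ℚ g q) → (∀ r q → g (r * q) ≤ℚ g q) →
  E (λ p → gap s (τ p) p) ps g q ≤ℚ ∏ ps (weight ∘ τ) · E (λ p → fromℕ s · inv p) ps g q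
E-gap s τ [] {g} q _ _ = ℚ.≤-reflexive (sym (ℚ.*-identityˡ (g q)))
E-gap s τ (p ∷ ps) {g} q 0≤g anti = step (τ p)
  where
  open ℚ.≤-Reasoning
  c = λ p → fromℕ s · inv p
  0≤c : ∀ p → 0ℚ ≤ℚ c p
  0≤c p = 0≤· (0≤fromℕ s) (0≤inv p)
  B = ∏ ps (weight ∘ τ)
  0≤B = 0≤∏ ps (0≤weight ∘ τ)
  G = E c ps g
  0≤G : ∀ q → 0ℚ ≤ℚ G q
  0≤G q = 0≤E 0≤c ps q 0≤g
  H = E (λ p → gap s (τ p) p) ps g

  double : H q + 1ℚ · H (p * q) ≤ℚ 2ℚ · B · (G q + c p · G (p * q))
  double = begin
    H q + 1ℚ · H (p * q)                 ≤⟨ ℚ.+-mono-≤ (E-gap s τ ps q 0≤g anti) (·-monoʳ 0≤1 (E-gap s τ ps (p * q) 0≤g anti)) ⟩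
    B · G q + 1ℚ · (B · G (p * q))       ≤⟨ ℚ.+-monoʳ-≤ (B · G q) (·-monoʳ 0≤1 (·-monoʳ 0≤B (E-antitone 0≤c ps p q (anti p)))) ⟩
    B · G q + 1ℚ · (B · G q)             ≡⟨ solve 2 (λ B G → B :* G :+ con 1ℚ :* (B :* G) := con 2ℚ :* B :* G) refl B (G q) ⟩
    2ℚ · B · G q                         ≤⟨ ·-monoʳ (0≤· (ℚ.≤-trans 0≤1 1≤2) 0≤B) (p≤p+q (0≤· (0≤c p) (0≤G (p * q)))) ⟩
    2ℚ · B · (G q + c p · G (p * q))     ∎

  step : ∀ t → H q + gap s t p · H (p * q) ≤ℚ weight t · B · (G q + c p · G (p * q))
  step 0 = double
  step 1 = double
  step (suc (suc _)) = begin
    H q + c p · H (p * q)                ≤⟨ ℚ.+-mono-≤ (E-gap s τ ps q 0≤g anti) (·-monoʳ (0≤c p) (E-gap s τ ps (p * q) 0≤g anti)) ⟩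
    B · G q + c p · (B · G (p * q))      ≡⟨ solve 4 (λ B a k b → B :* a :+ k :* (B :* b) := con 1ℚ :* B :* (a :+ k :* b)) refl
                                              B (G q) (c p) (G (p * q)) ⟩
    1ℚ · B · (G q + c p · G (p * q))     ∎

-- Counting tuples in which fewer than τ(p) entries are divisible by p

∑-cartesianProductWith : ∀ {Z : Set} (h : X → Y → Z) xs ys {F : Z → ℚ} →
  ∑ (cartesianProductWith h xs ys) F ≡ ∑ xs (λ x → ∑ ys (λ y → F (h x y)))
∑-cartesianProductWith h []       ys = refl
∑-cartesianProductWith h (x ∷ xs) ys = trans (∑-++ (map (h x) ys) (cartesianProductWith h xs ys))
  (cong₂ _+_ (∑-map (h x) ys) (∑-cartesianProductWith h xs ys))

lower : (ℕ → ℕ) → ℕ → ℕ → ℕ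
lower τ a p = pick (p ∣? a) (τ p ∸ 1) (τ p)

-- The indicator that fewer than τ(p) entries are divisible by p, for all p in ps. Each entry lowers
-- τ at the primes dividing it, and ρ with s = 0 finally tests 0 < τ(p). Consuming one entry at a
-- time fits the induction on s.
allowed : ∀ {s} → List ℕ → (ℕ → ℕ) → Vec ℕ s → ℚ
allowed ps τ []       = ∏ ps λ p → ρ (inv p) 0 (τ p)
allowed ps τ (a ∷ as) = allowed ps (lower τ a) as

module Core (n : ℕ) (1≤n : 1 ≤ n) (ps : List ℕ) (pc : PairwiseCoprime ps) (1≤ps : All (1 ≤_) ps) where

  private
    N = fromℕ n

  L : ℚ
  L = E inv ps (γ n) 1

  0≤L : 0ℚ ≤ℚ L
  0≤L = 0≤E 0≤inv ps 1 (0≤γ n)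

  1≤L : 1ℚ ≤ℚ L
  1≤L = ℚ.≤-trans (ℚ.≤-reflexive (sym (γ-small n 1 (s≤s z≤n) 1≤n))) (g≤E 0≤inv ps 1 (0≤γ n))

  F : (s : ℕ) → (ℕ → ℕ) → ℚ
  F s τ = ∑ (tuples s (1 ⋯ n)) (allowed ps τ)

  -- The first summand is the inherited error, summed over the new entry by `∑-weight`; the second
  -- is the sieve error from `main-step`.
  err : ℕ → ℚ
  err zero    = 0ℚ
  err (suc s) = err s · (N · L) + (N · L) ^ s

  0≤err : ∀ s → 0ℚ ≤ℚ err s
  0≤err zero    = ℚ.≤-refl
  0≤err (suc s) = 0≤+ (0≤· (0≤err s) (0≤· (0≤fromℕ n) 0≤L)) (0≤^ s (0≤· (0≤fromℕ n) 0≤L))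

  err-suc : ∀ s → err (suc s) ≡ fromℕ (suc s) · (N · L) ^ s
  err-suc zero    = trans (cong (_+ 1ℚ) (ℚ.*-zeroˡ (N · L))) refl
  err-suc (suc s) = trans (cong (λ e → e · (N · L) + (N · L) ^ suc s) (err-suc s))
    (trans (solve 3 (λ m x y → m :* y :* x :+ x :* y := (con 1ℚ :+ m) :* (x :* y)) refl (fromℕ (suc s)) (N · L) ((N · L) ^ s))
      (cong (_· (N · L) ^ suc s) (sym (fromℕ-suc (suc s)))))

  private
    1⊥ : All (λ p → Coprime p 1) ps
    1⊥ = All.tabulate λ _ → λ (_ , d∣1) → ∣1⇒≡1 d∣1

    main : (s : ℕ) → (ℕ → ℕ) → ℚ
    main s τ = N ^ s · ∏ ps (λ p → ρ (inv p) s (τ p))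

    sieveSum-1 : ∀ x y → ∑ (1 ⋯ n) (λ a → ∏ ps (λ p → pick (p ∣? a) (y p) (x p))) ≡ sieveSum n x y ps 1
    sieveSum-1 x y = ∑-cong (1 ⋯ n) λ {a} _ →
      sym (trans (cong (_· ∏ ps (λ p → pick (p ∣? a) (y p) (x p))) (pick-yes (1 ∣? a) (1∣ a))) (ℚ.*-identityˡ (∏ ps _)))

    ∏-lower : ∀ (h : ℕ → ℕ → ℚ) τ a →
      ∏ ps (λ p → h p (lower τ a p)) ≡ ∏ ps (λ p → pick (p ∣? a) (h p (τ p ∸ 1)) (h p (τ p)))
    ∏-lower h τ a = ∏-cong ps λ {p} _ → pick-∘ (h p) (p ∣? a)

  F-suc : ∀ s τ → F (suc s) τ ≡ ∑ (1 ⋯ n) (λ a → F s (lower τ a))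
  F-suc s τ = ∑-cartesianProductWith _∷_ (1 ⋯ n) (tuples s (1 ⋯ n))

  -- Summing over the new entry is a sieve with local weights ρ_s(τ) and ρ_s(τ - 1). Their mean (1 -
  -- 1/p) ρ_s(τ) + (1/p) ρ_s(τ - 1) is ρ_{s+1}(τ) by definition, so only the sieve error remains.
  main-step : ∀ s τ → ℚ.∣ ∑ (1 ⋯ n) (λ a → main s (lower τ a)) - main (suc s) τ ∣ ≤ℚ (N · L) ^ s · ∏ ps (weight ∘ τ)
  main-step s τ = begin
    ℚ.∣ ∑ (1 ⋯ n) (λ a → main s (lower τ a)) - main (suc s) τ ∣
      ≡⟨ cong ℚ.∣_∣ (begin-equality
         ∑ (1 ⋯ n) (λ a → main s (lower τ a)) - main (suc s) τ
           ≡⟨ cong (_- main (suc s) τ) (trans (∑-· (1 ⋯ n) (N ^ s) (λ a → ∏ ps (λ p → ρ (inv p) s (lower τ a p))))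
                (cong (N ^ s ·_) (trans (∑-cong (1 ⋯ n) (λ {a} _ → ∏-lower (λ p → ρ (inv p) s) τ a)) (sieveSum-1 x y)))) ⟩
         N ^ s · sieveSum n x y ps 1 - N ^ suc s · M
           ≡⟨ solve 4 (λ P S N M → P :* S :- N :* P :* M := P :* (S :- N :* con 1ℚ :* M)) refl (N ^ s) (sieveSum n x y ps 1) N M ⟩
         N ^ s · (sieveSum n x y ps 1 - N · inv 1 · M) ∎) ⟩
    ℚ.∣ N ^ s · (sieveSum n x y ps 1 - N · inv 1 · M) ∣
      ≡⟨ 0≤p⇒∣p·q∣≡p·∣q∣ 0≤Nˢ (sieveSum n x y ps 1 - N · inv 1 · M) ⟩
    N ^ s · ℚ.∣ sieveSum n x y ps 1 - N · inv 1 · M ∣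
      ≤⟨ ·-monoʳ 0≤Nˢ (sieveSum-error n (λ p → 0≤ρ (0≤inv p) (inv≤1 p) s (τ p)) (λ p → ρ≤1 (0≤inv p) (inv≤1 p) s (τ p))
           (λ p → 0≤q-p (y p) (x p) (ρ-mono (0≤inv p) (inv≤1 p) s (ℕ.m∸n≤m (τ p) 1))) (λ p → ρ-gap s (τ p) p) pc 1≤ps (s≤s z≤n) 1⊥) ⟩
    N ^ s · E (λ p → gap s (τ p) p) ps (γ n) 1
      ≤⟨ ·-monoʳ 0≤Nˢ (E-gap s τ ps 1 (0≤γ n) (γ-antitone 1≤n)) ⟩
    N ^ s · (B · E (λ p → fromℕ s · inv p) ps (γ n) 1)
      ≤⟨ ·-monoʳ 0≤Nˢ (·-monoʳ 0≤B (E-pow 0≤inv ps (0≤γ n) (γ-submult 1≤n) s 1)) ⟩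
    N ^ s · (B · (L ^ s · γ n 1))
      ≡⟨ cong (λ z → N ^ s · (B · (L ^ s · z))) (γ-small n 1 (s≤s z≤n) 1≤n) ⟩
    N ^ s · (B · (L ^ s · 1ℚ))
      ≡⟨ solve 3 (λ P B L → P :* (B :* (L :* con 1ℚ)) := P :* L :* B) refl (N ^ s) B (L ^ s) ⟩
    N ^ s · L ^ s · B
      ≡⟨ cong (_· B) (^-distrib-· N L s) ⟨
    (N · L) ^ s · B ∎
    where
    open ℚ.≤-Reasoning
    x = λ p → ρ (inv p) s (τ p)
    y = λ p → ρ (inv p) s (τ p ∸ 1)
    M = ∏ ps (λ p → ρ (inv p) (suc s) (τ p))
    B = ∏ ps (weight ∘ τ)
    0≤B = 0≤∏ ps (0≤weight ∘ τ)
    0≤Nˢ = 0≤^ s (0≤fromℕ n)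

  ∑-weight : ∀ τ → ∑ (1 ⋯ n) (λ a → ∏ ps (weight ∘ lower τ a)) ≤ℚ N · L · ∏ ps (weight ∘ τ)
  ∑-weight τ = begin
    ∑ (1 ⋯ n) (λ a → ∏ ps (weight ∘ lower τ a))
      ≤⟨ ∑-mono (1 ⋯ n) (λ a → ℚ.≤-trans (∏-mono ps (λ p → 0≤weight (lower τ a p)) (λ p → weight-lower a p))
           (ℚ.≤-reflexive (∏-· ps (weight ∘ τ) (λ p → pick (p ∣? a) 2ℚ 1ℚ)))) ⟩
    ∑ (1 ⋯ n) (λ a → B · ∏ ps (λ p → pick (p ∣? a) 2ℚ 1ℚ))
      ≡⟨ trans (∑-· (1 ⋯ n) B (λ a → ∏ ps (λ p → pick (p ∣? a) 2ℚ 1ℚ))) (cong (B ·_) (sieveSum-1 (λ _ → 1ℚ) (λ _ → 2ℚ))) ⟩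
    B · sieveSum n (λ _ → 1ℚ) (λ _ → 2ℚ) ps 1
      ≤⟨ ·-monoʳ (0≤∏ ps (0≤weight ∘ τ)) (sieveSum-2^ω n pc 1≤ps (s≤s z≤n) 1⊥) ⟩
    B · (N · 1ℚ · L)
      ≡⟨ solve 3 (λ B N L → B :* (N :* con 1ℚ :* L) := N :* L :* B) refl B N L ⟩
    N · L · B ∎
    where
    open ℚ.≤-Reasoning
    B = ∏ ps (weight ∘ τ)
    weight-lower : ∀ a p → weight (lower τ a p) ≤ℚ weight (τ p) · pick (p ∣? a) 2ℚ 1ℚ
    weight-lower a p with p ∣? a
    ... | yes _ = weight-∸1 (τ p)
    ... | no  _ = ℚ.≤-reflexive (sym (ℚ.*-identityʳ (weight (τ p))))

  count-error : ∀ s τ → ℚ.∣ F s τ - N ^ s · ∏ ps (λ p → ρ (inv p) s (τ p)) ∣ ≤ℚ err s · ∏ ps (weight ∘ τ)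
  count-error zero    τ = ℚ.≤-reflexive (trans
    (cong ℚ.∣_∣ (solve 1 (λ x → x :+ con 0ℚ :- con 1ℚ :* x := con 0ℚ) refl (∏ ps (λ p → ρ (inv p) 0 (τ p)))))
    (sym (ℚ.*-zeroˡ (∏ ps (weight ∘ τ)))))
  count-error (suc s) τ = begin
    ℚ.∣ F (suc s) τ - main (suc s) τ ∣
      ≡⟨ cong ℚ.∣_∣ (trans (cong (_- main (suc s) τ) (trans (F-suc s τ)
           (trans (∑-cong (1 ⋯ n) (λ {a} _ → sym (Identities.minus-cancel (F s (lower τ a)) (main s (lower τ a)))))
             (∑-+ (1 ⋯ n) d (λ a → main s (lower τ a))))))
           (solve 3 (λ a b c → a :+ b :- c := a :+ (b :- c)) refl (∑ (1 ⋯ n) d) Σmain (main (suc s) τ))) ⟩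
    ℚ.∣ ∑ (1 ⋯ n) d + (Σmain - main (suc s) τ) ∣
      ≤⟨ ℚ.∣p+q∣≤∣p∣+∣q∣ (∑ (1 ⋯ n) d) (Σmain - main (suc s) τ) ⟩
    ℚ.∣ ∑ (1 ⋯ n) d ∣ + ℚ.∣ Σmain - main (suc s) τ ∣
      ≤⟨ ℚ.+-mono-≤ (begin
         ℚ.∣ ∑ (1 ⋯ n) d ∣                                   ≤⟨ ∣∑∣≤∑∣∣ (1 ⋯ n) d ⟩
         ∑ (1 ⋯ n) (λ a → ℚ.∣ d a ∣)                         ≤⟨ ∑-mono (1 ⋯ n) (λ a → count-error s (lower τ a)) ⟩
         ∑ (1 ⋯ n) (λ a → err s · ∏ ps (weight ∘ lower τ a)) ≡⟨ ∑-· (1 ⋯ n) (err s) (λ a → ∏ ps (weight ∘ lower τ a)) ⟩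
         err s · ∑ (1 ⋯ n) (λ a → ∏ ps (weight ∘ lower τ a)) ≤⟨ ·-monoʳ (0≤err s) (∑-weight τ) ⟩
         err s · (N · L · B)                                 ∎)
         (main-step s τ) ⟩
    err s · (N · L · B) + (N · L) ^ s · B
      ≡⟨ solve 4 (λ e x y B → e :* (x :* B) :+ y :* B := (e :* x :+ y) :* B) refl (err s) (N · L) ((N · L) ^ s) B ⟩
    err (suc s) · B ∎
    where
    open ℚ.≤-Reasoning
    B = ∏ ps (weight ∘ τ)
    d = λ a → F s (lower τ a) - main s (lower τ a)
    Σmain = ∑ (1 ⋯ n) (λ a → main s (lower τ a))

-- Primes and products of distinct primes

primes : ℕ → List ℕ
primes zero    = []
primes (suc m) = pick (prime? (suc m)) (suc m ∷ primes m) (primes m)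

∈-primes⁻ : ∀ m {p} → p ∈ primes m → Prime p × p ≤ m
∈-primes⁻ (suc m) p∈ with prime? (suc m) | p∈
... | yes pr | here refl = pr , ℕ.≤-refl
... | yes pr | there p∈′ = let (pr′ , p≤m) = ∈-primes⁻ m p∈′ in pr′ , ℕ.m≤n⇒m≤1+n p≤m
... | no _   | p∈′       = let (pr′ , p≤m) = ∈-primes⁻ m p∈′ in pr′ , ℕ.m≤n⇒m≤1+n p≤m

∈-primes⁺ : ∀ m {p} → Prime p → p ≤ m → p ∈ primes m
∈-primes⁺ zero    pr z≤n = contradiction pr ¬prime[0]
∈-primes⁺ (suc m) {p} pr p≤1+m with ℕ.m≤n⇒m<n∨m≡n p≤1+m | prime? (suc m)
... | inj₁ (s≤s p≤m) | yes _  = there (∈-primes⁺ m pr p≤m)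
... | inj₁ (s≤s p≤m) | no  _  = ∈-primes⁺ m pr p≤m
... | inj₂ refl      | yes _  = here refl
... | inj₂ refl      | no ¬pr = contradiction pr ¬pr

prime⇒2≤ : ∀ {p} → Prime p → 2 ≤ p
prime⇒2≤ {p} pr = ℕ.nonTrivial⇒n>1 p {{prime⇒nonTrivial pr}}

prime⇒1≤ : ∀ {p} → Prime p → 1 ≤ p
prime⇒1≤ pr = ℕ.<⇒≤ (prime⇒2≤ pr)

primes-coprime : ∀ m → PairwiseCoprime (primes m)
primes-coprime zero = []
primes-coprime (suc m) with prime? (suc m)
... | no _   = primes-coprime m
... | yes pr = All.tabulate (λ r∈ → let (pr′ , r≤m) = ∈-primes⁻ m r∈ in
                 Coprime.prime⇒coprime pr {{ℕ.>-nonZero (prime⇒1≤ pr′)}} (s≤s r≤m))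
             ∷ primes-coprime m

1≤primes : ∀ m → All (1 ≤_) (primes m)
1≤primes m = All.tabulate λ p∈ → prime⇒1≤ (proj₁ (∈-primes⁻ m p∈))

subproducts : List ℕ → List ℕ
subproducts []       = [ 1 ]
subproducts (p ∷ ps) = subproducts ps ++ map (p *_) (subproducts ps)

subproducts-coprime : ∀ {r} ps → All (Coprime r) ps → ∀ {d} → d ∈ subproducts ps → Coprime r d
subproducts-coprime []       []        (here refl) (_ , e∣1) = ∣1⇒≡1 e∣1
subproducts-coprime (p ∷ ps) (rp ∷ r⊥) d∈ with ∈-++⁻ (subproducts ps) d∈
... | inj₁ d∈′ = subproducts-coprime ps r⊥ d∈′
... | inj₂ d∈′ with ∈-map⁻ (p *_) d∈′
...   | e , e∈ , refl = coprime-* rp (subproducts-coprime ps r⊥ e∈)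

1≤subproducts : ∀ {ps} → All (1 ≤_) ps → ∀ {d} → d ∈ subproducts ps → 1 ≤ d
1≤subproducts []                  (here refl) = ℕ.≤-refl
1≤subproducts {p ∷ ps} (1≤p ∷ 1≤ps) d∈ with ∈-++⁻ (subproducts ps) d∈
... | inj₁ d∈′ = 1≤subproducts 1≤ps d∈′
... | inj₂ d∈′ with ∈-map⁻ (p *_) d∈′
...   | e , e∈ , refl = ℕ.*-mono-≤ 1≤p (1≤subproducts 1≤ps e∈)

-- Products without p are coprime to p and those with p are not, so the two halves are disjoint.
subproducts-unique : ∀ {ps} → PairwiseCoprime ps → All (2 ≤_) ps → Unique (subproducts ps)
subproducts-unique []        []          = [] ∷ []
subproducts-unique {p ∷ ps} (p⊥ ∷ pc) (2≤p ∷ 2≤ps) =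
  Unique.++⁺ u (Unique.map⁺ (ℕ.*-cancelˡ-≡ _ _ p {{ℕ.>-nonZero (ℕ.<⇒≤ 2≤p)}}) u) λ { (d∈ , d∈′) → disjoint d∈ d∈′ }
  where
  u = subproducts-unique pc 2≤ps
  disjoint : ∀ {d} → d ∈ subproducts ps → ¬ d ∈ map (p *_) (subproducts ps)
  disjoint d∈ d∈′ with ∈-map⁻ (p *_) d∈′
  ... | e , _ , refl = contradiction (subproducts-coprime ps p⊥ d∈ (∣-refl , m∣m*n e)) (ℕ.>⇒≢ 2≤p)

-- The expansion of the operator product over subsets of ps. Carrying 1/q along lets the
-- coefficients 1/p merge into 1/(dq).
E-subproducts : ∀ ps g q → E inv ps g q · inv q ≡ ∑ (subproducts ps) (λ d → g (d * q) · inv (d * q))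
E-subproducts [] g q = sym (trans (ℚ.+-identityʳ (g (1 * q) · inv (1 * q))) (cong (λ m → g m · inv m) (ℕ.*-identityˡ q)))
E-subproducts (p ∷ ps) g q = begin
  (E inv ps g q + inv p · E inv ps g (p * q)) · inv q          ≡⟨ solve 4 (λ a i b j → (a :+ i :* b) :* j := a :* j :+ b :* (i :* j)) refl
                                                                    (E inv ps g q) (inv p) (E inv ps g (p * q)) (inv q) ⟩
  E inv ps g q · inv q + E inv ps g (p * q) · (inv p · inv q)  ≡⟨ cong (λ i → E inv ps g q · inv q + E inv ps g (p * q) · i) (inv-* p q) ⟨
  E inv ps g q · inv q + E inv ps g (p * q) · inv (p * q)      ≡⟨ cong₂ _+_ (E-subproducts ps g q) (E-subproducts ps g (p * q)) ⟩
  ∑ D (h q) + ∑ D (h (p * q))                                  ≡⟨ cong (∑ D (h q) +_) (∑-cong D (λ {d} _ → cong (λ m → g m · inv m) (swap d))) ⟩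
  ∑ D (h q) + ∑ D (h q ∘ (p *_))                               ≡⟨ cong (∑ D (h q) +_) (∑-map (p *_) D) ⟨
  ∑ D (h q) + ∑ (map (p *_) D) (h q)                           ≡⟨ ∑-++ D (map (p *_) D) ⟨
  ∑ (subproducts (p ∷ ps)) (h q)                               ∎
  where
  open ≡-Reasoning
  D = subproducts ps
  h : ℕ → ℕ → ℚ
  h q d = g (d * q) · inv (d * q)
  swap : ∀ d → d * (p * q) ≡ p * d * q
  swap d = trans (sym (ℕ.*-assoc d p q)) (cong (_* q) (ℕ.*-comm d p))

-- The one-dimensional sieve sum against the harmonic sum

harmonic : ℕ → ℚ
harmonic n = ∑ (1 ⋯ n) inv

-- 1/(m+1)² ≤ 1/(m(m+1)) = 1/m - 1/(m+1), written without subtraction.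
inv-telescope : ∀ {m} → 1 ≤ m → inv (suc m) · inv (suc m) + inv (suc m) ≤ℚ inv m
inv-telescope {m} 1≤m = begin
  j · j + j            ≤⟨ ℚ.+-monoˡ-≤ j (·-monoˡ (0≤inv (suc m)) (inv-antitone 1≤m (ℕ.n≤1+n m))) ⟩
  i · j + j            ≡⟨ cong (i · j +_) (trans (cong (_· j) (fromℕ·inv 1≤m)) (ℚ.*-identityˡ j)) ⟨
  i · j + M · i · j    ≡⟨ solve 3 (λ i j M → i :* j :+ M :* i :* j := i :* ((con 1ℚ :+ M) :* j)) refl i j M ⟩
  i · ((1ℚ + M) · j)   ≡⟨ cong (λ z → i · (z · j)) (fromℕ-suc m) ⟨
  i · (fromℕ (suc m) · j) ≡⟨ trans (cong (i ·_) (fromℕ·inv {suc m} (s≤s z≤n))) (ℚ.*-identityʳ i) ⟩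
  i                    ∎
  where
  open ℚ.≤-Reasoning
  i = inv m
  j = inv (suc m)
  M = fromℕ m

-- Beyond n the summand is n/d², which telescopes. The extra term n/(n + j) is the part of the
-- budget not yet spent, and at j = 0 it is the 1 on the right.
∑-γ : ∀ {n} → 1 ≤ n → ∀ j → ∑ (1 ⋯ (n ℕ.+ j)) (λ d → γ n d · inv d) + fromℕ n · inv (n ℕ.+ j) ≤ℚ harmonic n + 1ℚ
∑-γ {n} 1≤n zero rewrite ℕ.+-identityʳ n = ℚ.+-mono-≤
  (∑-mono (1 ⋯ n) (λ d → ℚ.≤-trans (·-monoˡ (0≤inv d) (γ≤1 n d)) (ℚ.≤-reflexive (ℚ.*-identityˡ (inv d)))))
  (ℚ.≤-reflexive (fromℕ·inv 1≤n))
∑-γ {n} 1≤n (suc j) rewrite ℕ.+-suc n j = begin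
  ∑ (1 ⋯ suc m) h + N · inv (suc m)                         ≡⟨ cong (_+ N · inv (suc m)) (∑-⋯-suc m h) ⟩
  ∑ (1 ⋯ m) h + γ n (suc m) · inv (suc m) + N · inv (suc m) ≡⟨ cong (λ z → ∑ (1 ⋯ m) h + z · inv (suc m) + N · inv (suc m))
                                                                 (γ-large n (suc m) (ℕ.m≤n⇒m≤1+n (ℕ.m≤m+n n j))) ⟩
  ∑ (1 ⋯ m) h + N · inv (suc m) · inv (suc m) + N · inv (suc m) ≡⟨ solve 3 (λ S N i → S :+ N :* i :* i :+ N :* i := S :+ N :* (i :* i :+ i)) refl
                                                                 (∑ (1 ⋯ m) h) N (inv (suc m)) ⟩
  ∑ (1 ⋯ m) h + N · (inv (suc m) · inv (suc m) + inv (suc m)) ≤⟨ ℚ.+-monoʳ-≤ (∑ (1 ⋯ m) h) (·-monoʳ (0≤fromℕ n)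
                                                                 (inv-telescope (ℕ.≤-trans 1≤n (ℕ.m≤m+n n j)))) ⟩
  ∑ (1 ⋯ m) h + N · inv m                                   ≤⟨ ∑-γ 1≤n j ⟩
  harmonic n + 1ℚ                                           ∎
  where
  open ℚ.≤-Reasoning
  N = fromℕ n
  m = n ℕ.+ j
  h = λ d → γ n d · inv d

∈⇒≤sumℕ : ∀ {x} xs → x ∈ xs → x ≤ sumℕ xs
∈⇒≤sumℕ (x ∷ xs) (here refl) = ℕ.m≤m+n x (sumℕ xs)
∈⇒≤sumℕ (y ∷ xs) (there x∈)  = ℕ.≤-trans (∈⇒≤sumℕ xs x∈) (ℕ.m≤n+m (sumℕ xs) y)

E-inv≤ : ∀ {n} → 1 ≤ n → ∀ {ps} → PairwiseCoprime ps → All (2 ≤_) ps → E inv ps (γ n) 1 ≤ℚ harmonic n + 1ℚ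
E-inv≤ {n} 1≤n {ps} pc 2≤ps = begin
  E inv ps (γ n) 1                                   ≡⟨ ℚ.*-identityʳ (E inv ps (γ n) 1) ⟨
  E inv ps (γ n) 1 · inv 1                           ≡⟨ E-subproducts ps (γ n) 1 ⟩
  ∑ D (λ d → γ n (d * 1) · inv (d * 1))              ≡⟨ ∑-cong D (λ {d} _ → cong (λ m → γ n m · inv m) (ℕ.*-identityʳ d)) ⟩
  ∑ D h                                              ≤⟨ ∑-⊆ (λ d → 0≤· (0≤γ n d) (0≤inv d)) (subproducts-unique pc 2≤ps) D⊆ ⟩
  ∑ (1 ⋯ (n ℕ.+ sumℕ D)) h                           ≤⟨ p≤p+q (0≤· (0≤fromℕ n) (0≤inv (n ℕ.+ sumℕ D))) ⟩
  ∑ (1 ⋯ (n ℕ.+ sumℕ D)) h + fromℕ n · inv (n ℕ.+ sumℕ D)  ≤⟨ ∑-γ 1≤n (sumℕ D) ⟩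
  harmonic n + 1ℚ                                    ∎
  where
  open ℚ.≤-Reasoning
  D = subproducts ps
  h = λ d → γ n d · inv d
  -- `sumℕ D` serves as an upper bound for the elements of D; n is added to give the range the shape
  -- n + j of `∑-γ`.
  D⊆ : ∀ {d} → d ∈ D → d ∈ 1 ⋯ (n ℕ.+ sumℕ D)
  D⊆ d∈ = ∈-⋯⁺ (1≤subproducts (All.map ℕ.<⇒≤ 2≤ps) d∈) (ℕ.≤-trans (∈⇒≤sumℕ D d∈) (ℕ.m≤n+m (sumℕ D) n))

-- The logarithm dominates the harmonic sum

module _ (n-1 : ℕ) where

  private
    n = suc n-1
    open LogCauchy n-1 using (x; 0≤x; xʲ≤1; S-mono)

  bernoulli : ∀ j → 1ℚ - fromℕ j · inv n ≤ℚ x ^ j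
  bernoulli zero    = ℚ.≤-reflexive (solve 1 (λ i → con 1ℚ :- con 0ℚ :* i := con 1ℚ) refl (inv n))
  bernoulli (suc j) = begin
    1ℚ - fromℕ (suc j) · inv n                 ≡⟨ cong (λ z → 1ℚ - z · inv n) (fromℕ-suc j) ⟩
    1ℚ - (1ℚ + fromℕ j) · inv n                ≤⟨ ≤-via (0≤· (0≤· (0≤fromℕ j) (0≤inv n)) (0≤inv n))
                                                   (solve 2 (λ i J → (con 1ℚ :- i) :* (con 1ℚ :- J :* i) :- (con 1ℚ :- (con 1ℚ :+ J) :* i) := J :* i :* i) refl (inv n) (fromℕ j)) ⟩
    (1ℚ - inv n) · (1ℚ - fromℕ j · inv n)      ≤⟨ ·-monoʳ 0≤x (bernoulli j) ⟩
    x ^ suc j                                  ∎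
    where open ℚ.≤-Reasoning

  -- By Bernoulli the j-th term x^j/j is at least 1/j - 1/n. At J = n the total loss is 1, so log n
  -- ≥ H_n - 1 already holds for the partial sums.
  harmonic≤logSum : ∀ J → harmonic J - fromℕ J · inv n ≤ℚ logSum n J
  harmonic≤logSum zero    = ℚ.≤-reflexive (solve 1 (λ i → con 0ℚ :- con 0ℚ :* i := con 0ℚ) refl (inv n))
  harmonic≤logSum (suc J) = begin
    harmonic (suc J) - fromℕ (suc J) · i            ≡⟨ cong₂ (λ a b → a - b · i) (∑-⋯-suc J inv) (fromℕ-suc J) ⟩
    harmonic J + inv (suc J) - (1ℚ + fromℕ J) · i   ≡⟨ solve 4 (λ h v J i → h :+ v :- (con 1ℚ :+ J) :* i := h :- J :* i :+ (con 1ℚ :* v :- con 1ℚ :* i)) refl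
                                                         (harmonic J) (inv (suc J)) (fromℕ J) i ⟩
    harmonic J - fromℕ J · i + (1ℚ · inv (suc J) - 1ℚ · i)
                                                    ≡⟨ cong (λ z → harmonic J - fromℕ J · i + (1ℚ · inv (suc J) - z · i)) (fromℕ·inv {suc J} (s≤s z≤n)) ⟨
    harmonic J - fromℕ J · i + (1ℚ · v - fromℕ (suc J) · v · i)
                                                    ≡⟨ cong (λ z → harmonic J - fromℕ J · i + z)
                                                         (solve 3 (λ v K i → con 1ℚ :* v :- K :* v :* i := (con 1ℚ :- K :* i) :* v) refl v (fromℕ (suc J)) i) ⟩
    harmonic J - fromℕ J · i + (1ℚ - fromℕ (suc J) · i) · v
                                                    ≤⟨ ℚ.+-mono-≤ (harmonic≤logSum J) (·-monoˡ (0≤inv (suc J)) (bernoulli (suc J))) ⟩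
    logSum n (suc J)                                ∎
    where
    open ℚ.≤-Reasoning
    i = inv n
    v = inv (suc J)

  harmonic-1≤logSum : ∀ {J} → n ≤ J → harmonic n - 1ℚ ≤ℚ logSum n J
  harmonic-1≤logSum {J} n≤J = begin
    harmonic n - 1ℚ              ≡⟨ cong (λ z → harmonic n - z) (fromℕ·inv {n} (s≤s z≤n)) ⟨
    harmonic n - fromℕ n · inv n ≤⟨ harmonic≤logSum n ⟩
    logSum n n                   ≤⟨ S-mono (ℕ.≤⇒≤′ n≤J) ⟩
    logSum n J                   ∎
    where open ℚ.≤-Reasoning

-- H + 1 ≤ 5(H - 1) is equivalent to H ≥ 3/2 = H_2; hence the constant 5 and the condition n ≥ 2.
harmonic≤5log : ∀ n .{{_ : NonZero n}} → 2 ≤ n → ∀ {J} → n ≤ J → harmonic n + 1ℚ ≤ℚ fromℕ 5 · logSum n J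
harmonic≤5log n@(suc n-1) 2≤n {J} n≤J = ℚ.≤-trans
  (≤-via (0≤q-p (fromℕ 6) (fromℕ 4 · harmonic n) (ℚ.≤-trans 6≤4H₂ (·-monoʳ (0≤fromℕ 4) H₂≤H)))
    (solve 1 (λ h → con (fromℕ 5) :* (h :- con 1ℚ) :- (h :+ con 1ℚ) := con (fromℕ 4) :* h :- con (fromℕ 6)) refl (harmonic n)))
  (·-monoʳ (0≤fromℕ 5) (harmonic-1≤logSum n-1 n≤J))
  where
  6≤4H₂ : fromℕ 6 ≤ℚ fromℕ 4 · harmonic 2
  -- Both sides evaluate to 6.
  6≤4H₂ = ℚ.≤-refl
  H₂≤H : harmonic 2 ≤ℚ harmonic n
  H₂≤H = ∑-⊆ 0≤inv (((λ ()) ∷ []) ∷ [] ∷ []) λ { (here refl) → ∈-⋯⁺ (s≤s z≤n) (ℕ.<⇒≤ 2≤n)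
                                             ; (there (here refl)) → ∈-⋯⁺ (s≤s z≤n) 2≤n }

-- Tails of the Euler product

module _ (s : ℕ) (τ : ℕ → ℕ) (1≤τ : ∀ p → 1 ≤ τ p) where

  eulerProduct weightProduct : ℕ → ℚ
  eulerProduct  m = ∏ (primes m) λ p → ρ (inv p) s (τ p)
  weightProduct m = ∏ (primes m) (weight ∘ τ)

  private
    S = fromℕ s
    P = eulerProduct
    B = weightProduct
    0≤S = 0≤fromℕ s

    1≤B : ∀ m → 1ℚ ≤ℚ B m
    1≤B m = 1≤∏ (primes m) (1≤weight ∘ τ)

    ρ′ : ℕ → ℚ
    ρ′ p = ρ (inv p) s (τ p)

    0≤ρ′ : ∀ p → 0ℚ ≤ℚ ρ′ p
    0≤ρ′ p = 0≤ρ (0≤inv p) (inv≤1 p) s (τ p)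

    ρ′≤1 : ∀ p → ρ′ p ≤ℚ 1ℚ
    ρ′≤1 p = ρ≤1 (0≤inv p) (inv≤1 p) s (τ p)

  0≤eulerProduct : ∀ m → 0ℚ ≤ℚ P m
  0≤eulerProduct m = 0≤∏ (primes m) 0≤ρ′

  eulerProduct≤1 : ∀ m → P m ≤ℚ 1ℚ
  eulerProduct≤1 m = ∏≤1 (primes m) 0≤ρ′ ρ′≤1

  eulerProduct-anti : ∀ {N} j → P (N ℕ.+ j) ≤ℚ P N
  eulerProduct-anti {N} zero rewrite ℕ.+-identityʳ N = ℚ.≤-refl
  eulerProduct-anti {N} (suc j) rewrite ℕ.+-suc N j with prime? (suc (N ℕ.+ j))
  ... | no _  = eulerProduct-anti {N} j
  ... | yes _ = ℚ.≤-trans (ℚ.≤-trans (·-monoˡ (0≤eulerProduct (N ℕ.+ j)) (ρ′≤1 (suc (N ℕ.+ j))))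
                  (ℚ.≤-reflexive (ℚ.*-identityˡ (P (N ℕ.+ j))))) (eulerProduct-anti {N} j)

  -- A prime p with τ ≥ 2 costs at most (S/p)², and these costs telescope. A prime with τ = 1 costs
  -- at most S/p ≤ S/N; it also doubles B, and since B ≥ 1 the term (S/N) B grows by at least S/N,
  -- which pays for it.
  eulerProduct-drop : ∀ {N} → 1 ≤ N → ∀ j →
    P N - P (N ℕ.+ j) ≤ℚ S · S · (inv N - inv (N ℕ.+ j)) + S · inv N · B (N ℕ.+ j)
  eulerProduct-drop {N} 1≤N zero rewrite ℕ.+-identityʳ N = ≤-via
    (0≤· (0≤· 0≤S (0≤inv N)) (ℚ.≤-trans 0≤1 (1≤B N)))
    (solve 4 (λ S i P X → S :* S :* (i :- i) :+ X :- (P :- P) := X) refl S (inv N) (P N) (S · inv N · B N))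
  eulerProduct-drop {N} 1≤N (suc j) rewrite ℕ.+-suc N j with prime? (suc (N ℕ.+ j)) | eulerProduct-drop 1≤N j
  ... | no _  | ih = ℚ.≤-trans ih (ℚ.+-monoˡ-≤ (S · inv N · B m) (·-monoʳ (0≤· 0≤S 0≤S) inv-step))
    where
    m = N ℕ.+ j
    inv-step : inv N - inv m ≤ℚ inv N - inv (suc m)
    inv-step = ℚ.+-monoʳ-≤ (inv N) (ℚ.neg-antimono-≤ (inv-antitone (ℕ.≤-trans 1≤N (ℕ.m≤m+n N j)) (ℕ.n≤1+n m)))
  ... | yes _ | ih = begin
    P N - ρₘ · P m                      ≡⟨ solve 3 (λ P r Q → P :- r :* Q := P :- Q :+ Q :* (con 1ℚ :- r)) refl (P N) ρₘ (P m) ⟩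
    P N - P m + P m · (1ℚ - ρₘ)         ≤⟨ ℚ.+-mono-≤ ih (ℚ.≤-trans (·-monoˡ (0≤q-p ρₘ 1ℚ (ρ′≤1 (suc m))) (eulerProduct≤1 m))
                                           (ℚ.≤-reflexive (ℚ.*-identityˡ (1ℚ - ρₘ)))) ⟩
    S · S · (inv N - inv m) + S · inv N · B m + (1ℚ - ρₘ)  ≤⟨ step (τ (suc m)) (1≤τ (suc m)) ⟩
    S · S · (inv N - inv (suc m)) + S · inv N · (weight (τ (suc m)) · B m) ∎
    where
    open ℚ.≤-Reasoning
    m = N ℕ.+ j
    1≤m = ℕ.≤-trans 1≤N (ℕ.m≤m+n N j)
    ρₘ = ρ′ (suc m)
    i = inv (suc m)
    step : ∀ t → 1 ≤ t → S · S · (inv N - inv m) + S · inv N · B m + (1ℚ - ρ i s t)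
                       ≤ℚ S · S · (inv N - i) + S · inv N · (weight t · B m)
    step 1 _ = begin
      S · S · (inv N - inv m) + S · inv N · B m + (1ℚ - ρ i s 1)
        ≤⟨ ℚ.+-mono-≤ (ℚ.+-monoˡ-≤ (S · inv N · B m) (·-monoʳ (0≤· 0≤S 0≤S)
             (ℚ.+-monoʳ-≤ (inv N) (ℚ.neg-antimono-≤ (inv-antitone 1≤m (ℕ.n≤1+n m))))))
             (ℚ.≤-trans (1-ρ₁≤ (0≤inv (suc m)) (inv≤1 (suc m)) s)
               (ℚ.≤-trans (·-monoʳ 0≤S (inv-antitone 1≤N (ℕ.m≤n⇒m≤1+n (ℕ.m≤m+n N j)))) (p≤p·q (0≤· 0≤S (0≤inv N)) (1≤B m)))) ⟩
      S · S · (inv N - i) + S · inv N · B m + S · inv N · B m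
        ≡⟨ solve 3 (λ A C B → A :+ C :* B :+ C :* B := A :+ C :* (con 2ℚ :* B)) refl (S · S · (inv N - i)) (S · inv N) (B m) ⟩
      S · S · (inv N - i) + S · inv N · (2ℚ · B m) ∎
    step t@(suc (suc _)) 1≤t = begin
      S · S · (inv N - inv m) + S · inv N · B m + (1ℚ - ρ i s t)
        ≤⟨ ℚ.+-monoʳ-≤ (S · S · (inv N - inv m) + S · inv N · B m) (1-ρ≤² (0≤inv (suc m)) (inv≤1 (suc m)) s (s≤s (s≤s z≤n))) ⟩
      S · S · (inv N - inv m) + S · inv N · B m + S · i · (S · i)
        ≤⟨ ≤-via (0≤· (0≤· 0≤S 0≤S) (0≤q-p (i · i + i) (inv m) (inv-telescope 1≤m)))
             (solve 5 (λ S a b i B → S :* S :* (a :- i) :+ S :* a :* (con 1ℚ :* B) :- (S :* S :* (a :- b) :+ S :* a :* B :+ S :* i :* (S :* i))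
               := S :* S :* (b :- (i :* i :+ i))) refl S (inv N) (inv m) i (B m)) ⟩
      S · S · (inv N - i) + S · inv N · (1ℚ · B m) ∎

  eulerProduct-tail : ∀ {N M} → 1 ≤ N → N ≤ M → ℚ.∣ P N - P M ∣ ≤ℚ S · S · inv N + S · inv N · B M
  eulerProduct-tail {N} {M} 1≤N N≤M with ℕ.m≤n⇒∃[o]m+o≡n N≤M
  ... | j , refl = ℚ.≤-trans (ℚ.≤-reflexive (ℚ.0≤p⇒∣p∣≡p (0≤q-p (P M) (P N) (eulerProduct-anti {N} j))))
    (ℚ.≤-trans (eulerProduct-drop 1≤N j) (ℚ.+-monoˡ-≤ (S · inv N · B M) (·-monoʳ (0≤· 0≤S 0≤S)
      (p-q≤r (inv N) (inv M) {inv N} (p≤p+q (0≤inv M))))))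

-- Squarefree divisors

prime∤⇒coprime : ∀ {p a} → Prime p → ¬ p ∣ a → Coprime a p
prime∤⇒coprime pr p∤a (d∣a , d∣p) with prime⇒irreducible pr d∣p
... | inj₁ d≡1  = d≡1
... | inj₂ refl = contradiction d∣a p∤a

-- If p ∣ e, then p² ∣ px gives p ∣ x against coprimality. Otherwise e² is coprime to p and hence
-- divides x.
squarefree-* : ∀ {p x} → Prime p → Coprime p x → Squarefree x → Squarefree (p * x)
squarefree-* {p} {x} pr p⊥x sf e e²∣px with p ∣? e
... | yes p∣e = contradiction (p⊥x (∣-refl , *-cancelˡ-∣ p {{prime⇒nonZero pr}} (∣-trans (*-pres-∣ p∣e p∣e) e²∣px)))
                  (ℕ.>⇒≢ (prime⇒2≤ pr))
... | no p∤e  = sf e (Coprime.coprime-divisor (Coprime.sym (coprime-* p⊥e p⊥e)) e²∣px)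
  where p⊥e = Coprime.sym (prime∤⇒coprime pr p∤e)

subproducts-∣ : ∀ {ps u} → PairwiseCoprime ps → All (_∣ u) ps → ∀ {d} → d ∈ subproducts ps → d ∣ u
subproducts-∣ {u = u} [] [] (here refl) = 1∣ u
subproducts-∣ {p ∷ ps} (p⊥ ∷ pc) (p∣u ∷ ∣u) d∈ with ∈-++⁻ (subproducts ps) d∈
... | inj₁ d∈′ = subproducts-∣ pc ∣u d∈′
... | inj₂ d∈′ with ∈-map⁻ (p *_) d∈′
...   | e , e∈ , refl = coprime-*∣ (subproducts-coprime ps p⊥ e∈) p∣u (subproducts-∣ pc ∣u e∈)

subproducts-squarefree : ∀ {ps} → PairwiseCoprime ps → All Prime ps → ∀ {d} → d ∈ subproducts ps → Squarefree d
subproducts-squarefree [] [] (here refl) e e²∣1 = ∣1⇒≡1 (m*n∣⇒m∣ e e e²∣1)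
subproducts-squarefree {p ∷ ps} (p⊥ ∷ pc) (pr ∷ prs) d∈ with ∈-++⁻ (subproducts ps) d∈
... | inj₁ d∈′ = subproducts-squarefree pc prs d∈′
... | inj₂ d∈′ with ∈-map⁻ (p *_) d∈′
...   | e , e∈ , refl = squarefree-* pr (subproducts-coprime ps p⊥ e∈) (subproducts-squarefree pc prs e∈)

∑-length : ∀ (xs : List X) → ∑ xs (λ _ → 1ℚ) ≡ fromℕ (length xs)
∑-length []       = refl
∑-length (x ∷ xs) = trans (cong (1ℚ +_) (∑-length xs)) (sym (fromℕ-suc (length xs)))

-- Both sides are 2^r with r the number of p in ps having τ(p) ≤ 1. The right side is prepared for
-- an embedding into the squarefree divisors of u_1.
∏-weight : ∀ τ ps → ∏ ps (weight ∘ τ) ≡ ∑ (subproducts (filter (λ p → τ p ℕ.≤? 1) ps)) (λ _ → 1ℚ)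
∏-weight τ []       = refl
∏-weight τ (p ∷ ps) with τ p ℕ.≤? 1
... | yes τp≤1 = begin
  weight (τ p) · ∏ ps (weight ∘ τ)     ≡⟨ cong₂ _·_ (weight≡2 τp≤1) (∏-weight τ ps) ⟩
  2ℚ · ∑ D (λ _ → 1ℚ)                  ≡⟨ solve 1 (λ x → con 2ℚ :* x := x :+ x) refl (∑ D (λ _ → 1ℚ)) ⟩
  ∑ D (λ _ → 1ℚ) + ∑ D (λ _ → 1ℚ)      ≡⟨ cong (∑ D (λ _ → 1ℚ) +_) (∑-map (p *_) D) ⟨
  ∑ D (λ _ → 1ℚ) + ∑ (map (p *_) D) (λ _ → 1ℚ) ≡⟨ ∑-++ D (map (p *_) D) ⟨
  ∑ (D ++ map (p *_) D) (λ _ → 1ℚ)     ≡⟨ cong (λ qs → ∑ (subproducts qs) (λ _ → 1ℚ)) (List.filter-accept (λ p → τ p ℕ.≤? 1) τp≤1) ⟨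
  ∑ (subproducts (filter (λ p → τ p ℕ.≤? 1) (p ∷ ps))) (λ _ → 1ℚ) ∎
  where
  open ≡-Reasoning
  D = subproducts (filter (λ p → τ p ℕ.≤? 1) ps)
  weight≡2 : ∀ {t} → t ≤ 1 → weight t ≡ 2ℚ
  weight≡2 z≤n       = refl
  weight≡2 (s≤s z≤n) = refl
... | no τp≰1 = trans (cong₂ _·_ (weight≡1 (ℕ.≰⇒> τp≰1)) (∏-weight τ ps)) (trans (ℚ.*-identityˡ (∑ (subproducts (filter (λ p → τ p ℕ.≤? 1) ps)) (λ _ → 1ℚ)))
  (cong (λ qs → ∑ (subproducts qs) (λ _ → 1ℚ)) (sym (List.filter-reject (λ p → τ p ℕ.≤? 1) τp≰1))))
  where
  weight≡1 : ∀ {t} → 2 ≤ t → weight t ≡ 1ℚ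
  weight≡1 (s≤s (s≤s _)) = refl

weightProduct≤θ : ∀ τ {u} → 1 ≤ u → ∀ m → (∀ {p} → τ p ≤ 1 → p ∣ u) → ∏ (primes m) (weight ∘ τ) ≤ℚ fromℕ (θ u)
weightProduct≤θ τ {u} 1≤u m τ≤1⇒∣u = begin
  ∏ (primes m) (weight ∘ τ)         ≡⟨ ∏-weight τ (primes m) ⟩
  ∑ (subproducts qs) (λ _ → 1ℚ)     ≤⟨ ∑-⊆ (λ _ → 0≤1) (subproducts-unique qs-coprime (All.map prime⇒2≤ qs-prime)) ⊆divisors ⟩
  ∑ (filter sq? (1 ⋯ u)) (λ _ → 1ℚ) ≡⟨ ∑-length (filter sq? (1 ⋯ u)) ⟩
  fromℕ (θ u)                       ∎
  where
  open ℚ.≤-Reasoning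
  small? = λ p → τ p ℕ.≤? 1
  qs = filter small? (primes m)
  sq? = λ d → (d ∣? u) ×-dec squarefree? d
  qs-coprime : PairwiseCoprime qs
  qs-coprime = AllPairs.filter⁺ small? (primes-coprime m)
  qs-prime : All Prime qs
  qs-prime = All.tabulate λ q∈ → proj₁ (∈-primes⁻ m (proj₁ (∈-filter⁻ small? q∈)))
  qs∣u : All (_∣ u) qs
  qs∣u = All.tabulate λ q∈ → τ≤1⇒∣u (proj₂ (∈-filter⁻ small? {xs = primes m} q∈))
  ⊆divisors : ∀ {d} → d ∈ subproducts qs → d ∈ filter sq? (1 ⋯ u)
  ⊆divisors d∈ = ∈-filter⁺ sq?
    (∈-⋯⁺ (1≤subproducts (All.map prime⇒1≤ qs-prime) d∈) (∣⇒≤ {{ℕ.>-nonZero 1≤u}} d∣u))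
    (d∣u , subproducts-squarefree qs-coprime qs-prime d∈)
    where d∣u = subproducts-∣ qs-coprime qs∣u d∈

-- Admissibility in terms of the number of multiples of each prime

private variable
  m : ℕ

count : ∀ {m} → ℕ → Vec ℕ m → ℕ
count p []       = 0
count p (a ∷ as) = pick (p ∣? a) 1 0 ℕ.+ count p as

∏-zero : ∀ {xs : List X} {F : X → ℚ} {x} → x ∈ xs → F x ≡ 0ℚ → ∏ xs F ≡ 0ℚ
∏-zero {xs = x ∷ xs} {F} (here refl) Fx≡0 = trans (cong (_· ∏ xs F) Fx≡0) (ℚ.*-zeroˡ (∏ xs F))
∏-zero {xs = y ∷ xs} {F} (there x∈) Fx≡0 = trans (cong (F y ·_) (∏-zero x∈ Fx≡0)) (ℚ.*-zeroʳ (F y))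

allowed-yes : ∀ ps τ (a : Vec ℕ m) → (∀ {p} → p ∈ ps → count p a < τ p) → allowed ps τ a ≡ 1ℚ
allowed-yes ps τ [] below = trans (∏-cong ps (λ {p} p∈ → ρ≡1 (τ p) (below p∈))) (∏-1 ps)
  where
  ρ≡1 : ∀ {y} t → 0 < t → ρ y 0 t ≡ 1ℚ
  ρ≡1 (suc _) _ = refl
allowed-yes ps τ (a ∷ as) below = allowed-yes ps (lower τ a) as (λ {p} p∈ → lowered p (below p∈))
  where
  lowered : ∀ p → count p (a ∷ as) < τ p → count p as < lower τ a p
  lowered p h with p ∣? a
  ... | yes _ = ℕ.∸-monoˡ-≤ 1 h
  ... | no  _ = h

allowed-no : ∀ {ps} τ (a : Vec ℕ m) {p} → p ∈ ps → τ p ≤ count p a → allowed ps τ a ≡ 0ℚ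
allowed-no τ [] {p} p∈ τp≤0 = ∏-zero p∈ (ρ≡0 (τ p) τp≤0)
  where
  ρ≡0 : ∀ {y} t → t ≤ 0 → ρ y 0 t ≡ 0ℚ
  ρ≡0 zero _ = refl
allowed-no τ (a ∷ as) {p} p∈ τp≤ = allowed-no (lower τ a) as p∈ lowered
  where
  lowered : lower τ a p ≤ count p as
  lowered with p ∣? a
  ... | yes _ = ℕ.∸-monoˡ-≤ 1 τp≤
  ... | no  _ = τp≤

multiples-subset : ∀ {p} j (a : Vec ℕ m) → j ≤ count p a → ∃ λ (I : Subset m) → ∣ I ∣ ≡ j × p ∣ gcdOver a I
multiples-subset {p = p} zero [] _ = [] , refl , (p ∣0)
multiples-subset {p = p} j (a ∷ as) j≤ with p ∣? a
multiples-subset j       (a ∷ as) j≤ | no  _ = let (I , ∣I∣ , p∣) = multiples-subset j as j≤ in outside ∷ I , ∣I∣ , p∣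
multiples-subset zero    (a ∷ as) j≤ | yes _ = let (I , ∣I∣ , p∣) = multiples-subset 0 as z≤n in outside ∷ I , ∣I∣ , p∣
multiples-subset (suc j) (a ∷ as) (s≤s j≤) | yes p∣a = let (I , ∣I∣ , p∣) = multiples-subset j as j≤ in
  inside ∷ I , cong suc ∣I∣ , gcd-greatest p∣a p∣

∣I∣≤count : ∀ {p} (a : Vec ℕ m) (I : Subset m) → p ∣ gcdOver a I → ∣ I ∣ ≤ count p a
∣I∣≤count [] [] _ = z≤n
∣I∣≤count {p = p} (a ∷ as) (outside ∷ I) p∣ = ℕ.≤-trans (∣I∣≤count as I p∣) (ℕ.m≤n+m (count p as) (pick (p ∣? a) 1 0))
∣I∣≤count {p = p} (a ∷ as) (inside ∷ I) p∣ with p ∣? a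
... | yes _  = s≤s (∣I∣≤count as I (∣-trans p∣ (gcd[m,n]∣n a (gcdOver as I))))
... | no p∤a = contradiction (∣-trans p∣ (gcd[m,n]∣m a (gcdOver as I))) p∤a

-- This makes the gcd over a nonempty index set positive and at most n, so that its prime divisors
-- all lie in `primes n`.
gcdOver-∣ : ∀ {n} {a : Vec ℕ m} → VecAll (_∈ 1 ⋯ n) a → (I : Subset m) → 1 ≤ ∣ I ∣ → ∃ λ b → b ∈ 1 ⋯ n × gcdOver a I ∣ b
gcdOver-∣ {a = a ∷ as} (a∈ ∷ _)  (inside  ∷ I) _   = a , a∈ , gcd[m,n]∣m a (gcdOver as I)
gcdOver-∣              (_ ∷ as∈) (outside ∷ I) 1≤I = gcdOver-∣ as∈ I 1≤I

tuples-∈ : ∀ {xs} m {a : Vec ℕ m} → a ∈ tuples m xs → VecAll (_∈ xs) a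
tuples-∈ zero {[]} _ = []
tuples-∈ {xs} (suc m) a∈ with ∈-cartesianProductWith⁻ _∷_ xs (tuples m xs) a∈
... | x , as , x∈ , as∈ , refl = x∈ ∷ tuples-∈ m as∈

no-prime-divisor⇒1 : ∀ {g} → 1 ≤ g → (∀ {p} → Prime p → ¬ p ∣ g) → g ≡ 1
no-prime-divisor⇒1 {g} 1≤g ∤g with factorise g {{ℕ.>-nonZero 1≤g}}
... | record { factors = [] ; isFactorisation = g≡1 } = g≡1
... | record { factors = p ∷ ps ; isFactorisation = g≡ ; factorsPrime = pr ∷ _ } =
  contradiction (subst (p ∣_) (sym g≡) (m∣m*n _)) (∤g pr)

module _ (k : ℕ) (u : Fin (k ∸ 1) → ℕ) where

  -- an admissible tuple has fewer than level p multiples of p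
  level : ℕ → ℕ
  level p = go (Fin.any? (λ i → p ∣? u i))
    where
    go : Dec (∃ λ i → p ∣ u i) → ℕ
    go (yes (i , _)) = suc (Fin.toℕ i)
    go (no _)        = k

  level-cases : ∀ p → (∃ λ i → p ∣ u i × level p ≡ suc (Fin.toℕ i)) ⊎ ((∀ i → ¬ p ∣ u i) × level p ≡ k)
  level-cases p with Fin.any? (λ i → p ∣? u i)
  ... | yes (i , p∣ui) = inj₁ (i , p∣ui , refl)
  ... | no ∄i          = inj₂ ((λ i p∣ui → ∄i (i , p∣ui)) , refl)

  level≤k : ∀ p → level p ≤ k
  level≤k p with level-cases p
  ... | inj₁ (i , _ , eq) = subst (_≤ k) (sym eq) (ℕ.≤-trans (Fin.toℕ<n i) (ℕ.m∸n≤m k 1))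
  ... | inj₂ (_ , eq)     = ℕ.≤-reflexive eq

  module _ (u-coprime : ∀ i j → i ≢ j → gcd (u i) (u j) ≡ 1) where

    divisor-unique : ∀ {p} → Prime p → ∀ {i j} → p ∣ u i → p ∣ u j → i ≡ j
    divisor-unique pr {i} {j} p∣ui p∣uj with i Fin.≟ j
    ... | yes i≡j = i≡j
    ... | no  i≢j = contradiction (∣1⇒≡1 (subst (_ ∣_) (u-coprime i j i≢j) (gcd-greatest p∣ui p∣uj))) (ℕ.>⇒≢ (prime⇒2≤ pr))

    -- `level` takes whichever index the search returns; at a prime, pairwise coprimality leaves
    -- only one.
    level-∣ : ∀ {p} → Prime p → ∀ {i} → p ∣ u i → level p ≡ suc (Fin.toℕ i)
    level-∣ {p} pr {i} p∣ui with level-cases p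
    ... | inj₁ (j , p∣uj , eq) = trans eq (cong (suc ∘ Fin.toℕ) (divisor-unique pr p∣uj p∣ui))
    ... | inj₂ (∤u , _)        = contradiction p∣ui (∤u i)

    -- If at least `level p` entries were multiples of p, exactly `level p` of them could be
    -- selected, and p would divide a gcd that admissibility keeps free of p.
    admissible⇒below : ∀ {a : Vec ℕ m} → Admissible m k u a → ∀ {p} → Prime p → count p a < level p
    admissible⇒below {a = a} (wise , wiseTo) {p} pr = ℕ.≰⇒> λ level≤ →
      let (I , ∣I∣ , p∣gcd) = multiples-subset (level p) a level≤ in p≢1 (case I ∣I∣ p∣gcd)
      where
      p≢1 : p ≢ 1
      p≢1 = ℕ.>⇒≢ (prime⇒2≤ pr)
      case : ∀ I → ∣ I ∣ ≡ level p → p ∣ gcdOver a I → p ≡ 1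
      case I ∣I∣ p∣gcd with level-cases p
      ... | inj₁ (i , p∣ui , eq) = wiseTo i I (trans ∣I∣ eq) (p∣gcd , p∣ui)
      ... | inj₂ (_ , eq)        = ∣1⇒≡1 (subst (p ∣_) (wise I (trans ∣I∣ eq)) p∣gcd)

    -- A forbidden common divisor has a prime factor p ≤ n. All entries indexed by I are then
    -- multiples of p, but I has at least `level p` elements.
    below⇒admissible : 1 ≤ k → ∀ {n} {a : Vec ℕ m} → VecAll (_∈ 1 ⋯ n) a →
      (∀ {p} → p ∈ primes n → count p a < level p) → Admissible m k u a
    below⇒admissible {m = m} 1≤k {n} {a} a∈ below = wise , wiseTo
      where
      module _ (I : Subset m) (1≤I : 1 ≤ ∣ I ∣) where
        g = gcdOver a I
        b : ∃ λ b → b ∈ 1 ⋯ n × g ∣ b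
        b = gcdOver-∣ a∈ I 1≤I
        1≤b = proj₁ (∈-⋯⁻ {n = n} (proj₁ (proj₂ b)))
        b≤n = proj₂ (∈-⋯⁻ {n = n} (proj₁ (proj₂ b)))

        1≤divisor : ∀ {d} → d ∣ g → 1 ≤ d
        1≤divisor {zero}  0∣g = contradiction (0∣⇒≡0 (∣-trans 0∣g (proj₂ (proj₂ b)))) (ℕ.>⇒≢ 1≤b)
        1≤divisor {suc d} _   = s≤s z≤n

        ∣I∣<level : ∀ {p} → Prime p → p ∣ g → ∣ I ∣ < level p
        ∣I∣<level pr p∣g = ℕ.≤-<-trans (∣I∣≤count a I p∣g) (below (∈-primes⁺ n pr
          (ℕ.≤-trans (∣⇒≤ {{ℕ.>-nonZero 1≤b}} (∣-trans p∣g (proj₂ (proj₂ b)))) b≤n)))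

      wise : WiseCoprime k a
      wise I ∣I∣≡k = no-prime-divisor⇒1 (1≤divisor I 1≤I ∣-refl) λ {p} pr p∣g →
        ℕ.<⇒≱ (∣I∣<level I 1≤I pr p∣g) (ℕ.≤-trans (level≤k p) (ℕ.≤-reflexive (sym ∣I∣≡k)))
        where 1≤I = subst (1 ≤_) (sym ∣I∣≡k) 1≤k

      wiseTo : ∀ i → WiseCoprimeTo (suc (Fin.toℕ i)) a (u i)
      wiseTo i I ∣I∣≡i {d} (d∣g , d∣ui) = no-prime-divisor⇒1 (1≤divisor I 1≤I d∣g) λ {p} pr p∣d →
        ℕ.<⇒≱ (∣I∣<level I 1≤I pr (∣-trans p∣d d∣g))
          (ℕ.≤-reflexive (trans (level-∣ pr (∣-trans p∣d d∣ui)) (sym ∣I∣≡i)))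
        where 1≤I = subst (1 ≤_) (sym ∣I∣≡i) (s≤s z≤n)

    ind-admissible : 1 ≤ k → ∀ {n} {a : Vec ℕ m} → VecAll (_∈ 1 ⋯ n) a →
      (d : Dec (Admissible m k u a)) → ind d ≡ allowed (primes n) level a
    ind-admissible 1≤k {n} {a} a∈ (yes adm) = sym (allowed-yes (primes n) level a
      (λ p∈ → admissible⇒below {a = a} adm (proj₁ (∈-primes⁻ n p∈))))
    ind-admissible 1≤k {n} {a} a∈ (no ¬adm) with All.all? (λ p → count p a ℕ.<? level p) (primes n)
    ... | yes below = contradiction (below⇒admissible 1≤k {a = a} a∈ (All.lookup below)) ¬adm
    ... | no ¬below with find (All.¬All⇒Any¬ (λ p → count p a ℕ.<? level p) (primes n) ¬below)
    ...   | p , p∈ , ≮ = sym (allowed-no level a p∈ (ℕ.≮⇒≥ ≮))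

    Q-∑ : 1 ≤ k → ∀ s n → fromℕ (Q s k u n) ≡ ∑ (tuples s (1 ⋯ n)) (allowed (primes n) level)
    Q-∑ 1≤k s n = trans (length-filter (admissible? s k u) (tuples s (1 ⋯ n)))
      (∑-cong (tuples s (1 ⋯ n)) λ {a} a∈ → ind-admissible 1≤k {a = a} (tuples-∈ s a∈) (admissible? s k u a))
      where
      length-filter : ∀ {P : X → Set} (P? : Decidable P) xs → fromℕ (length (filter P? xs)) ≡ ∑ xs (λ x → ind (P? x))
      length-filter P? [] = refl
      length-filter P? (x ∷ xs) with P? x
      ... | yes _ = trans (fromℕ-suc (length (filter P? xs))) (cong (1ℚ +_) (length-filter P? xs))
      ... | no  _ = trans (length-filter P? xs) (sym (ℚ.+-identityˡ _))

-- The local factors of the Euler product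

/≡·inv : ∀ a b .{{_ : NonZero b}} → pos a / b ≡ fromℕ a · inv b
/≡·inv a (suc b) = sym (trans (/-* a 1 b) (cong (λ c → pos c / suc b) (ℕ.*-identityʳ a)))

∑-upTo-suc : ∀ n (F : ℕ → ℚ) → ∑ (upTo (suc n)) F ≡ ∑ (upTo n) F + F n
∑-upTo-suc n F = trans (cong (λ xs → ∑ xs F) (sym (List.upTo-∷ʳ n)))
  (trans (∑-++ (upTo n) [ n ]) (cong (∑ (upTo n) F +_) (ℚ.+-identityʳ (F n))))

∑-upTo-+ : ∀ i j (F : ℕ → ℚ) → ∑ (upTo (i ℕ.+ j)) F ≡ ∑ (upTo i) F + ∑ (upTo j) (F ∘ (i ℕ.+_))
∑-upTo-+ i zero    F rewrite ℕ.+-identityʳ i = sym (ℚ.+-identityʳ (∑ (upTo i) F))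
∑-upTo-+ i (suc j) F rewrite ℕ.+-suc i j = begin
  ∑ (upTo (suc (i ℕ.+ j))) F                                    ≡⟨ ∑-upTo-suc (i ℕ.+ j) F ⟩
  ∑ (upTo (i ℕ.+ j)) F + F (i ℕ.+ j)                            ≡⟨ cong (_+ F (i ℕ.+ j)) (∑-upTo-+ i j F) ⟩
  ∑ (upTo i) F + ∑ (upTo j) (F ∘ (i ℕ.+_)) + F (i ℕ.+ j)        ≡⟨ ℚ.+-assoc (∑ (upTo i) F) (∑ (upTo j) (F ∘ (i ℕ.+_))) (F (i ℕ.+ j)) ⟩
  ∑ (upTo i) F + (∑ (upTo j) (F ∘ (i ℕ.+_)) + F (i ℕ.+ j))      ≡⟨ cong (∑ (upTo i) F +_) (∑-upTo-suc j (F ∘ (i ℕ.+_))) ⟨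
  ∑ (upTo i) F + ∑ (upTo (suc j)) (F ∘ (i ℕ.+_))                ∎
  where open ≡-Reasoning

fromℕ-sumℕ : ∀ (h : ℕ → ℕ) xs → fromℕ (sumℕ (map h xs)) ≡ ∑ xs (fromℕ ∘ h)
fromℕ-sumℕ h []       = refl
fromℕ-sumℕ h (x ∷ xs) = trans (fromℕ-+ (h x) (sumℕ (map h xs))) (cong (fromℕ (h x) +_) (fromℕ-sumℕ h xs))

nC0≡1 : ∀ n → n C 0 ≡ 1
nC0≡1 n = trans (nCk≡nC[n∸k] {0} {n} z≤n) (nCn≡1 n)

^-+ : ∀ p m n → p ^ (m ℕ.+ n) ≡ p ^ m · p ^ n
^-+ p zero    n = sym (ℚ.*-identityˡ (p ^ n))
^-+ p (suc m) n = trans (cong (p ·_) (^-+ p m n)) (sym (ℚ.*-assoc p (p ^ m) (p ^ n)))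

1^ : ∀ m → 1ℚ ^ m ≡ 1ℚ
1^ zero    = refl
1^ (suc m) = trans (ℚ.*-identityˡ (1ℚ ^ m)) (1^ m)

module _ (y : ℚ) (k-1 : ℕ) where

  private
    x = 1ℚ - y

  -- The binomial probability binom(s,m) x^(s-m) y^m up to the factor x^(k-1-s). With k - 1 in place
  -- of s the exponent is a true difference for every m < k, also when s < m, and the shape is that
  -- of the sum in A.
  term : ℕ → ℕ → ℚ
  term s m = fromℕ (s C m) · x ^ (k-1 ∸ m) · y ^ m

  binomialSum : ℕ → ℕ → ℚ
  binomialSum s τ = ∑ (upTo τ) (term s)

  private
    term-0 : ∀ s → term s 0 ≡ x ^ k-1
    term-0 s = trans (cong (λ c → fromℕ c · x ^ k-1 · 1ℚ) (nC0≡1 s))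
      (solve 1 (λ a → con 1ℚ :* a :* con 1ℚ := a) refl (x ^ k-1))

    sum-1 : ∀ s → binomialSum s 1 ≡ x ^ k-1
    sum-1 s = trans (ℚ.+-identityʳ (term s 0)) (term-0 s)

    sum-0 : ∀ τ → binomialSum 0 (suc τ) ≡ x ^ k-1
    sum-0 zero    = sum-1 0
    sum-0 (suc τ) = trans (∑-upTo-suc (suc τ) (term 0)) (trans (cong₂ _+_ (sum-0 τ) term≡0) (ℚ.+-identityʳ (x ^ k-1)))
      where
      term≡0 : term 0 (suc τ) ≡ 0ℚ
      term≡0 = trans (cong (λ c → fromℕ c · x ^ (k-1 ∸ suc τ) · y ^ suc τ) (k>n⇒nCk≡0 {0} {suc τ} (s≤s z≤n)))
        (solve 2 (λ a b → con 0ℚ :* a :* b := con 0ℚ) refl (x ^ (k-1 ∸ suc τ)) (y ^ suc τ))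

    -- Pascal's rule. The factor x compensates for an exponent of x that depends on m but not on s.
    term-pascal : ∀ s {m} → m < k-1 → x · term (suc s) (suc m) ≡ x · term s (suc m) + y · term s m
    term-pascal s {m} m<k-1 = begin
      x · (fromℕ (suc s C suc m) · ξ · (y · η))                    ≡⟨ cong (λ c → x · (c · ξ · (y · η))) (trans (cong fromℕ (sym (nCk+nC[k+1]≡[n+1]C[k+1] s m))) (fromℕ-+ (s C m) (s C suc m))) ⟩
      x · ((fromℕ (s C m) + fromℕ (s C suc m)) · ξ · (y · η))      ≡⟨ solve 6 (λ x a b ξ y η → x :* ((a :+ b) :* ξ :* (y :* η)) := x :* (b :* ξ :* (y :* η)) :+ y :* (a :* (x :* ξ) :* η)) refl
                                                                        x (fromℕ (s C m)) (fromℕ (s C suc m)) ξ y η ⟩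
      x · term s (suc m) + y · (fromℕ (s C m) · x ^ suc (k-1 ∸ suc m) · η)
                                                                   ≡⟨ cong (λ e → x · term s (suc m) + y · (fromℕ (s C m) · x ^ e · η)) (ℕ.+-∸-assoc 1 m<k-1) ⟨
      x · term s (suc m) + y · term s m                            ∎
      where
      open ≡-Reasoning
      ξ = x ^ (k-1 ∸ suc m)
      η = y ^ m

    sum-pascal : ∀ s {t} → t ≤ k-1 → x · binomialSum (suc s) (suc t) ≡ x · binomialSum s (suc t) + y · binomialSum s t
    sum-pascal s {zero} _ = trans (cong (x ·_) (trans (sum-1 (suc s)) (sym (sum-1 s))))
      (solve 3 (λ x y b → x :* b := x :* b :+ y :* con 0ℚ) refl x y (binomialSum s 1))
    sum-pascal s {suc t} t<k-1 = begin
      x · binomialSum (suc s) (2 ℕ.+ t)                             ≡⟨ cong (x ·_) (∑-upTo-suc (suc t) (term (suc s))) ⟩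
      x · (binomialSum (suc s) (suc t) + term (suc s) (suc t))      ≡⟨ ℚ.*-distribˡ-+ x (binomialSum (suc s) (suc t)) (term (suc s) (suc t)) ⟩
      x · binomialSum (suc s) (suc t) + x · term (suc s) (suc t)    ≡⟨ cong₂ _+_ (sum-pascal s (ℕ.<⇒≤ t<k-1)) (term-pascal s t<k-1) ⟩
      x · b₁ + y · b₀ + (x · term s (suc t) + y · term s t)         ≡⟨ solve 6 (λ x b₁ y b₀ u v → x :* b₁ :+ y :* b₀ :+ (x :* u :+ y :* v) := x :* (b₁ :+ u) :+ y :* (b₀ :+ v)) refl
                                                                         x b₁ y b₀ (term s (suc t)) (term s t) ⟩
      x · (b₁ + term s (suc t)) + y · (b₀ + term s t)               ≡⟨ cong₂ (λ a b → x · a + y · b) (∑-upTo-suc (suc t) (term s)) (∑-upTo-suc t (term s)) ⟨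
      x · binomialSum s (2 ℕ.+ t) + y · binomialSum s (suc t)       ∎
      where
      open ≡-Reasoning
      b₁ = binomialSum s (suc t)
      b₀ = binomialSum s t

  -- The binomial formula for P(X < τ), cross-multiplied so that no negative power of x occurs.
  ρ-binomialSum : ∀ s {τ} → τ ≤ suc k-1 → x ^ k-1 · ρ y s τ ≡ x ^ s · binomialSum s τ
  ρ-binomialSum s {zero} _ = trans (cong (x ^ k-1 ·_) (ρ-0 y s)) (trans (ℚ.*-zeroʳ (x ^ k-1)) (sym (ℚ.*-zeroʳ (x ^ s))))
  ρ-binomialSum zero {suc t} _ = trans (ℚ.*-identityʳ (x ^ k-1)) (sym (trans (ℚ.*-identityˡ (binomialSum 0 (suc t))) (sum-0 t)))
  ρ-binomialSum (suc s) {suc t} (s≤s t≤k-1) = begin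
    x ^ k-1 · (x · ρ y s (suc t) + y · ρ y s t)                   ≡⟨ solve 5 (λ p x y a b → p :* (x :* a :+ y :* b) := x :* (p :* a) :+ y :* (p :* b)) refl
                                                                       (x ^ k-1) x y (ρ y s (suc t)) (ρ y s t) ⟩
    x · (x ^ k-1 · ρ y s (suc t)) + y · (x ^ k-1 · ρ y s t)       ≡⟨ cong₂ (λ a b → x · a + y · b) (ρ-binomialSum s (s≤s t≤k-1))
                                                                       (ρ-binomialSum s (ℕ.m≤n⇒m≤1+n t≤k-1)) ⟩
    x · (x ^ s · binomialSum s (suc t)) + y · (x ^ s · binomialSum s t)
                                                                  ≡⟨ solve 5 (λ p x y a b → x :* (p :* a) :+ y :* (p :* b) := p :* (x :* a :+ y :* b)) refl
                                                                       (x ^ s) x y (binomialSum s (suc t)) (binomialSum s t) ⟩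
    x ^ s · (x · binomialSum s (suc t) + y · binomialSum s t)     ≡⟨ cong (x ^ s ·_) (sum-pascal s t≤k-1) ⟨
    x ^ s · (x · binomialSum (suc s) (suc t))                     ≡⟨ solve 3 (λ p x b → p :* (x :* b) := x :* p :* b) refl (x ^ s) x (binomialSum (suc s) (suc t)) ⟩
    x ^ suc s · binomialSum (suc s) (suc t)                       ∎
    where open ≡-Reasoning

  module _ .{{_ : ℚ.NonZero x}} where

    ^ℤ-⊖ : ∀ m j → x ^ℤ (m ⊖ j) ≡ x ^ m · (1/ x) ^ j
    ^ℤ-⊖ m       zero    = sym (ℚ.*-identityʳ (x ^ m))
    ^ℤ-⊖ zero    (suc j) = sym (ℚ.*-identityˡ ((1/ x) ^ suc j))
    ^ℤ-⊖ (suc m) (suc j) = begin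
      x ^ℤ (suc m ⊖ suc j)                   ≡⟨ cong (λ e → x ^ℤ e) (ℤ.[1+m]⊖[1+n]≡m⊖n m j) ⟩
      x ^ℤ (m ⊖ j)                           ≡⟨ ^ℤ-⊖ m j ⟩
      x ^ m · (1/ x) ^ j                     ≡⟨ ℚ.*-identityˡ _ ⟨
      1ℚ · (x ^ m · (1/ x) ^ j)              ≡⟨ cong (_· (x ^ m · (1/ x) ^ j)) (ℚ.*-inverseʳ x) ⟨
      x · 1/ x · (x ^ m · (1/ x) ^ j)        ≡⟨ solve 4 (λ a b c d → a :* b :* (c :* d) := a :* c :* (b :* d)) refl x (1/ x) (x ^ m) ((1/ x) ^ j) ⟩
      x ^ suc m · (1/ x) ^ suc j             ∎
      where open ≡-Reasoning

    ^ℤ·binomialSum : ∀ s {τ} → τ ≤ suc k-1 → x ^ℤ (pos s ℤ.- pos (suc k-1) ℤ.+ ℤ.1ℤ) · binomialSum s τ ≡ ρ y s τ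
    ^ℤ·binomialSum s {τ} τ≤k = begin
      x ^ℤ (pos s ℤ.- pos (suc k-1) ℤ.+ ℤ.1ℤ) · b        ≡⟨ cong (λ e → x ^ℤ e · b) exponent ⟩
      x ^ℤ (s ⊖ k-1) · b                                  ≡⟨ cong (_· b) (^ℤ-⊖ s k-1) ⟩
      x ^ s · (1/ x) ^ k-1 · b                            ≡⟨ solve 3 (λ a i b → a :* i :* b := i :* (a :* b)) refl (x ^ s) ((1/ x) ^ k-1) b ⟩
      (1/ x) ^ k-1 · (x ^ s · b)                          ≡⟨ cong ((1/ x) ^ k-1 ·_) (ρ-binomialSum s τ≤k) ⟨
      (1/ x) ^ k-1 · (x ^ k-1 · ρ y s τ)                  ≡⟨ ℚ.*-assoc ((1/ x) ^ k-1) (x ^ k-1) (ρ y s τ) ⟨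
      (1/ x) ^ k-1 · x ^ k-1 · ρ y s τ                    ≡⟨ cong (_· ρ y s τ) (^-distrib-· (1/ x) x k-1) ⟨
      (1/ x · x) ^ k-1 · ρ y s τ                          ≡⟨ cong (λ z → z ^ k-1 · ρ y s τ) (ℚ.*-inverseˡ x) ⟩
      1ℚ ^ k-1 · ρ y s τ                                  ≡⟨ trans (cong (_· ρ y s τ) (1^ k-1)) (ℚ.*-identityˡ (ρ y s τ)) ⟩
      ρ y s τ                                             ∎
      where
      open ≡-Reasoning
      b = binomialSum s τ
      exponent : pos s ℤ.- pos (suc k-1) ℤ.+ ℤ.1ℤ ≡ s ⊖ k-1
      exponent = trans (ℤ.distribˡ-⊖-+-pos 1 s (suc k-1))
        (trans (cong (_⊖ suc k-1) (ℕ.+-comm s 1)) (ℤ.[1+m]⊖[1+n]≡m⊖n s k-1))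

module _ (s k-1 p : ℕ) .{{nt : NonTrivial p}} where

  private
    k = suc k-1
    y = inv p
    x = 1ℚ - y
    instance
      p≢0 : NonZero p
      p≢0 = ℕ.nonTrivial⇒nonZero p
    1≤p : 1 ≤ p
    1≤p = ℕ.>-nonZero⁻¹ p

  -- (p-1)^(k-1-m) / p^(k-1) = (1 - 1/p)^(k-1-m) / p^m.
  W-term : ∀ {m} → m ≤ k-1 → fromℕ ((s C m) * (p ∸ 1) ^ⁿ (k-1 ∸ m)) · y ^ k-1 ≡ term y k-1 s m
  W-term {m} m≤k-1 = begin
    fromℕ ((s C m) * (p ∸ 1) ^ⁿ j) · y ^ k-1                ≡⟨ cong₂ _·_ (trans (fromℕ-* (s C m) ((p ∸ 1) ^ⁿ j)) (cong (fromℕ (s C m) ·_) (fromℕ-^ (p ∸ 1) j)))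
                                                                (trans (cong (y ^_) (sym (ℕ.m∸n+n≡m m≤k-1))) (^-+ y j m)) ⟩
    fromℕ (s C m) · fromℕ (p ∸ 1) ^ j · (y ^ j · y ^ m)     ≡⟨ solve 4 (λ c a b d → c :* a :* (b :* d) := c :* (a :* b) :* d) refl
                                                                (fromℕ (s C m)) (fromℕ (p ∸ 1) ^ j) (y ^ j) (y ^ m) ⟩
    fromℕ (s C m) · (fromℕ (p ∸ 1) ^ j · y ^ j) · y ^ m     ≡⟨ cong (λ z → fromℕ (s C m) · z · y ^ m) (^-distrib-· (fromℕ (p ∸ 1)) y j) ⟨
    fromℕ (s C m) · (fromℕ (p ∸ 1) · y) ^ j · y ^ m         ≡⟨ cong (λ z → fromℕ (s C m) · z ^ j · y ^ m) [p-1]y≡x ⟩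
    term y k-1 s m                                          ∎
    where
    open ≡-Reasoning
    j = k-1 ∸ m
    [p-1]y≡x : fromℕ (p ∸ 1) · y ≡ x
    [p-1]y≡x = begin
      fromℕ (p ∸ 1) · y                     ≡⟨ solve 2 (λ a y → a :* y := (con 1ℚ :+ a) :* y :- y) refl (fromℕ (p ∸ 1)) y ⟩
      (1ℚ + fromℕ (p ∸ 1)) · y - y          ≡⟨ cong (λ z → z · y - y) (trans (sym (fromℕ-suc (p ∸ 1))) (cong fromℕ (ℕ.m+[n∸m]≡n 1≤p))) ⟩
      fromℕ p · y - y                       ≡⟨ cong (_- y) (fromℕ·inv 1≤p) ⟩
      x                                     ∎

  W-sum : ∀ {i} → i ≤ k → fromℕ (W s k i p) · y ^ k-1 ≡ ∑ (upTo (k ∸ i)) (term y k-1 s ∘ (i ℕ.+_))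
  W-sum {i} i≤k = begin
    fromℕ (W s k i p) · y ^ k-1                               ≡⟨ cong (_· y ^ k-1) (trans (fromℕ-sumℕ h (i ⋯ k-1)) (∑-map (i ℕ.+_) (upTo (k ∸ i)))) ⟩
    ∑ (upTo (k ∸ i)) (fromℕ ∘ h ∘ (i ℕ.+_)) · y ^ k-1         ≡⟨ ℚ.*-comm (∑ (upTo (k ∸ i)) (fromℕ ∘ h ∘ (i ℕ.+_))) (y ^ k-1) ⟩
    y ^ k-1 · ∑ (upTo (k ∸ i)) (fromℕ ∘ h ∘ (i ℕ.+_))         ≡⟨ ∑-· (upTo (k ∸ i)) (y ^ k-1) (fromℕ ∘ h ∘ (i ℕ.+_)) ⟨
    ∑ (upTo (k ∸ i)) (λ j → y ^ k-1 · fromℕ (h (i ℕ.+ j)))    ≡⟨ ∑-cong (upTo (k ∸ i)) (λ {j} j∈ → trans (ℚ.*-comm (y ^ k-1) (fromℕ (h (i ℕ.+ j))))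
                                                                   (W-term (i+j≤k-1 (∈-upTo⁻ j∈)))) ⟩
    ∑ (upTo (k ∸ i)) (term y k-1 s ∘ (i ℕ.+_))                ∎
    where
    open ≡-Reasoning
    h = λ m → (s C m) * (p ∸ 1) ^ⁿ (k-1 ∸ m)
    i+j≤k-1 : ∀ {j} → j < k ∸ i → i ℕ.+ j ≤ k-1
    i+j≤k-1 {j} j<k∸i = ℕ.≤-pred (subst (_≤ k) (ℕ.+-suc i j)
      (ℕ.≤-trans (ℕ.+-monoʳ-≤ i j<k∸i) (ℕ.≤-reflexive (ℕ.m+[n∸m]≡n i≤k))))

  W-binomialSum : ∀ {i} → i ≤ k → binomialSum y k-1 s k ≡ binomialSum y k-1 s i + fromℕ (W s k i p) · y ^ k-1
  W-binomialSum {i} i≤k = begin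
    ∑ (upTo k) (term y k-1 s)                  ≡⟨ cong (λ j → ∑ (upTo j) (term y k-1 s)) (ℕ.m+[n∸m]≡n i≤k) ⟨
    ∑ (upTo (i ℕ.+ (k ∸ i))) (term y k-1 s)    ≡⟨ ∑-upTo-+ i (k ∸ i) (term y k-1 s) ⟩
    binomialSum y k-1 s i + ∑ (upTo (k ∸ i)) (term y k-1 s ∘ (i ℕ.+_))
                                               ≡⟨ cong (binomialSum y k-1 s i +_) (W-sum i≤k) ⟨
    binomialSum y k-1 s i + fromℕ (W s k i p) · y ^ k-1  ∎
    where open ≡-Reasoning

  f-factor : ℕ → ℚ
  f-factor i = 1ℚ - fromℕ (W s k i p) · inv (W s k 0 p)

  -- W_0 is the whole sum and W_i its tail from m = i on, so 1 - W_i/W_0 is the quotient of the sums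
  -- over m < i and over m < k, in other words the conditional probability of X < i given X < k.
  binomialSum·f-factor : ∀ {i} → i ≤ k → binomialSum y k-1 s k · f-factor i ≡ binomialSum y k-1 s i
  binomialSum·f-factor {i} i≤k = begin
    b k · (1ℚ - Wᵢ · inv W₀)                  ≡⟨ solve 3 (λ b w v → b :* (con 1ℚ :- w :* v) := b :- b :* w :* v) refl (b k) Wᵢ (inv W₀) ⟩
    b k - b k · Wᵢ · inv W₀                   ≡⟨ cong (λ z → b k - z · Wᵢ · inv W₀) (trans (W-binomialSum {0} z≤n) (ℚ.+-identityˡ (fromℕ W₀ · η))) ⟩
    b k - fromℕ W₀ · η · Wᵢ · inv W₀          ≡⟨ cong (λ z → b k - z) (solve 4 (λ a y w v → a :* y :* w :* v := a :* v :* (w :* y)) refl (fromℕ W₀) η Wᵢ (inv W₀)) ⟩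
    b k - fromℕ W₀ · inv W₀ · (Wᵢ · η)        ≡⟨ cong (λ z → b k - z · (Wᵢ · η)) (fromℕ·inv (ℕ.>-nonZero⁻¹ W₀ {{W-nonZero s k p}})) ⟩
    b k - 1ℚ · (Wᵢ · η)                       ≡⟨ cong (_- 1ℚ · (Wᵢ · η)) (W-binomialSum i≤k) ⟩
    b i + Wᵢ · η - 1ℚ · (Wᵢ · η)              ≡⟨ solve 2 (λ a z → a :+ z :- con 1ℚ :* z := a) refl (b i) (Wᵢ · η) ⟩
    b i                                       ∎
    where
    open ≡-Reasoning
    b = binomialSum y k-1 s
    Wᵢ = fromℕ (W s k i p)
    W₀ = W s k 0 p
    η = y ^ k-1

A-factor≡ρ : ∀ s k-1 p .{{_ : NonTrivial p}} → A-factor s (suc k-1) p ≡ ρ (inv p) s (suc k-1)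
A-factor≡ρ s k-1 p@(suc (suc _)) = trans
  (cong ((1-1/ p) ^ℤ (pos s ℤ.- pos (suc k-1) ℤ.+ ℤ.1ℤ) ·_) (∑-map (0 ℕ.+_) (upTo (suc k-1)) {term (inv p) k-1 s}))
  (^ℤ·binomialSum (inv p) k-1 s ℕ.≤-refl)
  where instance _ = 1-1/p-nonZero p

ρ·f-factor : ∀ s k-1 p .{{_ : NonTrivial p}} {i} → i ≤ suc k-1 → ρ (inv p) s (suc k-1) · f-factor s k-1 p i ≡ ρ (inv p) s i
ρ·f-factor s k-1 p@(suc (suc _)) {i} i≤k = begin
  ρ (inv p) s (suc k-1) · f-factor s k-1 p i      ≡⟨ cong (_· f-factor s k-1 p i) (^ℤ·binomialSum (inv p) k-1 s ℕ.≤-refl) ⟨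
  z · b (suc k-1) · f-factor s k-1 p i            ≡⟨ ℚ.*-assoc z (b (suc k-1)) (f-factor s k-1 p i) ⟩
  z · (b (suc k-1) · f-factor s k-1 p i)          ≡⟨ cong (z ·_) (binomialSum·f-factor s k-1 p i≤k) ⟩
  z · b i                                         ≡⟨ ^ℤ·binomialSum (inv p) k-1 s i≤k ⟩
  ρ (inv p) s i                                   ∎
  where
  open ≡-Reasoning
  instance _ = 1-1/p-nonZero p
  z = (1-1/ p) ^ℤ (pos s ℤ.- pos (suc k-1) ℤ.+ ℤ.1ℤ)
  b = binomialSum (inv p) k-1 s

-- Products over primes and the main term

primeProduct-∏ : ∀ {P : ℕ → Set} (P? : Decidable P) (g : (p : ℕ) .{{_ : NonTrivial p}} → ℚ) (h : ℕ → ℚ) →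
  (∀ {p} (pr : Prime p) → P p → g p {{prime⇒nonTrivial pr}} ≡ h p) →
  (∀ {p} → Prime p → ¬ P p → h p ≡ 1ℚ) → ∀ m → primeProduct P? g m ≡ ∏ (primes m) h
primeProduct-∏ P? g h yes≡ no≡ zero = refl
primeProduct-∏ P? g h yes≡ no≡ (suc m) with prime? (suc m) | P? (suc m)
... | yes pr | yes Pp = cong₂ _·_ (yes≡ pr Pp) (primeProduct-∏ P? g h yes≡ no≡ m)
... | yes pr | no ¬Pp = trans (primeProduct-∏ P? g h yes≡ no≡ m)
  (sym (trans (cong (_· ∏ (primes m) h) (no≡ pr ¬Pp)) (ℚ.*-identityˡ (∏ (primes m) h))))
... | no _   | _      = primeProduct-∏ P? g h yes≡ no≡ m

-- This brings the products over p ≤ u_i, one for each i, to a common range p ≤ m.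
∏-primes-extend : ∀ {h u} → (∀ {p} → u < p → h p ≡ 1ℚ) → ∀ {m} → u ≤ m → ∏ (primes m) h ≡ ∏ (primes u) h
∏-primes-extend {h} {u} h≡1 u≤m with ℕ.m≤n⇒∃[o]m+o≡n u≤m
... | j , refl = go j
  where
  go : ∀ j → ∏ (primes (u ℕ.+ j)) h ≡ ∏ (primes u) h
  go zero rewrite ℕ.+-identityʳ u = refl
  go (suc j) rewrite ℕ.+-suc u j with prime? (suc (u ℕ.+ j))
  ... | no _  = go j
  ... | yes _ = trans (cong₂ _·_ (h≡1 (s≤s (ℕ.m≤m+n u j))) (go j)) (ℚ.*-identityˡ (∏ (primes u) h))

∏ᶠ : ∀ {m} → (Fin m → ℚ) → ℚ
∏ᶠ F = productℚ (tabulate F)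

∏ᶠ-1 : ∀ {m} {F : Fin m → ℚ} → (∀ i → F i ≡ 1ℚ) → ∏ᶠ F ≡ 1ℚ
∏ᶠ-1 {zero}  F≡1 = refl
∏ᶠ-1 {suc m} {F} F≡1 = cong₂ _·_ (F≡1 Fin.zero) (∏ᶠ-1 (F≡1 ∘ Fin.suc))

∏ᶠ-single : ∀ {m} {F : Fin m → ℚ} i → (∀ j → i ≢ j → F j ≡ 1ℚ) → ∏ᶠ F ≡ F i
∏ᶠ-single {suc m} {F} Fin.zero    F≡1 = trans (cong (F Fin.zero ·_) (∏ᶠ-1 (λ j → F≡1 (Fin.suc j) λ ())))
  (ℚ.*-identityʳ (F Fin.zero))
∏ᶠ-single {suc m} {F} (Fin.suc i) F≡1 = trans
  (cong₂ _·_ (F≡1 Fin.zero λ ()) (∏ᶠ-single i (λ j i≢j → F≡1 (Fin.suc j) (i≢j ∘ Fin.suc-injective))))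
  (ℚ.*-identityˡ (F (Fin.suc i)))

∏ᶠ-cong : ∀ {m} {F G : Fin m → ℚ} → (∀ i → F i ≡ G i) → ∏ᶠ F ≡ ∏ᶠ G
∏ᶠ-cong F≡G = cong productℚ (List.tabulate-cong F≡G)

∏ᶠ-∏ : ∀ {m} (xs : List X) (h : Fin m → X → ℚ) → ∏ᶠ (λ i → ∏ xs (h i)) ≡ ∏ xs (λ x → ∏ᶠ (λ i → h i x))
∏ᶠ-∏ {m = zero}  xs h = sym (∏-1 xs)
∏ᶠ-∏ {m = suc m} xs h = trans (cong (∏ xs (h Fin.zero) ·_) (∏ᶠ-∏ xs (h ∘ Fin.suc)))
  (sym (∏-· xs (h Fin.zero) (λ x → ∏ᶠ (λ i → h (Fin.suc i) x))))

module _ (s k-1 : ℕ) (u : Fin k-1 → ℕ) (1≤u : ∀ i → 1 ≤ u i) (u-coprime : ∀ i j → i ≢ j → gcd (u i) (u j) ≡ 1) where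

  private
    k = suc k-1
    -- f-factor without its NonTrivial argument
    ratio : Fin k-1 → ℕ → ℚ
    ratio i p = 1ℚ - fromℕ (W s k (suc (Fin.toℕ i)) p) · inv (W s k 0 p)
    h : Fin k-1 → ℕ → ℚ
    h i p = pick (p ∣? u i) (ratio i p) 1ℚ

  f-∏ : ∀ i {m} → u i ≤ m → f s k (suc (Fin.toℕ i)) (u i) ≡ ∏ (primes m) (h i)
  f-∏ i {m} uᵢ≤m = trans
    (primeProduct-∏ (_∣? u i) _ (h i)
      (λ {p} pr p∣u → trans (cong (λ z → 1ℚ - z) (/≡·inv (W s k (suc (Fin.toℕ i)) p) (W s k 0 p) {{W-nonZero s k p {{prime⇒nonTrivial pr}}}}))
        (sym (pick-yes (p ∣? u i) p∣u)))
      (λ {p} _ p∤u → pick-no (p ∣? u i) p∤u) (u i))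
    (sym (∏-primes-extend (λ {p} u<p → pick-no (p ∣? u i) (λ p∣u → ℕ.<⇒≱ u<p (∣⇒≤ {{ℕ.>-nonZero (1≤u i)}} p∣u))) uᵢ≤m))

  -- At most one u_i is divisible by p, so at most one factor differs from 1, and that factor turns
  -- the threshold k into suc (toℕ i).
  ρ·h : ∀ {p} → Prime p → ρ (inv p) s k · ∏ᶠ (λ i → h i p) ≡ ρ (inv p) s (level k u p)
  ρ·h {p} pr with level-cases k u p
  ... | inj₁ (i , p∣uᵢ , eq) = begin
    ρ (inv p) s k · ∏ᶠ (λ i → h i p)  ≡⟨ cong (ρ (inv p) s k ·_) (trans (∏ᶠ-single i λ j i≢j → pick-no (p ∣? u j)
                                          (λ p∣uⱼ → i≢j (divisor-unique k u u-coprime pr p∣uᵢ p∣uⱼ))) (pick-yes (p ∣? u i) p∣uᵢ)) ⟩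
    ρ (inv p) s k · ratio i p         ≡⟨ ρ·f-factor s k-1 p {{prime⇒nonTrivial pr}} (ℕ.m≤n⇒m≤1+n (Fin.toℕ<n i)) ⟩
    ρ (inv p) s (suc (Fin.toℕ i))     ≡⟨ cong (ρ (inv p) s) eq ⟨
    ρ (inv p) s (level k u p)         ∎
    where open ≡-Reasoning
  ... | inj₂ (∤u , eq) = trans (cong (ρ (inv p) s k ·_) (∏ᶠ-1 (λ i → pick-no (p ∣? u i) (∤u i))))
    (trans (ℚ.*-identityʳ (ρ (inv p) s k)) (cong (ρ (inv p) s) (sym eq)))

  main-term : ∀ {m} → (∀ i → u i ≤ m) →
    ∏ (primes m) (λ p → ρ (inv p) s k) · ∏f s k u ≡ ∏ (primes m) (λ p → ρ (inv p) s (level k u p))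
  main-term {m} u≤m = begin
    ∏ (primes m) ρₖ · ∏f s k u                                    ≡⟨ cong (∏ (primes m) ρₖ ·_) (trans (∏ᶠ-cong (λ i → f-∏ i (u≤m i))) (∏ᶠ-∏ (primes m) h)) ⟩
    ∏ (primes m) ρₖ · ∏ (primes m) (λ p → ∏ᶠ (λ i → h i p))       ≡⟨ ∏-· (primes m) ρₖ (λ p → ∏ᶠ (λ i → h i p)) ⟨
    ∏ (primes m) (λ p → ρₖ p · ∏ᶠ (λ i → h i p))                  ≡⟨ ∏-cong (primes m) (λ p∈ → ρ·h (proj₁ (∈-primes⁻ m p∈))) ⟩
    ∏ (primes m) (λ p → ρ (inv p) s (level k u p))                ∎
    where
    open ≡-Reasoning
    ρₖ = λ p → ρ (inv p) s k

-- The constant A and the final estimate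

archimedean : ∀ K ε → 0ℚ <ℚ ε → ∃ λ N → 1 ≤ N × fromℕ K · inv N ≤ℚ ε
archimedean K (ℚ.mkℚ (pos zero) _ _) (*<* (+<+ ()))
archimedean K (ℚ.mkℚ ℤ.-[1+ _ ] _ _) (*<* ())
archimedean K ε@(ℚ.mkℚ (pos (suc a)) b c) _ = N , s≤s z≤n , ℚ.≤-trans
  (·inv-≤ {K} {N} {suc a} {suc b} (s≤s z≤n) (s≤s z≤n) (ℕ.≤-trans (ℕ.n≤1+n (K * suc b)) (ℕ.m≤m+n N (a * N))))
  (ℚ.≤-reflexive (trans (sym (/≡·inv (suc a) (suc b))) (ℚ.fromℚᵘ-toℚᵘ ε)))
  -- N > K(b + 1) gives K/N ≤ 1/(b + 1) ≤ ε, and the successor keeps N positive when K = 0.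
  where N = suc (K * suc b)

approx-^ʳ : ∀ x d m → ℝ.approx (x ^ʳ d) m ≡ ℝ.approx x m ^ d
approx-^ʳ x zero    m = refl
approx-^ʳ x (suc d) m = cong (ℝ.approx x m ·_) (approx-^ʳ x d m)

approx-log : ∀ n .{{_ : NonZero n}} m → ℝ.approx (log n) m ≡ logSum n m
approx-log (suc _) m = refl

cauchy⇒⟶ : ∀ x c → x ⟶ mkℝ x c
cauchy⇒⟶ x c ε 0<ε with c ε 0<ε
... | N , h = N , λ m N≤m ε′ 0<ε′ → N , λ m′ N≤m′ → ℚ.≤-trans (h m m′ N≤m N≤m′) (p≤p+q (ℚ.<⇒≤ 0<ε′))

∈⇒≤maxℕ : ∀ {x} xs → x ∈ xs → x ≤ maxℕ xs
∈⇒≤maxℕ (x ∷ xs) (here refl) = ℕ.m≤m⊔n x (maxℕ xs)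
∈⇒≤maxℕ (y ∷ xs) (there x∈)  = ℕ.≤-trans (∈⇒≤maxℕ xs x∈) (ℕ.m≤n⊔m y (maxℕ xs))

s∸1≤δ : ∀ s {k} → 2 ≤ k → s ∸ 1 ≤ δ s k
s∸1≤δ s (s≤s 1≤k-1) = ℕ.≤-trans (ℕ.≤-reflexive (sym (nC1≡n (s ∸ 1))))
  (∈⇒≤maxℕ _ (∈-map⁺ ((s ∸ 1) C_) (∈-⋯⁺ (s≤s z≤n) 1≤k-1)))

harmonic-log : ∀ s {k} → 2 ≤ k → ∀ n .{{_ : NonZero n}} → (2 ≤ n ⊎ δ s k ≡ 0) → ∀ {m} → n ≤ m →
  (harmonic n + 1ℚ) ^ (s ∸ 1) ≤ℚ fromℕ 5 ^ δ s k · logSum n m ^ δ s k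
harmonic-log s {k} 2≤k n (inj₁ 2≤n) {m} n≤m = begin
  (harmonic n + 1ℚ) ^ (s ∸ 1)               ≤⟨ ^-monoˡ (s ∸ 1) (0≤+ 0≤H 0≤1) H≤5ℓ ⟩
  -- δ may be larger than s - 1; the exponent can be raised because 1 ≤ H + 1 ≤ 5 log n.
  (fromℕ 5 · logSum n m) ^ (s ∸ 1)          ≤⟨ ^-monoʳ {m = s ∸ 1} {δ s k} (ℚ.≤-trans (ℚ.+-monoˡ-≤ 1ℚ 0≤H) H≤5ℓ) (s∸1≤δ s 2≤k) ⟩
  (fromℕ 5 · logSum n m) ^ δ s k            ≡⟨ ^-distrib-· (fromℕ 5) (logSum n m) (δ s k) ⟩
  fromℕ 5 ^ δ s k · logSum n m ^ δ s k      ∎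
  where
  open ℚ.≤-Reasoning
  0≤H = 0≤∑ (1 ⋯ n) 0≤inv
  H≤5ℓ = harmonic≤5log n 2≤n n≤m
-- δ = 0 forces s ∸ 1 = 0, so all powers are empty. This admits n = 1, where the logarithm vanishes.
harmonic-log s {k} 2≤k n (inj₂ δ≡0) {m} _ = ℚ.≤-reflexive (trans (cong ((harmonic n + 1ℚ) ^_) s∸1≡0)
  (sym (cong (λ d → fromℕ 5 ^ d · logSum n m ^ d) δ≡0)))
  where
  s∸1≡0 : s ∸ 1 ≡ 0
  s∸1≡0 = ℕ.n≤0⇒n≡0 (subst (s ∸ 1 ≤_) δ≡0 (s∸1≤δ s 2≤k))

module _ (s-1 k-2 : ℕ) where

  private
    s = suc s-1
    k = suc (suc k-2)
    S = fromℕ s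
    0≤S = 0≤fromℕ s

  P : ℕ → ℚ
  P = primeProduct {λ _ → ⊤} (λ _ → yes tt) (A-factor s k)

  private
    P-∏ : ∀ m → P m ≡ eulerProduct s (λ _ → k) (λ _ → s≤s z≤n) m
    P-∏ = primeProduct-∏ _ (A-factor s k) _ (λ {p} pr _ → A-factor≡ρ s (suc k-2) p {{prime⇒nonTrivial pr}}) (λ _ ¬⊤ → contradiction tt ¬⊤)

  -- The tail estimate for the constant threshold k ≥ 2: all weights are 1, so the tail beyond N is
  -- at most (s² + s)/N.
  A-cauchy : IsCauchy P
  A-cauchy ε 0<ε with archimedean (s * s ℕ.+ s) ε 0<ε
  ... | N , 1≤N , bound = N , λ i j N≤i N≤j → close i j N≤i N≤j (ℕ.≤-total i j)
    where
    P′ = eulerProduct s (λ _ → k) (λ _ → s≤s z≤n)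
    ordered : ∀ {i j} → N ≤ i → i ≤ j → ℚ.∣ P i - P j ∣ ≤ℚ ε
    ordered {i} {j} N≤i i≤j = begin
      ℚ.∣ P i - P j ∣             ≡⟨ cong₂ (λ a b → ℚ.∣ a - b ∣) (P-∏ i) (P-∏ j) ⟩
      ℚ.∣ P′ i - P′ j ∣           ≤⟨ eulerProduct-tail s (λ _ → k) (λ _ → s≤s z≤n) (ℕ.≤-trans 1≤N N≤i) i≤j ⟩
      S · S · inv i + S · inv i · ∏ (primes j) (λ _ → 1ℚ)  ≡⟨ cong (λ b → S · S · inv i + S · inv i · b) (∏-1 (primes j)) ⟩
      S · S · inv i + S · inv i · 1ℚ  ≡⟨ solve 2 (λ S i → S :* S :* i :+ S :* i :* con 1ℚ := (S :* S :+ S) :* i) refl S (inv i) ⟩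
      (S · S + S) · inv i         ≡⟨ cong (_· inv i) (trans (fromℕ-+ (s * s) s) (cong (_+ S) (fromℕ-* s s))) ⟨
      fromℕ (s * s ℕ.+ s) · inv i ≤⟨ ·-monoʳ (0≤fromℕ (s * s ℕ.+ s)) (inv-antitone 1≤N N≤i) ⟩
      fromℕ (s * s ℕ.+ s) · inv N ≤⟨ bound ⟩
      ε                           ∎
      where open ℚ.≤-Reasoning
    close : ∀ i j → N ≤ i → N ≤ j → i ≤ j ⊎ j ≤ i → ℚ.∣ P i - P j ∣ ≤ℚ ε
    close i j N≤i N≤j (inj₁ i≤j) = ordered N≤i i≤j
    close i j N≤i N≤j (inj₂ j≤i) = subst (_≤ℚ ε) (∣p-q∣-sym (P j) (P i)) (ordered N≤j j≤i)

  -- One S comes from `Q-error`, S · S + S from `tail-error`, and the power of 5 from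
  -- `harmonic≤5log`.
  constant : ℚ
  constant = (S + S · S + S) · fromℕ 5 ^ δ s k

  module _ (n : ℕ) .{{_ : NonZero n}} (n-large : 2 ≤ n ⊎ δ s k ≡ 0)
           (u : Fin (suc k-2) → ℕ) (1≤u : ∀ i → 1 ≤ u i) (u-coprime : ∀ i j → i ≢ j → gcd (u i) (u j) ≡ 1)
           (m : ℕ) (n≤m : n ≤ m) (u≤m : ∀ i → u i ≤ m) where

    private
      1≤n = ℕ.>-nonZero⁻¹ n
      τ = level k u
      N = fromℕ n
      Θ = fromℕ (θ (u Fin.zero))
      Λ = fromℕ 5 ^ δ s k · logSum n m ^ δ s k

      1≤τ : ∀ p → 1 ≤ τ p
      1≤τ p with level-cases k u p
      ... | inj₁ (i , _ , eq) = subst (1 ≤_) (sym eq) (s≤s z≤n)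
      ... | inj₂ (_ , eq)     = subst (1 ≤_) (sym eq) (s≤s z≤n)

      τ≤1⇒∣u₁ : ∀ {p} → τ p ≤ 1 → p ∣ u Fin.zero
      τ≤1⇒∣u₁ {p} τp≤1 with level-cases k u p
      ... | inj₂ (_ , eq) with s≤s () ← subst (_≤ 1) eq τp≤1
      ... | inj₁ (Fin.zero , p∣u , _)   = p∣u
      ... | inj₁ (Fin.suc i , _ , eq) with s≤s () ← subst (_≤ 1) eq τp≤1

      R B : ℕ → ℚ
      R = eulerProduct s τ 1≤τ
      B = weightProduct s τ 1≤τ

      B≤Θ : ∀ m → B m ≤ℚ Θ
      B≤Θ m = weightProduct≤θ τ (1≤u Fin.zero) m τ≤1⇒∣u₁

      1≤Θ : 1ℚ ≤ℚ Θ
      1≤Θ = ℚ.≤-trans (1≤∏ (primes n) (1≤weight ∘ τ)) (B≤Θ n)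
      0≤Θ = ℚ.≤-trans 0≤1 1≤Θ

      open Core n 1≤n (primes n) (primes-coprime n) (1≤primes n) using (L; 0≤L; 1≤L; err; 0≤err; err-suc; count-error)

      L^≤Λ : L ^ s-1 ≤ℚ Λ
      L^≤Λ = ℚ.≤-trans
        (^-monoˡ s-1 0≤L (E-inv≤ 1≤n (primes-coprime n) (All.tabulate λ p∈ → prime⇒2≤ (proj₁ (∈-primes⁻ n p∈)))))
        (harmonic-log s {k} (s≤s (s≤s z≤n)) n n-large n≤m)

      1≤Λ : 1ℚ ≤ℚ Λ
      1≤Λ = ℚ.≤-trans (1≤^ s-1 1≤L) L^≤Λ
      0≤Λ = ℚ.≤-trans 0≤1 1≤Λ

      Q-error : ℚ.∣ fromℕ (Q s k u n) - N ^ s · R n ∣ ≤ℚ S · (N ^ s-1 · Λ) · Θ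
      Q-error = begin
        ℚ.∣ fromℕ (Q s k u n) - N ^ s · R n ∣  ≡⟨ cong (λ q → ℚ.∣ q - N ^ s · R n ∣) (Q-∑ k u u-coprime (s≤s z≤n) s n) ⟩
        ℚ.∣ ∑ (tuples s (1 ⋯ n)) (allowed (primes n) τ) - N ^ s · R n ∣  ≤⟨ count-error s τ ⟩
        err s · B n                            ≤⟨ ·-monoʳ (0≤err s) (B≤Θ n) ⟩
        err s · Θ                              ≡⟨ cong (_· Θ) (trans (err-suc s-1) (cong (S ·_) (^-distrib-· N L s-1))) ⟩
        S · (N ^ s-1 · L ^ s-1) · Θ            ≤⟨ ·-monoˡ 0≤Θ (·-monoʳ 0≤S (·-monoʳ (0≤^ s-1 (0≤fromℕ n)) L^≤Λ)) ⟩
        S · (N ^ s-1 · Λ) · Θ                  ∎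
        where open ℚ.≤-Reasoning

      N^s·inv : N ^ s · inv n ≡ N ^ s-1
      N^s·inv = trans (solve 3 (λ N M i → N :* M :* i := M :* (N :* i)) refl N (N ^ s-1) (inv n))
        (trans (cong (N ^ s-1 ·_) (fromℕ·inv 1≤n)) (ℚ.*-identityʳ (N ^ s-1)))

      -- The factor 1/n of the Euler tail lowers n^s to n^(s-1). The bound Θ for `B m` is uniform in
      -- m, since all primes with τ ≤ 1 divide u_1.
      tail-error : ℚ.∣ N ^ s · (R n - R m) ∣ ≤ℚ (S · S + S) · (N ^ s-1 · Λ) · Θ
      tail-error = begin
        ℚ.∣ N ^ s · (R n - R m) ∣                      ≡⟨ 0≤p⇒∣p·q∣≡p·∣q∣ 0≤Nˢ (R n - R m) ⟩
        N ^ s · ℚ.∣ R n - R m ∣                        ≤⟨ ·-monoʳ 0≤Nˢ (eulerProduct-tail s τ 1≤τ 1≤n n≤m) ⟩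
        N ^ s · (S · S · inv n + S · inv n · B m)      ≡⟨ solve 4 (λ M S i B → M :* (S :* S :* i :+ S :* i :* B) := M :* i :* (S :* S :+ S :* B)) refl
                                                            (N ^ s) S (inv n) (B m) ⟩
        N ^ s · inv n · (S · S + S · B m)              ≡⟨ cong (_· (S · S + S · B m)) N^s·inv ⟩
        N ^ s-1 · (S · S + S · B m)                    ≤⟨ ·-monoʳ 0≤N (ℚ.+-mono-≤ (p≤p·q (0≤· 0≤S 0≤S) 1≤Θ) (·-monoʳ 0≤S (B≤Θ m))) ⟩
        N ^ s-1 · (S · S · Θ + S · Θ)                  ≡⟨ solve 3 (λ M S T → M :* (S :* S :* T :+ S :* T) := (S :* S :+ S) :* M :* T) refl (N ^ s-1) S Θ ⟩
        (S · S + S) · N ^ s-1 · Θ                      ≤⟨ ·-monoˡ 0≤Θ (·-monoʳ (0≤+ (0≤· 0≤S 0≤S) 0≤S) (p≤p·q 0≤N 1≤Λ)) ⟩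
        (S · S + S) · (N ^ s-1 · Λ) · Θ                ∎
        where
        open ℚ.≤-Reasoning
        0≤Nˢ = 0≤^ s (0≤fromℕ n)
        0≤N = 0≤^ s-1 (0≤fromℕ n)

    -- The estimate for the rational approximants at one index m. Since every u_i ≤ m, the partial
    -- product of A times `∏f` is exactly `R m`; passing from `R m` to `R n` is left to
    -- `tail-error`.
    error-bound : ℚ.∣ fromℕ (Q s k u n) - P m · ∏f s k u · fromℕ (n ^ⁿ s) ∣
                ≤ℚ constant · (fromℕ (θ (u Fin.zero) * n ^ⁿ s-1) · ℝ.approx (log n ^ʳ δ s k) m)
    error-bound = begin
      ℚ.∣ Qₙ - P m · ∏f s k u · fromℕ (n ^ⁿ s) ∣
        ≡⟨ cong (λ z → ℚ.∣ Qₙ - z ∣) (cong₂ _·_ (trans (cong (_· ∏f s k u) (P-∏ m)) (main-term s (suc k-2) u 1≤u u-coprime u≤m)) (fromℕ-^ n s)) ⟩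
      ℚ.∣ Qₙ - R m · N ^ s ∣
        ≡⟨ cong ℚ.∣_∣ (solve 4 (λ q r M r′ → q :- r :* M := q :- M :* r′ :+ M :* (r′ :- r)) refl Qₙ (R m) (N ^ s) (R n)) ⟩
      ℚ.∣ Qₙ - N ^ s · R n + N ^ s · (R n - R m) ∣
        ≤⟨ ℚ.≤-trans (ℚ.∣p+q∣≤∣p∣+∣q∣ (Qₙ - N ^ s · R n) (N ^ s · (R n - R m))) (ℚ.+-mono-≤ Q-error tail-error) ⟩
      S · (N ^ s-1 · Λ) · Θ + (S · S + S) · (N ^ s-1 · Λ) · Θ
        ≡⟨ solve 5 (λ S M F l T → S :* (M :* (F :* l)) :* T :+ (S :* S :+ S) :* (M :* (F :* l)) :* T := (S :+ S :* S :+ S) :* F :* (T :* M :* l)) refl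
             S (N ^ s-1) (fromℕ 5 ^ δ s k) (logSum n m ^ δ s k) Θ ⟩
      constant · (Θ · N ^ s-1 · logSum n m ^ δ s k)
        ≡⟨ cong (constant ·_) (cong₂ _·_
             (trans (fromℕ-* (θ (u Fin.zero)) (n ^ⁿ s-1)) (cong (Θ ·_) (fromℕ-^ n s-1)))
             (trans (approx-^ʳ (log n) (δ s k) m) (cong (_^ δ s k) (approx-log n m)))) ⟨
      constant · (fromℕ (θ (u Fin.zero) * n ^ⁿ s-1) · ℝ.approx (log n ^ʳ δ s k) m) ∎
      where
      open ℚ.≤-Reasoning
      Qₙ = fromℕ (Q s k u n)

theorem1 : (s k : ℕ) → 1 ≤ s → (2≤k : 2 ≤ k) →
    Σ[ A ∈ ℝ ] (A IsProductOverPrimesOf A-factor s k) ×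
    (Σ[ C ∈ ℝ ]
    ((n : ℕ) .{{_ : NonZero n}} → (2 ≤ n ⊎ δ s k ≡ 0) →
    (u : Fin (k ∸ 1) → ℕ) → (∀ i → 1 ≤ u i) →
    (∀ i j → i ≢ j → gcd (u i) (u j) ≡ 1) →
    ∣ fromℚ (fromℕ (Q s k u n)) -ʳ A *ʳ fromℚ (∏f s k u) *ʳ fromℚ (fromℕ (n ^ⁿ s)) ∣ʳ
    ≤ʳ C *ʳ (fromℚ (fromℕ (θ (u (first 2≤k)) * n ^ⁿ (s ∸ 1))) *ʳ log n ^ʳ δ s k)))
theorem1 (suc s-1) (suc (suc k-2)) (s≤s z≤n) (s≤s (s≤s z≤n)) =
  mkℝ (P s-1 k-2) (A-cauchy s-1 k-2) , cauchy⇒⟶ (P s-1 k-2) (A-cauchy s-1 k-2) , fromℚ (constant s-1 k-2) ,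
  -- This index is at least n and at least every u_i. From there on the inequality holds without the
  -- slack ε.
  λ n n-large u 1≤u u-coprime ε 0<ε → n ℕ.⊔ sumℕ (tabulate u) , λ m h → ℚ.≤-trans
    (error-bound s-1 k-2 n n-large u 1≤u u-coprime m (≤⊔ˡ h)
      (λ i → ℕ.≤-trans (∈⇒≤sumℕ (tabulate u) (∈-tabulate⁺ {f = u} i)) (≤⊔ʳ {n} h)))
    (p≤p+q (ℚ.<⇒≤ 0<ε))
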